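{- The repeated control state reachability problem is decidable for vector addition systems with states and one zero-test: given such a system $\mathcal V=\langle A,a_z,\delta,\vec x_{in},Q,T,q_{in}\rangle$ of dimension $d$ and a control state $q_f\in Q$, one can decide whether $q_f$ is visited infinitely often.
   Context: A VASSZ of dimension $d$ is $\mathcal V=\langle A,a_z,\delta,\vec x_{in},Q,T,q_{in}\rangle$ where $A$ is a finite alphabet, $a_z\notin A$, $\delta:A\cup\{a_z\}\to\mathbb Z^d$, $\vec x_{in}\in\mathbb N^d$, $Q$ a nonempty finite set of control states, $T\subseteq Q\times(A\cup\{a_z\})\times Q$ a finite set of transitions and $q_{in}\in Q$. States are pairs $(q,\vec x)\in Q\times\mathbb N^d$. For $a\in A$: $(p,\vec x)\xrightarrow{a}(q,\vec y)$ iff $(p,a,q)\in T$ and $\vec y-\vec x=\delta(a)$; $(p,\vec x)\xrightarrow{a_z}(q,\vec y)$ iff $(p,a_z,q)\in T$, $\vec y-\vec x=\delta(a_z)$ and $\vec x(1)=0$. Extend to words by composition; $\xrightarrow{*}$ (resp. $\xrightarrow{+}$) is the union over all words (resp. all nonempty words). A control state $q_f$ is visited infinitely often if there is an infinite sequence $(\vec x_j)_{j>0}$ in $\mathbb N^d$ with $(q_{in},\vec x_{in})\xrightarrow{*}(q_f,\vec x_1)$ and $(q_f,\vec x_j)\xrightarrow{+}(q_f,\vec x_{j+1})$ for all $j>0$. -}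

module Defs where

open import Data.Nat using (ℕ; suc)
open import Data.Integer as ℤ using (ℤ; +_)
open import Data.Fin using (Fin; zero)
open import Data.Vec using (Vec; lookup)
open import Data.List using (List)
open import Data.List.Membership.Propositional using (_∈_)
open import Data.Product using (_×_; _,_; Σ; ∃)
open import Relation.Binary.PropositionalEquality using (_≡_)

-- Labels: the finite alphabet A is Fin nA; 'zt' is the extra zero-test letter a_z ∉ A.
data Label (nA : ℕ) : Set where
  letter : Fin nA → Label nA
  zt     : Label nA

-- A VASSZ of dimension d (d = suc d', so that coordinate 1, i.e. index zero, exists).
-- Q is Fin (suc nQ) (nonempty finite set); T is a finite list of transitions.
record VASSZ (d : ℕ) : Set where
  field
    nA   : ℕ
    δ    : Label nA → Vec ℤ d
    xin  : Vec ℕ d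
    nQ   : ℕ
    T    : List (Fin (suc nQ) × Label nA × Fin (suc nQ))
    qin  : Fin (suc nQ)

  St : Set
  St = Fin (suc nQ)

  Config : Set
  Config = St × Vec ℕ d

  Shift : Label nA → Vec ℕ d → Vec ℕ d → Set
  Shift a x y = ∀ i → + lookup y i ≡ + lookup x i ℤ.+ lookup (δ a) i

open VASSZ public

data Step {d : ℕ} (V : VASSZ (suc d)) : Config V → Label (nA V) → Config V → Set where
  stepA : ∀ {p q x y} (a : Fin (nA V)) →
          (p , letter a , q) ∈ T V → Shift V (letter a) x y →
          Step V (p , x) (letter a) (q , y)
  stepZ : ∀ {p q x y} →
          (p , zt , q) ∈ T V → Shift V zt x y → lookup x zero ≡ 0 →
          Step V (p , x) zt (q , y)

data Reach* {d : ℕ} (V : VASSZ (suc d)) : Config V → Config V → Set where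
  done : ∀ {c} → Reach* V c c
  more : ∀ {c c' c''} (a : Label (nA V)) → Step V c a c' → Reach* V c' c'' → Reach* V c c''

data Reach+ {d : ℕ} (V : VASSZ (suc d)) : Config V → Config V → Set where
  more : ∀ {c c' c''} (a : Label (nA V)) → Step V c a c' → Reach* V c' c'' → Reach+ V c c''

-- q_f is visited infinitely often (sequence indexed from 0 instead of 1)
VisitedInfinitelyOften : {d : ℕ} (V : VASSZ (suc d)) → St V → Set
VisitedInfinitelyOften V qf =
  Σ (ℕ → Vec ℕ _) λ x →
    Reach* V (qin V , xin V) (qf , x 0) ×
    (∀ j → Reach+ V (qf , x j) (qf , x (suc j)))

{-# OPTIONS --safe #-}
-- A relation on ℕᵏ is described by a cover: finitely many affine images of sets having Lambert's
-- pumping property, hereditarily when coordinates are fixed. Covers decide emptiness and are closed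
-- under union, projection and linear constraints. The core is that the reflexive transitive closure
-- of a monotone relation with a cover again has a cover, by the Mayr–Kosaraju–Lambert decomposition
-- and induction on k: if the linear equations satisfied by the runs bound the use of an edge or of
-- one of its parameters, the runs are cut at these uses; if the runs cannot be pumped at one of
-- their ends, Karp–Miller trees show that one coordinate stays bounded, and it becomes control
-- state; otherwise all large multiples of the homogeneous solutions are realised by runs.
--
-- This is applied to the letters, and then once more, one dimension lower, to the rounds between
-- successive zero-tests, which are monotone relations between configurations with first
-- coordinate 0. So the reachability relation of the whole system has a cover. By Dickson's lemma,
-- q_f is visited infinitely often iff some reachable configuration can be followed by a larger one,
-- either at q_f using letters only, or visiting q_f with first coordinate 0 at both ends; both
-- conditions are emptiness problems for covers.

module Submission where

open import Defs
open import Algebra.Bundles using (CommutativeMonoid)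
import Algebra.Solver.CommutativeMonoid as CMSolver
open import Data.Bool using (Bool; true; false; if_then_else_; _∨_)
import Data.Bool.Properties as Boolₚ
open import Data.Empty using (⊥)
open import Data.Fin as Fin using (Fin; zero; suc)
import Data.Fin.Properties as Finₚ
open import Data.Integer as ℤ using (ℤ; -[1+_]) renaming (+_ to ⁺_)
import Data.Integer.Properties as ℤₚ
open import Data.List as List using (List; []; _∷_; length)
open import Data.List.Membership.Propositional using (_∈_; find; lose)
open import Data.List.Membership.Propositional.Properties
open import Data.List.Relation.Unary.All as All using (All; []; _∷_)
open import Data.List.Relation.Unary.Any as Any using (Any; here; there)
import Data.List.Relation.Unary.Any.Properties as Anyₚ
open import Data.Nat
open import Data.Nat.Induction using (<-wellFounded)
open import Data.Nat.Properties
open import Data.Nat.Tactic.RingSolver using (solve-∀)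
open import Data.Product using (∃; _×_; _,_; proj₁; proj₂)
open import Data.Sum as Sum using (_⊎_; inj₁; inj₂)
open import Data.Unit using (⊤; tt)
open import Data.Vec as Vec using (Vec; []; _∷_; lookup; zipWith; replicate)
open import Data.Vec.Properties using (lookup-zipWith; lookup-replicate; lookup∘tabulate; lookup-map; zipWith-assoc; zipWith-comm; zipWith-identityˡ; take-zipWith; drop-zipWith; ∷-injective; insertAt-removeAt)
open import Function using (_∘_; id; case_of_)
open import Induction.WellFounded using (Acc; acc)
open import Relation.Binary.Construct.Closure.ReflexiveTransitive as Star using (Star; ε; _◅_; _◅◅_)
open import Relation.Binary.PropositionalEquality hiding ([_]; J)
open import Relation.Nullary using (¬_; Dec; yes; no; contradiction)
open import Relation.Nullary.Decidable using (_×-dec_; _⊎-dec_; map′)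

-- A cover approximates from two sides, and its two sets are used differently: elements of the lower
-- set only have to be sorted into cases, elements of the upper set have to be produced, by pumping.
-- In the closure theorem the lower set consists of runs with given steps, the upper one of runs
-- whose steps may be translated; monotonicity is therefore a hypothesis on the upper relation.
-- Pieces may overlap or be enlarged, so complements never have to be formed. Where both sets
-- coincide the description is exact, and this is how emptiness gets decided.
--
-- Membership in a covered set is never tested. Case distinctions inspect affine maps: whether a
-- coordinate varies along a parametrisation is read off from the linear part at `𝟙`. Termination
-- comes from structural recursion on trees, well-founded recursion on lists of edges, and bars for
-- Dickson's order, so the argument is itself the algorithm.

-- Cancellative commutative monoids, vectors and affine maps

record CMon : Set₁ where
  infixr 6 _⊕_
  field
    C       : Set
    _⊕_     : C → C → C
    0#       : C
    assoc   : ∀ x y z → (x ⊕ y) ⊕ z ≡ x ⊕ (y ⊕ z)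
    comm    : ∀ x y → x ⊕ y ≡ y ⊕ x
    idˡ     : ∀ x → 0# ⊕ x ≡ x
    cancelˡ : ∀ x {y z} → x ⊕ y ≡ x ⊕ z → y ≡ z

  idʳ : ∀ x → x ⊕ 0# ≡ x
  idʳ x = trans (comm x 0#) (idˡ x)

  mul : ℕ → C → C
  mul zero    x = 0#
  mul (suc n) x = x ⊕ mul n x

  bundle : CommutativeMonoid _ _
  bundle = record
    { Carrier = C ; _≈_ = _≡_ ; _∙_ = _⊕_ ; ε = 0#
    ; isCommutativeMonoid = record
      { isMonoid = record
        { isSemigroup = record
          { isMagma = record { isEquivalence = isEquivalence ; ∙-cong = cong₂ _⊕_ }
          ; assoc = assoc }
        ; identity = idˡ , idʳ }
      ; comm = comm } }

  interchange : ∀ a b c d → (a ⊕ b) ⊕ (c ⊕ d) ≡ (a ⊕ c) ⊕ (b ⊕ d)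
  interchange = CMSolver.solve bundle 4 (λ a b c d → (a S.⊕ b) S.⊕ (c S.⊕ d) S.⊜ (a S.⊕ c) S.⊕ (b S.⊕ d)) refl
    where module S = CMSolver bundle

  mul-+ : ∀ m n x → mul (m + n) x ≡ mul m x ⊕ mul n x
  mul-+ zero    n x = sym (idˡ _)
  mul-+ (suc m) n x = trans (cong (x ⊕_) (mul-+ m n x)) (sym (assoc _ _ _))

  mul-⊕ : ∀ n x y → mul n (x ⊕ y) ≡ mul n x ⊕ mul n y
  mul-⊕ zero    x y = sym (idˡ 0#)
  mul-⊕ (suc n) x y = trans (cong ((x ⊕ y) ⊕_) (mul-⊕ n x y)) (interchange x y _ _)

  mul-0 : ∀ n → mul n 0# ≡ 0#
  mul-0 zero = refl
  mul-0 (suc n) = trans (idˡ _) (mul-0 n)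

  mul-* : ∀ m n x → mul (m * n) x ≡ mul m (mul n x)
  mul-* zero    n x = refl
  mul-* (suc m) n x = trans (mul-+ n (m * n) x) (cong (mul n x ⊕_) (mul-* m n x))

open CMon public using () renaming (C to ∣_∣)

infixr 6 _+v_
_+v_ : ∀ {n} → Vec ℕ n → Vec ℕ n → Vec ℕ n
_+v_ = zipWith _+_

𝟘 𝟙 : ∀ {n} → Vec ℕ n
𝟘 = replicate _ 0
𝟙 = replicate _ 1

+v-cancelˡ : ∀ {n} (x : Vec ℕ n) {y z} → x +v y ≡ x +v z → y ≡ z
+v-cancelˡ []      {[]}    {[]}    _  = refl
+v-cancelˡ (a ∷ x) {b ∷ y} {c ∷ z} eq =
  cong₂ _∷_ (+-cancelˡ-≡ a b c (proj₁ (∷-injective eq))) (+v-cancelˡ x (proj₂ (∷-injective eq)))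

V : ℕ → CMon
V n = record
  { C = Vec ℕ n ; _⊕_ = _+v_ ; 0# = 𝟘
  ; assoc = zipWith-assoc +-assoc ; comm = zipWith-comm +-comm
  ; idˡ = zipWith-identityˡ +-identityˡ ; cancelˡ = +v-cancelˡ }

Nat : CMon
Nat = record
  { C = ℕ ; _⊕_ = _+_ ; 0# = 0 ; assoc = +-assoc ; comm = +-comm
  ; idˡ = +-identityˡ ; cancelˡ = λ x → +-cancelˡ-≡ x _ _ }

Unit : CMon
Unit = record
  { C = ⊤ ; _⊕_ = λ _ _ → tt ; 0# = tt ; assoc = λ _ _ _ → refl ; comm = λ _ _ → refl
  ; idˡ = λ _ → refl ; cancelˡ = λ _ _ → refl }

infixr 4 _⊗_
_⊗_ : CMon → CMon → CMon
S ⊗ T = record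
  { C = ∣ S ∣ × ∣ T ∣ ; _⊕_ = λ p q → proj₁ p S.⊕ proj₁ q , proj₂ p T.⊕ proj₂ q ; 0# = S.0# , T.0#
  ; assoc = λ x y z → cong₂ _,_ (S.assoc _ _ _) (T.assoc _ _ _)
  ; comm = λ x y → cong₂ _,_ (S.comm _ _) (T.comm _ _)
  ; idˡ = λ x → cong₂ _,_ (S.idˡ _) (T.idˡ _)
  ; cancelˡ = λ x eq → cong₂ _,_ (S.cancelˡ _ (cong proj₁ eq)) (T.cancelˡ _ (cong proj₂ eq)) }
  where module S = CMon S
        module T = CMon T

infixr 8 _·_
_·_ : ∀ {n} → ℕ → Vec ℕ n → Vec ℕ n
_·_ {n} = CMon.mul (V n)

lookup-+v : ∀ {n} (x y : Vec ℕ n) i → lookup (x +v y) i ≡ lookup x i + lookup y i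
lookup-+v x y i = lookup-zipWith _+_ i x y

lookup-𝟘 : ∀ {n} (i : Fin n) → lookup 𝟘 i ≡ 0
lookup-𝟘 i = lookup-replicate i 0

lookup-𝟙 : ∀ {n} (i : Fin n) → lookup 𝟙 i ≡ 1
lookup-𝟙 i = lookup-replicate i 1

lookup-· : ∀ {n} m (x : Vec ℕ n) i → lookup (m · x) i ≡ m * lookup x i
lookup-· zero    x i = lookup-𝟘 i
lookup-· (suc m) x i = trans (lookup-+v x _ i) (cong (lookup x i +_) (lookup-· m x i))

mul-Nat : ∀ m n → CMon.mul Nat m n ≡ m * n
mul-Nat zero n = refl
mul-Nat (suc m) n = cong (n +_) (mul-Nat m n)

vec-ext : ∀ {n} {x y : Vec ℕ n} → (∀ i → lookup x i ≡ lookup y i) → x ≡ y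
vec-ext {x = []}    {[]}    _ = refl
vec-ext {x = _ ∷ _} {_ ∷ _} p = cong₂ _∷_ (p zero) (vec-ext (p ∘ suc))

infix 4 _≤v_
_≤v_ : ∀ {n} → Vec ℕ n → Vec ℕ n → Set
x ≤v y = ∀ i → lookup x i ≤ lookup y i

_∸v_ : ∀ {n} → Vec ℕ n → Vec ℕ n → Vec ℕ n
_∸v_ = zipWith _∸_

x+[y∸x] : ∀ {n} (x y : Vec ℕ n) → x ≤v y → x +v (y ∸v x) ≡ y
x+[y∸x] x y p = vec-ext λ i → trans (lookup-+v x _ i)
  (trans (cong (lookup x i +_) (lookup-zipWith _∸_ i y x)) (m+[n∸m]≡n (p i)))

-- There is no subtraction, so the linear part is carried along. The law `aff` and cancellation in
-- `T` determine it, and its additivity is derived rather than demanded.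
record Aff (S T : CMon) : Set where
  constructor mkAff
  private
    module S = CMon S
    module T = CMon T
  field
    fun : S.C → T.C
    lin : S.C → T.C
    aff : ∀ x v → fun (x S.⊕ v) ≡ fun x T.⊕ lin v

  lin-⊕ : ∀ u v → lin (u S.⊕ v) ≡ lin u T.⊕ lin v
  lin-⊕ u v = T.cancelˡ (fun u) (begin
    fun u T.⊕ lin (u S.⊕ v)      ≡⟨ aff _ _ ⟨
    fun (u S.⊕ (u S.⊕ v))        ≡⟨ cong fun (S.assoc _ _ _) ⟨
    fun ((u S.⊕ u) S.⊕ v)        ≡⟨ aff _ _ ⟩
    fun (u S.⊕ u) T.⊕ lin v      ≡⟨ cong (T._⊕ lin v) (aff _ _) ⟩
    (fun u T.⊕ lin u) T.⊕ lin v  ≡⟨ T.assoc _ _ _ ⟩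
    fun u T.⊕ (lin u T.⊕ lin v)  ∎)
    where open ≡-Reasoning

  lin-0 : lin S.0# ≡ T.0#
  lin-0 = T.cancelˡ (fun S.0#) (trans (sym (aff _ _)) (trans (cong fun (S.idˡ _)) (sym (T.idʳ _))))

  lin-mul : ∀ n x → lin (S.mul n x) ≡ T.mul n (lin x)
  lin-mul zero    x = lin-0
  lin-mul (suc n) x = trans (lin-⊕ _ _) (cong (lin x T.⊕_) (lin-mul n x))

  fun-0 : ∀ x → fun x ≡ fun S.0# T.⊕ lin x
  fun-0 x = trans (cong fun (sym (S.idˡ x))) (aff _ _)

open Aff public

idA : ∀ {S} → Aff S S
idA = mkAff id id (λ _ _ → refl)

infixr 9 _∘A_
_∘A_ : ∀ {S T U} → Aff T U → Aff S T → Aff S U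
f ∘A g = mkAff (fun f ∘ fun g) (lin f ∘ lin g) (λ x v → trans (cong (fun f) (aff g x v)) (aff f _ _))

constA : ∀ {S T} → ∣ T ∣ → Aff S T
constA {S} {T} t = mkAff (λ _ → t) (λ _ → CMon.0# T) (λ _ _ → sym (CMon.idʳ T t))

fstA : ∀ {S T} → Aff (S ⊗ T) S
fstA = mkAff proj₁ proj₁ (λ _ _ → refl)

sndA : ∀ {S T} → Aff (S ⊗ T) T
sndA = mkAff proj₂ proj₂ (λ _ _ → refl)

⟨_,_⟩A : ∀ {S T U} → Aff S T → Aff S U → Aff S (T ⊗ U)
⟨ f , g ⟩A = mkAff (λ x → fun f x , fun g x) (λ x → lin f x , lin g x) (λ x v → cong₂ _,_ (aff f x v) (aff g x v))

takeA : ∀ m {n} → Aff (V (m + n)) (V m)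
takeA m = mkAff (Vec.take m) (Vec.take m) (λ x v → take-zipWith _+_ x v)

dropA : ∀ m {n} → Aff (V (m + n)) (V n)
dropA m = mkAff (Vec.drop m) (Vec.drop m) (λ x v → drop-zipWith {m = m} _+_ x v)

lookupA : ∀ {n} → Fin n → Aff (V n) Nat
lookupA i = mkAff (λ x → lookup x i) (λ x → lookup x i) (λ x v → lookup-+v x v i)

take-++ : ∀ {A : Set} {m n} (x : Vec A m) (y : Vec A n) → Vec.take m (x Vec.++ y) ≡ x
take-++ []      y = refl
take-++ (a ∷ x) y = cong (a ∷_) (take-++ x y)

drop-++ : ∀ {A : Set} {m n} (x : Vec A m) (y : Vec A n) → Vec.drop m (x Vec.++ y) ≡ y
drop-++ []      y = refl
drop-++ (a ∷ x) y = drop-++ x y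

-- Linear Diophantine equations over ℕ

-- Unlike a cover this is exact: a semilinear set, as a finite union of affine images of orthants.
-- `or` names its two parts freely, so recursive solutions can be restated before they are merged.
data Sol {m : ℕ} (Q : Vec ℕ m → Set) : Set₁ where
  none : (∀ w → ¬ Q w) → Sol Q
  img  : ∀ {n} (u : Aff (V n) (V m)) → (∀ z → Q (fun u z)) → (∀ w → Q w → ∃ λ z → fun u z ≡ w) → Sol Q
  or   : ∀ {Q₁ Q₂ : Vec ℕ m → Set} → Sol Q₁ → Sol Q₂ → (∀ w → Q w → Q₁ w ⊎ Q₂ w) →
         (∀ w → Q₁ w → Q w) → (∀ w → Q₂ w → Q w) → Sol Q

Sol-⇔ : ∀ {m} {Q Q′ : Vec ℕ m → Set} → (∀ w → Q w → Q′ w) → (∀ w → Q′ w → Q w) → Sol Q → Sol Q′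
Sol-⇔ to from (none p)           = none (λ w → p w ∘ from w)
Sol-⇔ to from (img u p c)        = img u (λ z → to _ (p z)) (λ w → c w ∘ from w)
Sol-⇔ to from (or s₁ s₂ c p₁ p₂) = or s₁ s₂ (λ w → c w ∘ from w) (λ w → to w ∘ p₁ w) (λ w → to w ∘ p₂ w)

Sol-img : ∀ {m n} {Q : Vec ℕ m → Set} (u : Aff (V n) (V m)) {Q′ : Vec ℕ n → Set} → Sol Q′ →
          (∀ z → Q′ z → Q (fun u z)) → (∀ w → Q w → ∃ λ z → Q′ z × fun u z ≡ w) → Sol Q
Sol-img u (none p) to from = none (λ w q → case from w q of λ (z , q′ , _) → p z q′)
Sol-img u (img u′ p c) to from = img (u ∘A u′) (λ z → to _ (p z))
  (λ w q → case from w q of λ (z , q′ , eq) → case c z q′ of λ (y , eq′) → y , trans (cong (fun u) eq′) eq)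
Sol-img {Q = Q} u (or {Q₁} {Q₂} s₁ s₂ c p₁ p₂) to from =
  or (Sol-img {Q = λ w → ∃ λ z → Q₁ z × fun u z ≡ w} u s₁ (λ z q → z , q , refl) (λ _ x → x))
     (Sol-img {Q = λ w → ∃ λ z → Q₂ z × fun u z ≡ w} u s₂ (λ z q → z , q , refl) (λ _ x → x))
     (λ w q → case from w q of λ (z , q′ , eq) → case c z q′ of λ
        { (inj₁ q₁) → inj₁ (z , q₁ , eq) ; (inj₂ q₂) → inj₂ (z , q₂ , eq) })
     (λ { w (z , q , refl) → to z (p₁ z q) })
     (λ { w (z , q , refl) → to z (p₂ z q) })

-- Elimination by substitution: the second constraint is solved in the parameters of each family of
-- solutions of the first, which reduces systems to single equations.
Sol-× : ∀ {m} {Q R : Vec ℕ m → Set} → Sol Q → (∀ {n} (u : Aff (V n) (V m)) → Sol (R ∘ fun u)) →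
        Sol (λ w → Q w × R w)
Sol-× (none p) k = none (λ w → p w ∘ proj₁)
Sol-× (img u p c) k = Sol-img u (k u) (λ z r → p z , r)
  (λ w (q , r) → case c w q of λ { (z , refl) → z , r , refl })
Sol-× (or s₁ s₂ c p₁ p₂) k = or (Sol-× s₁ k) (Sol-× s₂ k)
  (λ w (q , r) → case c w q of λ { (inj₁ q₁) → inj₁ (q₁ , r) ; (inj₂ q₂) → inj₂ (q₂ , r) })
  (λ w (q , r) → p₁ w q , r) (λ w (q , r) → p₂ w q , r)

dot : ∀ {m} → Vec ℕ m → Vec ℕ m → ℕ
dot []      []      = 0
dot (a ∷ α) (x ∷ w) = a * x + dot α w

dot-+v : ∀ {m} (α x y : Vec ℕ m) → dot α (x +v y) ≡ dot α x + dot α y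
dot-+v []      []      []      = refl
dot-+v (a ∷ α) (x ∷ u) (y ∷ v) = trans (cong (a * (x + y) +_) (dot-+v α u v)) (lem a x y _ _)
  where
  lem : ∀ a x y p q → a * (x + y) + (p + q) ≡ a * x + p + (a * y + q)
  lem = solve-∀

dot-+ˡ : ∀ {m} (α β w : Vec ℕ m) → dot (α +v β) w ≡ dot α w + dot β w
dot-+ˡ []      []      []      = refl
dot-+ˡ (a ∷ α) (b ∷ β) (x ∷ w) = trans (cong ((a + b) * x +_) (dot-+ˡ α β w)) (lem a b x _ _)
  where
  lem : ∀ a b x p q → (a + b) * x + (p + q) ≡ a * x + p + (b * x + q)
  lem = solve-∀

dot-𝟘 : ∀ {m} (α : Vec ℕ m) → dot α 𝟘 ≡ 0
dot-𝟘 []      = refl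
dot-𝟘 (a ∷ α) = cong₂ _+_ (*-zeroʳ a) (dot-𝟘 α)

at : ∀ {m} → Fin m → ℕ → Vec ℕ m
at zero    n = n ∷ 𝟘
at (suc i) n = 0 ∷ at i n

dot-at : ∀ {m} (α : Vec ℕ m) i n → dot α (at i n) ≡ lookup α i * n
dot-at (a ∷ α) zero    n = trans (cong (a * n +_) (dot-𝟘 α)) (+-identityʳ _)
dot-at (a ∷ α) (suc i) n = trans (cong (_+ dot α (at i n)) (*-zeroʳ a)) (dot-at α i n)

split-at : ∀ {m} (w : Vec ℕ m) i n → n ≤ lookup w i →
           ∃ λ w′ → w ≡ at i n +v w′ × (∀ j → j ≢ i → lookup w′ j ≡ lookup w j)
split-at (x ∷ w) zero    n le = (x ∸ n ∷ w) , cong₂ _∷_ (sym (m+[n∸m]≡n le)) (sym (CMon.idˡ (V _) w)) ,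
  λ { zero ne → contradiction refl ne ; (suc j) ne → refl }
split-at (x ∷ w) (suc i) n le with split-at w i n le
... | w′ , eq , other = (x ∷ w′) , cong (x ∷_) eq ,
  λ { zero ne → refl ; (suc j) ne → other j (ne ∘ cong suc) }

coefs : ∀ {m} → Aff (V m) Nat → Vec ℕ m
coefs {zero}  f = []
coefs {suc m} f = lin f (1 ∷ 𝟘) ∷ coefs (f ∘A mkAff (0 ∷_) (0 ∷_) (λ _ _ → refl))

coefs-correct : ∀ {m} (f : Aff (V m) Nat) w → fun f w ≡ fun f 𝟘 + dot (coefs f) w
coefs-correct {zero}  f []      = sym (+-identityʳ _)
coefs-correct {suc m} f (x ∷ w) = begin
  fun f (x ∷ w)                                  ≡⟨ cong (fun f) (cong₂ _∷_ refl (sym (CMon.idʳ (V _) w))) ⟩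
  fun f ((0 ∷ w) +v (x ∷ 𝟘))                     ≡⟨ aff f _ _ ⟩
  fun f (0 ∷ w) + lin f (x ∷ 𝟘)                  ≡⟨ cong₂ _+_ (coefs-correct (f ∘A mkAff (0 ∷_) (0 ∷_) (λ _ _ → refl)) w) linx ⟩
  fun f 𝟘 + dot α w + lin f (1 ∷ 𝟘) * x          ≡⟨ lem (fun f 𝟘) (dot α w) _ ⟩
  fun f 𝟘 + (lin f (1 ∷ 𝟘) * x + dot α w)        ∎
  where
  open ≡-Reasoning
  α = coefs (f ∘A mkAff (0 ∷_) (0 ∷_) (λ _ _ → refl))
  lem : ∀ a b c → a + b + c ≡ a + (c + b)
  lem = solve-∀
  scaled : ∀ y → (y ∷ 𝟘) ≡ y · (1 ∷ 𝟘 {m})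
  scaled zero    = refl
  scaled (suc y) = trans (cong (suc y ∷_) (sym (CMon.idˡ (V _) 𝟘))) (cong ((1 ∷ 𝟘) +v_) (scaled y))
  linx : lin f (x ∷ 𝟘) ≡ lin f (1 ∷ 𝟘) * x
  linx = trans (cong (lin f) (scaled x)) (trans (lin-mul f x _) (trans (mul-Nat x _) (*-comm x _)))

comb : ∀ {m} (G : List (Vec ℕ m)) → Vec ℕ (length G) → Vec ℕ m
comb []      _       = 𝟘
comb (γ ∷ G) (z ∷ v) = z · γ +v comb G v

comb-+v : ∀ {m} (G : List (Vec ℕ m)) u v → comb G (u +v v) ≡ comb G u +v comb G v
comb-+v []      u       v       = sym (CMon.idˡ (V _) 𝟘)
comb-+v (γ ∷ G) (x ∷ u) (y ∷ v) = trans (cong₂ _+v_ (CMon.mul-+ (V _) x y γ) (comb-+v G u v))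
  (CMon.interchange (V _) _ _ _ _)

comb-𝟘 : ∀ {m} (G : List (Vec ℕ m)) → comb G 𝟘 ≡ 𝟘
comb-𝟘 []      = refl
comb-𝟘 (γ ∷ G) = trans (CMon.idˡ (V _) _) (comb-𝟘 G)

comb-∈ : ∀ {m} {G : List (Vec ℕ m)} {γ} → γ ∈ G → ∃ λ z → comb G z ≡ γ
comb-∈ {G = γ ∷ G} (here refl) = (1 ∷ 𝟘) , trans (cong₂ _+v_ (CMon.idʳ (V _) γ) (comb-𝟘 G)) (CMon.idʳ (V _) γ)
comb-∈ (there p) with comb-∈ p
... | z , eq = (0 ∷ z) , trans (CMon.idˡ (V _) _) eq

box : ∀ m → ℕ → List (Vec ℕ m)
box zero    b = [] ∷ []
box (suc m) b = List.cartesianProductWith _∷_ (List.upTo (suc b)) (box m b)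

∈-box : ∀ {m b} (w : Vec ℕ m) → (∀ i → lookup w i ≤ b) → w ∈ box m b
∈-box []      p = here refl
∈-box (x ∷ w) p = ∈-cartesianProductWith⁺ _∷_ (∈-upTo⁺ (s≤s (p zero))) (∈-box w (p ∘ suc))

-- Every solution of c + α·w = d + β·w is a bounded solution plus a combination of solutions of
-- the homogeneous equation: a positive and a negative coefficient cancel each other, and no such
-- cancelling pair can be subtracted only if all entries are bounded.
module Equation {m : ℕ} (c d : ℕ) (α β : Vec ℕ m) where
  private
    A B : Fin m → ℕ
    A i = lookup α i ∸ lookup β i
    B i = lookup β i ∸ lookup α i

    Q : Vec ℕ m → Set
    Q w = c + dot α w ≡ d + dot β w

    -- With a surplus `a` on the left at `i` and a surplus `b` on the right at `j`, `b` units at `i`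
    -- balance `a` units at `j`. Where nothing cancels the generator is `𝟘`, which is harmless and
    -- saves filtering `G`.
    cancelling : ℕ → ℕ → Fin m → Fin m → Vec ℕ m
    cancelling (suc a) (suc b) i j = at i (suc b) +v at j (suc a)
    cancelling _       _       i j = 𝟘

    free : ℕ → ℕ → Fin m → Vec ℕ m
    free zero zero i = at i 1
    free _    _    i = 𝟘

    G : List (Vec ℕ m)
    G = List.map (λ i → free (A i) (B i) i) (List.allFin m) List.++
        List.cartesianProductWith (λ i j → cancelling (A i) (B j) i j) (List.allFin m) (List.allFin m)

    Balanced : Vec ℕ m → Set
    Balanced γ = dot α γ ≡ dot β γ

    pos⇒ : ∀ x y {n} → x ∸ y ≡ suc n → x ≡ y + suc n
    pos⇒ x y {n} eq = trans (sym (m+[n∸m]≡n {y} {x} (<⇒≤ (m∸n≢0⇒n<m (λ e → 1+n≢0 (trans (sym eq) e))))))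
                            (cong (y +_) eq)

    𝟘-balanced : Balanced 𝟘
    𝟘-balanced = trans (dot-𝟘 α) (sym (dot-𝟘 β))

    cancelling-balanced : ∀ i j {a b} → A i ≡ a → B j ≡ b → Balanced (cancelling a b i j)
    cancelling-balanced i j {zero}  {_}     _  _  = 𝟘-balanced
    cancelling-balanced i j {suc a} {zero}  _  _  = 𝟘-balanced
    cancelling-balanced i j {suc a} {suc b} ea eb = begin
      dot α (at i (suc b) +v at j (suc a))                     ≡⟨ dot-+v α _ _ ⟩
      dot α (at i (suc b)) + dot α (at j (suc a))              ≡⟨ cong₂ _+_ (dot-at α i _) (dot-at α j _) ⟩
      lookup α i * suc b + lookup α j * suc a                  ≡⟨ cong (λ t → t * suc b + lookup α j * suc a) (pos⇒ (lookup α i) (lookup β i) ea) ⟩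
      (lookup β i + suc a) * suc b + lookup α j * suc a        ≡⟨ lem (lookup β i) (lookup α j) (suc a) (suc b) ⟩
      lookup β i * suc b + (lookup α j + suc b) * suc a        ≡⟨ cong (λ t → lookup β i * suc b + t * suc a) (pos⇒ (lookup β j) (lookup α j) eb) ⟨
      lookup β i * suc b + lookup β j * suc a                  ≡⟨ cong₂ _+_ (dot-at β i _) (dot-at β j _) ⟨
      dot β (at i (suc b)) + dot β (at j (suc a))              ≡⟨ dot-+v β _ _ ⟨
      dot β (at i (suc b) +v at j (suc a))                     ∎
      where
      open ≡-Reasoning
      lem : ∀ p q a b → (p + a) * b + q * a ≡ p * b + (q + b) * a
      lem = solve-∀

    free-balanced : ∀ i {a b} → A i ≡ a → B i ≡ b → Balanced (free a b i)
    free-balanced i {zero}  {zero}  ea eb = trans (dot-at α i 1) (trans (cong (_* 1) {x = lookup α i} {y = lookup β i}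
      (≤-antisym (m∸n≡0⇒m≤n ea) (m∸n≡0⇒m≤n eb))) (sym (dot-at β i 1)))
    free-balanced i {zero}  {suc _} _  _  = 𝟘-balanced
    free-balanced i {suc _} {_}     _  _  = 𝟘-balanced

    G-balanced : All Balanced G
    G-balanced = All.tabulate λ γ∈ → case ∈-++⁻ (List.map (λ i → free (A i) (B i) i) (List.allFin m)) γ∈ of λ
      { (inj₁ p) → case ∈-map⁻ _ p of λ { (i , _ , refl) → free-balanced i refl refl }
      ; (inj₂ p) → case ∈-cartesianProductWith⁻ _ (List.allFin m) (List.allFin m) p of λ
          { (i , j , _ , _ , refl) → cancelling-balanced i j refl refl } }

    comb-balanced : ∀ {G} → All Balanced G → ∀ z → Balanced (comb G z)
    comb-balanced []       z       = 𝟘-balanced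
    comb-balanced {γ ∷ G} (e ∷ es) (z ∷ v) = trans (dot-+v α _ _)
      (trans (cong₂ _+_ (mulB z) (comb-balanced es v)) (sym (dot-+v β _ _)))
      where
      mulB : ∀ z → Balanced (z · γ)
      mulB zero    = 𝟘-balanced
      mulB (suc z) = trans (dot-+v α _ _) (trans (cong₂ _+_ e (mulB z)) (sym (dot-+v β _ _)))

    Q-+ : ∀ w {γ} → Balanced γ → Q w → Q (w +v γ)
    Q-+ w {γ} e q = begin
      c + dot α (w +v γ)          ≡⟨ cong (c +_) (dot-+v α w γ) ⟩
      c + (dot α w + dot α γ)     ≡⟨ +-assoc c _ _ ⟨
      c + dot α w + dot α γ       ≡⟨ cong₂ _+_ q e ⟩
      d + dot β w + dot β γ       ≡⟨ +-assoc d _ _ ⟩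
      d + (dot β w + dot β γ)     ≡⟨ cong (d +_) (dot-+v β w γ) ⟨
      d + dot β (w +v γ)          ∎
      where open ≡-Reasoning

    Q-- : ∀ w {γ} → Balanced γ → Q (γ +v w) → Q w
    Q-- w {γ} e q = +-cancelˡ-≡ (dot α γ) _ _ (begin
      dot α γ + (c + dot α w)     ≡⟨ swap (dot α γ) c _ ⟩
      c + (dot α γ + dot α w)     ≡⟨ cong (c +_) (dot-+v α γ w) ⟨
      c + dot α (γ +v w)          ≡⟨ q ⟩
      d + dot β (γ +v w)          ≡⟨ cong (d +_) (dot-+v β γ w) ⟩
      d + (dot β γ + dot β w)     ≡⟨ swap d (dot β γ) _ ⟩
      dot β γ + (d + dot β w)     ≡⟨ cong (_+ (d + dot β w)) e ⟨
      dot α γ + (d + dot β w)     ∎)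
      where
      open ≡-Reasoning
      swap : ∀ x y z → x + (y + z) ≡ y + (x + z)
      swap = solve-∀

    Reducible : Vec ℕ m → Set
    Reducible w = ∃ λ γ → ∃ λ w′ → γ ∈ G × w ≡ γ +v w′ × 1 ≤ dot 𝟙 γ

    av bv : Vec ℕ m
    av = α ∸v β
    bv = β ∸v α

    -- `M` bounds all coefficient differences. If an entry with a surplus on one side exceeds `M`,
    -- no entry with a surplus on the other side does, for otherwise the two would cancel. The other
    -- side of the equation is then at most `c + d + K`, and so is the large entry.
    M K bound : ℕ
    M = dot av 𝟙 + dot bv 𝟙
    K = m * (M * M)
    bound = M + (c + d + K)

    lookup-≤-dot : ∀ {m} (u w : Vec ℕ m) i → lookup u i * lookup w i ≤ dot u w
    lookup-≤-dot (a ∷ u) (x ∷ w) zero    = m≤m+n _ _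
    lookup-≤-dot (a ∷ u) (x ∷ w) (suc i) = ≤-trans (lookup-≤-dot u w i) (m≤n+m _ _)

    dot-≤ : ∀ {m} (u w : Vec ℕ m) k → (∀ i → lookup u i * lookup w i ≤ k) → dot u w ≤ m * k
    dot-≤ []      []      k p = z≤n
    dot-≤ (a ∷ u) (x ∷ w) k p = +-mono-≤ (p zero) (dot-≤ u w k (p ∘ suc))

    lookup-av : ∀ i → lookup av i ≡ A i
    lookup-av i = lookup-zipWith _∸_ i α β

    lookup-bv : ∀ i → lookup bv i ≡ B i
    lookup-bv i = lookup-zipWith _∸_ i β α

    A≤M : ∀ i → A i ≤ M
    A≤M i = subst (_≤ M) (*-identityʳ (A i)) (≤-trans
      (subst₂ (λ s t → s * t ≤ dot av 𝟙) (lookup-av i) (lookup-𝟙 i) (lookup-≤-dot av 𝟙 i))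
      (m≤m+n (dot av 𝟙) _))

    B≤M : ∀ i → B i ≤ M
    B≤M i = subst (_≤ M) (*-identityʳ (B i)) (≤-trans
      (subst₂ (λ s t → s * t ≤ dot bv 𝟙) (lookup-bv i) (lookup-𝟙 i) (lookup-≤-dot bv 𝟙 i))
      (m≤n+m (dot bv 𝟙) (dot av 𝟙)))

    Q⇒reduced : ∀ w → Q w → c + dot av w ≡ d + dot bv w
    Q⇒reduced w q = +-cancelʳ-≡ (dot α w + dot β w) _ _ (begin
      c + dot av w + (dot α w + dot β w)    ≡⟨ l₁ c (dot av w) (dot α w) (dot β w) ⟩
      c + dot α w + (dot β w + dot av w)    ≡⟨ cong₂ _+_ q (trans (sym (dot-+ˡ β av w)) (trans (cong (λ t → dot t w) exch) (dot-+ˡ α bv w))) ⟩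
      d + dot β w + (dot α w + dot bv w)    ≡⟨ l₂ d (dot bv w) (dot α w) (dot β w) ⟩
      d + dot bv w + (dot α w + dot β w)    ∎)
      where
      open ≡-Reasoning
      l₁ : ∀ c x a b → c + x + (a + b) ≡ c + a + (b + x)
      l₁ = solve-∀
      l₂ : ∀ d y a b → d + b + (a + y) ≡ d + y + (a + b)
      l₂ = solve-∀
      -- Both sides are the entrywise maximum of `α` and `β`.
      exch : β +v av ≡ α +v bv
      exch = vec-ext λ i → trans (lookup-+v β av i) (trans (cong (lookup β i +_) (lookup-av i))
        (trans (trans (sym (m⊔n≡m+n∸m′ (lookup β i) (lookup α i))) (trans (⊔-comm (lookup β i) _) (m⊔n≡m+n∸m′ (lookup α i) (lookup β i))))
        (sym (trans (lookup-+v α bv i) (cong (lookup α i +_) (lookup-bv i))))))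
        where
        m⊔n≡m+n∸m′ : ∀ x y → x ⊔ y ≡ x + (y ∸ x)
        m⊔n≡m+n∸m′ zero    y       = refl
        m⊔n≡m+n∸m′ (suc x) zero    = cong suc (sym (+-identityʳ x))
        m⊔n≡m+n∸m′ (suc x) (suc y) = cong suc (m⊔n≡m+n∸m′ x y)

    Free Pair : Vec ℕ m → Set
    Free w = ∃ λ i → A i ≡ 0 × B i ≡ 0 × 1 ≤ lookup w i
    Pair w = ∃ λ i → ∃ λ j → 1 ≤ A i × 1 ≤ B j × B j ≤ lookup w i × A i ≤ lookup w j

    free-reduces : ∀ w → Free w → Reducible w
    free-reduces w (i , ea , eb , le) with split-at w i 1 le
    ... | w′ , eq , _ = at i 1 , w′ ,
      ∈-++⁺ˡ (subst (_∈ _) (cong₂ (λ a b → free a b i) ea eb) (∈-map⁺ (λ i → free (A i) (B i) i) (∈-allFin i))) , eq ,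
      ≤-reflexive (sym (trans (dot-at 𝟙 i 1) (cong (_* 1) (lookup-𝟙 i))))

    pair-reduces : ∀ w → Pair w → Reducible w
    pair-reduces w (i , j , pa , pb , lb , la) with A i in ea | B j in eb
    ... | suc a | suc b with split-at w i (suc b) lb
    ... | w₁ , eq₁ , other with split-at w₁ j (suc a) (≤-trans la (≤-reflexive (sym (other j j≢i))))
      where
      j≢i : j ≢ i
      j≢i refl = <⇒≱ (m∸n≢0⇒n<m {lookup α i} {lookup β i} (λ e → 1+n≢0 (trans (sym ea) e)))
                     (<⇒≤ (m∸n≢0⇒n<m {lookup β i} {lookup α i} (λ e → 1+n≢0 (trans (sym eb) e))))
    ... | w₂ , eq₂ , _ = at i (suc b) +v at j (suc a) , w₂ ,
      ∈-++⁺ʳ (List.map (λ i → free (A i) (B i) i) (List.allFin m)) (subst (_∈ _) (cong₂ (λ a b → cancelling a b i j) ea eb)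
        (∈-cartesianProductWith⁺ (λ i j → cancelling (A i) (B j) i j) (∈-allFin i) (∈-allFin j))) ,
      trans eq₁ (trans (cong (at i (suc b) +v_) eq₂) (sym (CMon.assoc (V _) _ _ _))) ,
      ≤-trans (s≤s z≤n) (≤-trans (≤-reflexive (sym (trans (dot-at 𝟙 i (suc b)) (trans (cong (_* suc b) (lookup-𝟙 i)) (*-identityˡ _)))))
        (≤-trans (m≤m+n _ _) (≤-reflexive (sym (dot-+v 𝟙 (at i (suc b)) _)))))

    irreducible-bounded : ∀ w → Q w → ¬ Free w → ¬ Pair w → ∀ i → lookup w i ≤ bound
    irreducible-bounded w q nf np i with lookup w i ≤? M
    ... | yes le = ≤-trans le (m≤m+n M _)
    ... | no nle with A i in ea | B i in eb
    ... | zero | zero = contradiction (i , ea , eb , ≤-trans (s≤s z≤n) (≰⇒> nle)) nf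
    ... | suc a | _ = ≤-trans (begin
        lookup w i               ≤⟨ m≤m+n _ (a * lookup w i) ⟩
        suc a * lookup w i       ≡⟨ cong (_* lookup w i) (trans (sym ea) (sym (lookup-av i))) ⟩
        lookup av i * lookup w i ≤⟨ lookup-≤-dot av w i ⟩
        dot av w                 ≤⟨ m≤n+m _ c ⟩
        c + dot av w             ≡⟨ Q⇒reduced w q ⟩
        d + dot bv w             ≤⟨ +-mono-≤ (m≤n+m d c) (dot-≤ bv w (M * M) small) ⟩
        c + d + K                ∎) (m≤n+m _ M)
      where
      open ≤-Reasoning
      small : ∀ j → lookup bv j * lookup w j ≤ M * M
      small j with B j in eb′
      ... | zero  = subst (λ t → t * lookup w j ≤ M * M) (sym (trans (lookup-bv j) eb′)) z≤n
      ... | suc b = *-mono-≤ (≤-trans (≤-reflexive (lookup-bv j)) (B≤M j)) (≮⇒≥ λ lt →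
          np (i , j , ≤-trans (s≤s z≤n) (≤-reflexive (sym ea)) , ≤-trans (s≤s z≤n) (≤-reflexive (sym eb′)) ,
              ≤-trans (B≤M j) (<⇒≤ (≰⇒> nle)) , ≤-trans (A≤M i) (<⇒≤ lt)))
    ... | zero | suc b = ≤-trans (begin
        lookup w i               ≤⟨ m≤m+n _ (b * lookup w i) ⟩
        suc b * lookup w i       ≡⟨ cong (_* lookup w i) (trans (sym eb) (sym (lookup-bv i))) ⟩
        lookup bv i * lookup w i ≤⟨ lookup-≤-dot bv w i ⟩
        dot bv w                 ≤⟨ m≤n+m _ d ⟩
        d + dot bv w             ≡⟨ Q⇒reduced w q ⟨
        c + dot av w             ≤⟨ +-mono-≤ (m≤m+n c d) (dot-≤ av w (M * M) small) ⟩
        c + d + K                ∎) (m≤n+m _ M)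
      where
      open ≤-Reasoning
      small : ∀ j → lookup av j * lookup w j ≤ M * M
      small j with A j in ea′
      ... | zero  = subst (λ t → t * lookup w j ≤ M * M) (sym (trans (lookup-av j) ea′)) z≤n
      ... | suc a = *-mono-≤ (≤-trans (≤-reflexive (lookup-av j)) (A≤M j)) (≮⇒≥ λ lt →
          np (j , i , ≤-trans (s≤s z≤n) (≤-reflexive (sym ea′)) , ≤-trans (s≤s z≤n) (≤-reflexive (sym eb)) ,
              ≤-trans (B≤M i) (<⇒≤ lt) , ≤-trans (A≤M j) (<⇒≤ (≰⇒> nle))))

    reduce : ∀ w → Q w → Reducible w ⊎ (∀ i → lookup w i ≤ bound)
    reduce w q with Finₚ.any? (λ i → (A i ≟ 0) ×-dec ((B i ≟ 0) ×-dec (1 ≤? lookup w i)))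
    ... | yes p = inj₁ (free-reduces w p)
    ... | no nf with Finₚ.any? (λ i → Finₚ.any? (λ j → (1 ≤? A i) ×-dec ((1 ≤? B j) ×-dec ((B j ≤? lookup w i) ×-dec (A i ≤? lookup w j)))))
    ... | yes p = inj₁ (pair-reduces w p)
    ... | no np = inj₂ (irreducible-bounded w q nf np)

    Decomposed : List (Vec ℕ m) → Vec ℕ m → Set
    Decomposed bs w = ∃ λ b → b ∈ bs × Q b × ∃ λ z → b +v comb G z ≡ w

    decompose : ∀ w → Acc _<_ (dot 𝟙 w) → Q w → Decomposed (box m bound) w
    decompose w (acc rs) q with reduce w q
    ... | inj₂ small = w , ∈-box w small , q , 𝟘 , trans (cong (w +v_) (comb-𝟘 G)) (CMon.idʳ (V _) w)
    ... | inj₁ (γ , w′ , γ∈ , refl , pos)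
      with decompose w′ (rs (≤-trans (+-monoˡ-≤ (dot 𝟙 w′) pos) (≤-reflexive (sym (dot-+v 𝟙 γ w′)))))
                     (Q-- w′ (All.lookup G-balanced γ∈) q) | comb-∈ γ∈
    ... | b , b∈ , qb , z , refl | y , refl = b , b∈ , qb , (y +v z) ,
        trans (cong (b +v_) (comb-+v G y z)) (swap b (comb G y) (comb G z))
      where
      swap : ∀ a b c → a +v (b +v c) ≡ b +v (a +v c)
      swap a b c = trans (sym (CMon.assoc (V _) a b c)) (trans (cong (_+v c) (CMon.comm (V _) a b)) (CMon.assoc (V _) b a c))

    sols : ∀ bs → Sol (Decomposed bs)
    sols [] = none λ { w (_ , () , _) }
    sols (b ∷ bs) with (c + dot α b) ≟ (d + dot β b)
    ... | yes q = or {Q₁ = λ w → ∃ λ z → b +v comb G z ≡ w}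
        (img (mkAff (λ z → b +v comb G z) (comb G)
               (λ x v → trans (cong (b +v_) (comb-+v G x v)) (sym (CMon.assoc (V _) b _ _))))
             (λ z → z , refl) (λ w p → p))
        (sols bs)
        (λ { w (_ , here refl , _ , p) → inj₁ p ; w (b′ , there b∈ , r) → inj₂ (b′ , b∈ , r) })
        (λ { w p → b , here refl , q , p })
        (λ { w (b′ , b∈ , r) → b′ , there b∈ , r })
    ... | no nq = Sol-⇔ (λ { w (b′ , b∈ , r) → b′ , there b∈ , r })
        (λ { w (_ , here refl , q , _) → contradiction q nq ; w (b′ , there b∈ , r) → b′ , b∈ , r }) (sols bs)

  solve-dot : Sol (λ w → c + dot α w ≡ d + dot β w)
  solve-dot = Sol-⇔ (λ { w (b , _ , qb , z , refl) → Q-+ b (comb-balanced G-balanced z) qb })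
    (λ w q → decompose w (<-wellFounded _) q) (sols (box m bound))

Solvable : CMon → Set₁
Solvable T = ∀ {m} (f g : Aff (V m) T) → Sol (λ w → fun f w ≡ fun g w)

solve-Nat : Solvable Nat
solve-Nat f g = Sol-⇔
  (λ w q → trans (coefs-correct f w) (trans q (sym (coefs-correct g w))))
  (λ w q → trans (sym (coefs-correct f w)) (trans q (coefs-correct g w)))
  (Equation.solve-dot (fun f 𝟘) (fun g 𝟘) (coefs f) (coefs g))

solve-⊗ : ∀ {S T} → Solvable S → Solvable T → Solvable (S ⊗ T)
solve-⊗ {S} {T} s t f g = Sol-⇔ (λ w (p , q) → cong₂ _,_ p q) (λ w eq → cong proj₁ eq , cong proj₂ eq)
  (Sol-× (s (fstA {S} {T} ∘A f) (fstA {S} {T} ∘A g)) (λ u → t (sndA {S} {T} ∘A f ∘A u) (sndA {S} {T} ∘A g ∘A u)))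

headA : ∀ {n} → Aff (V (suc n)) Nat
headA = mkAff Vec.head Vec.head (λ { (_ ∷ _) (_ ∷ _) → refl })

tailA : ∀ {n} → Aff (V (suc n)) (V n)
tailA = mkAff Vec.tail Vec.tail (λ { (_ ∷ _) (_ ∷ _) → refl })

solve-V : ∀ n → Solvable (V n)
solve-V zero f g = img idA (λ z → []-unique (fun f z) (fun g z)) (λ w _ → w , refl)
  where
  []-unique : (x y : Vec ℕ 0) → x ≡ y
  []-unique [] [] = refl
solve-V (suc n) f g = Sol-⇔ (λ w (p , q) → ∷-eq p q) (λ w eq → cong Vec.head eq , cong Vec.tail eq)
  (Sol-× (solve-Nat (headA ∘A f) (headA ∘A g)) (λ u → solve-V n (tailA ∘A f ∘A u) (tailA ∘A g ∘A u)))
  where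
  ∷-eq : ∀ {x y : Vec ℕ (suc n)} → Vec.head x ≡ Vec.head y → Vec.tail x ≡ Vec.tail y → x ≡ y
  ∷-eq {_ ∷ _} {_ ∷ _} refl refl = refl

-- Sections at a fixed coordinate, pumping trees and covers

-- Indexing by `pred m` lets a coordinate be fixed in an arbitrary dimension; the presence of an
-- element of `Fin m` excludes 0.
ins : ∀ {m} → Fin m → ℕ → Vec ℕ (pred m) → Vec ℕ m
ins {suc m} i v w = Vec.insertAt w i v

rem : ∀ {m} → Fin m → Vec ℕ m → Vec ℕ (pred m)
rem {suc m} i w = Vec.removeAt w i

ins-rem : ∀ {m} (i : Fin m) {v} w → lookup w i ≡ v → ins i v (rem i w) ≡ w
ins-rem {suc m} i w refl = insertAt-removeAt w i

insertAt-+ : ∀ {m} (i : Fin (suc m)) v (x y : Vec ℕ m) →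
             Vec.insertAt (x +v y) i v ≡ Vec.insertAt x i v +v Vec.insertAt y i 0
insertAt-+ zero    v x       y       = cong (_∷ _) (sym (+-identityʳ v))
insertAt-+ (suc i) v (a ∷ x) (b ∷ y) = cong (_ ∷_) (insertAt-+ i v x y)

removeAt-+ : ∀ {m} (i : Fin (suc m)) (x y : Vec ℕ (suc m)) →
             Vec.removeAt (x +v y) i ≡ Vec.removeAt x i +v Vec.removeAt y i
removeAt-+ zero    (a ∷ x)           (b ∷ y)           = refl
removeAt-+ (suc i) (a ∷ x@(_ ∷ _)) (b ∷ y@(_ ∷ _)) = cong (_ ∷_) (removeAt-+ i x y)

insA : ∀ {m} → Fin m → ℕ → Aff (V (pred m)) (V m)
insA {suc m} i v = mkAff (ins i v) (ins i 0) (insertAt-+ i v)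

remA : ∀ {m} → Fin m → Aff (V m) (V (pred m))
remA {suc m} i = mkAff (rem i) (rem i) (removeAt-+ i)

fun-insA : ∀ {m} (i : Fin m) v w → fun (insA i v) w ≡ ins i v w
fun-insA {suc m} i v w = refl

fun-remA : ∀ {m} (i : Fin m) w → fun (remA i) w ≡ rem i w
fun-remA {suc m} i w = refl

-- The step z + (1+j)(1+N)(𝟙+h) is quantified over all multiples j so that the N of several
-- predicates can be multiplied.
Pumpable : ∀ {m} → (Vec ℕ m → Set) → Set
Pumpable B = ∀ z h → ∃ λ N → ∀ j → B (z +v (suc j * suc N) · (𝟙 +v h))

-- A cover of the pair (A , B) is a finite family of affine images of predicates on ℕᵐ which
-- contains A and is contained in B; a tree certifies that the predicate on ℕᵐ is pumpable, and so
-- are, hereditarily, its sections at a fixed value of a coordinate.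
data Tree (m : ℕ) (A B : Vec ℕ m → Set) : Set₁
data Cover (S : CMon) (A B : ∣ S ∣ → Set) : Set₁

data Tree m A B where
  node : B 𝟘 → Pumpable B →
         (∀ i v → Cover (V (pred m)) (λ w → A (ins i v w)) (λ w → B (ins i v w))) → Tree m A B

data Cover S A B where
  none  : (∀ s → ¬ A s) → Cover S A B
  image : ∀ {m} (A′ B′ : Vec ℕ m → Set) → Tree m A′ B′ → (f : Aff (V m) S) →
          (∀ s → A s → ∃ λ w → A′ w × fun f w ≡ s) → (∀ w → B′ w → B (fun f w)) → Cover S A B
  both  : ∀ (A₁ A₂ B₁ B₂ : ∣ S ∣ → Set) → Cover S A₁ B₁ → Cover S A₂ B₂ →
          (∀ s → A s → A₁ s ⊎ A₂ s) → (∀ s → B₁ s → B s) → (∀ s → B₂ s → B s) → Cover S A B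

-- This is why a `node` contains `B 𝟘`: every image in the family exhibits a point of the upper set,
-- so a cover without such a point is built from `none` alone.
inhabited? : ∀ {S A B} → Cover S A B → (∃ λ s → B s) ⊎ (∀ s → ¬ A s)
inhabited? (none p) = inj₂ p
inhabited? (image A′ B′ (node b _ _) f _ q) = inj₁ (_ , q 𝟘 b)
inhabited? (both A₁ A₂ B₁ B₂ c₁ c₂ p q₁ q₂) with inhabited? c₁ | inhabited? c₂
... | inj₁ (s , b) | _            = inj₁ (s , q₁ s b)
... | inj₂ _       | inj₁ (s , b) = inj₁ (s , q₂ s b)
... | inj₂ n₁      | inj₂ n₂      = inj₂ λ s a → case p s a of λ { (inj₁ a₁) → n₁ s a₁ ; (inj₂ a₂) → n₂ s a₂ }

map-image : ∀ {S T A B A′ B′} → Cover S A B → (f : Aff S T) →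
            (∀ t → A′ t → ∃ λ s → A s × fun f s ≡ t) → (∀ s → B s → B′ (fun f s)) → Cover T A′ B′
map-image (none p) f to from = none λ t a′ → case to t a′ of λ (s , a , _) → p s a
map-image (image A₁ B₁ t g p q) f to from = image A₁ B₁ t (f ∘A g)
  (λ t a′ → case to t a′ of λ { (s , a , refl) → case p s a of λ { (w , a₁ , refl) → w , a₁ , refl } })
  (λ w b → from _ (q w b))
map-image {A′ = A′} {B′ = B′} (both A₁ A₂ B₁ B₂ c₁ c₂ p q₁ q₂) f to from =
  both (λ t → ∃ λ s → A₁ s × fun f s ≡ t) (λ t → ∃ λ s → A₂ s × fun f s ≡ t) B′ B′
    (map-image c₁ f (λ _ x → x) (λ s b → from s (q₁ s b)))
    (map-image c₂ f (λ _ x → x) (λ s b → from s (q₂ s b)))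
    (λ t a′ → case to t a′ of λ (s , a , eq) → case p s a of λ
      { (inj₁ a₁) → inj₁ (s , a₁ , eq) ; (inj₂ a₂) → inj₂ (s , a₂ , eq) })
    (λ _ b → b) (λ _ b → b)

weaken : ∀ {S A B A′ B′} → Cover S A B → (∀ s → A′ s → A s) → (∀ s → B s → B′ s) → Cover S A′ B′
weaken c to from = map-image c idA (λ s a → s , to s a , refl) from

union : ∀ {S A₁ A₂ B} → Cover S A₁ B → Cover S A₂ B → Cover S (λ s → A₁ s ⊎ A₂ s) B
union {S} {A₁} {A₂} {B} c₁ c₂ = both A₁ A₂ B B c₁ c₂ (λ _ x → x) (λ _ b → b) (λ _ b → b)

⋃Fin : ∀ {S n} {A : Fin n → ∣ S ∣ → Set} {B} → (∀ i → Cover S (A i) B) → Cover S (λ s → ∃ λ i → A i s) B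
⋃Fin {n = zero}  c = none λ { s (() , _) }
⋃Fin {n = suc n} c = weaken (union (c zero) (⋃Fin (c ∘ suc)))
  (λ { s (zero , a) → inj₁ a ; s (suc i , a) → inj₂ (i , a) }) (λ _ b → b)

⋃< : ∀ {S} n {A : ℕ → ∣ S ∣ → Set} {B} → (∀ i → Cover S (A i) B) → Cover S (λ s → ∃ λ i → i < n × A i s) B
⋃< n {A} c = weaken (⋃Fin {n = n} (c ∘ Fin.toℕ))
  (λ { s (i , lt , a) → Fin.fromℕ< lt , subst (λ k → A k s) (sym (Finₚ.toℕ-fromℕ< lt)) a }) (λ _ b → b)

-- A linear constraint is imposed by reparametrising: a cover has to be found only on the orthants
-- that parametrise its solutions.
Sol-cover : ∀ {m} {Q A B : Vec ℕ m → Set} → Sol Q →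
            (∀ {n} (u : Aff (V n) (V m)) → (∀ z → Q (fun u z)) → Cover (V n) (A ∘ fun u) (B ∘ fun u)) →
            Cover (V m) (λ w → A w × Q w) (λ w → B w × Q w)
Sol-cover (none p) k = none λ w → p w ∘ proj₂
Sol-cover (img u p c) k = map-image (k u p) u
  (λ { w (a , q) → case c w q of λ { (z , refl) → z , a , refl } }) (λ z b → b , p z)
Sol-cover {A = A} {B} (or {Q₁} {Q₂} s₁ s₂ c p₁ p₂) k =
  both (λ w → A w × Q₁ w) (λ w → A w × Q₂ w) (λ w → B w × Q₁ w) (λ w → B w × Q₂ w)
    (Sol-cover s₁ λ u q → k u (λ z → p₁ _ (q z))) (Sol-cover s₂ λ u q → k u (λ z → p₂ _ (q z)))
    (λ { w (a , q) → case c w q of λ { (inj₁ q₁) → inj₁ (a , q₁) ; (inj₂ q₂) → inj₂ (a , q₂) } })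
    (λ { w (b , q) → b , p₁ w q }) (λ { w (b , q) → b , p₂ w q })

shiftA : ∀ {n} → Vec ℕ n → Aff (V n) (V n)
shiftA s = mkAff (s +v_) id (λ x v → sym (CMon.assoc (V _) s x v))

≤v-or-small : ∀ {n} (s w : Vec ℕ n) → (s ≤v w) ⊎ (∃ λ i → lookup w i < lookup s i)
≤v-or-small s w with Finₚ.any? (λ i → suc (lookup w i) ≤? lookup s i)
... | yes p = inj₂ p
... | no ¬p = inj₁ λ i → ≮⇒≥ λ lt → ¬p (i , lt)

Pumpable-shift : ∀ {m} {B : Vec ℕ m → Set} s → Pumpable B → Pumpable (λ w → B (s +v w))
Pumpable-shift {B = B} s p z h with p (s +v z) h
... | N , q = N , λ j → subst B (CMon.assoc (V _) s z _) (q j)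

-- Moving the origin to a point of B far inside the orthant leaves finitely many sections
-- uncovered, hence the hereditary structure of a tree may be built by induction on the dimension
-- from a decision made separately at each affine parametrisation.
cover-by-pumping :
  ∀ {S} (A B : ∣ S ∣ → Set) (P : ∀ {n} → Aff (V n) S → Set) →
  (∀ {m n} (g : Aff (V n) S) (u : Aff (V m) (V n)) → P g → P (g ∘A u)) →
  (∀ {n} (g : Aff (V n) S) → P g → Cover (V n) (A ∘ fun g) (B ∘ fun g) ⊎ Pumpable (B ∘ fun g)) →
  ∀ n (g : Aff (V n) S) → P g → Cover (V n) (A ∘ fun g) (B ∘ fun g)
cover-by-pumping {S} A B P P-∘ decide = go
  where
  go : ∀ n (g : Aff (V n) S) → P g → Cover (V n) (A ∘ fun g) (B ∘ fun g)
  section : ∀ n (g : Aff (V n) S) → P g → ∀ i v →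
            Cover (V (pred n)) (λ w → A (fun g (ins i v w))) (λ w → B (fun g (ins i v w)))

  go n g pg with decide g pg
  ... | inj₁ c    = c
  ... | inj₂ pump = both
      (λ w → A (fun g w) × (s ≤v w)) (λ w → ∃ λ i → ∃ λ v → v < lookup s i × (A (fun g w) × lookup w i ≡ v))
      (λ w → B (fun g w)) (λ w → B (fun g w))
      (image (λ w → A (fun g (s +v w))) (λ w → B (fun g (s +v w)))
        (node (subst (λ w → B (fun g w)) start (proj₂ (pump 𝟘 𝟘) 0)) (Pumpable-shift {B = B ∘ fun g} s pump)
              (section n (g ∘A shiftA s) (P-∘ g (shiftA s) pg)))
        (shiftA s)
        (λ { w (a , le) → w ∸v s , subst (λ x → A (fun g x)) (sym (x+[y∸x] s w le)) a , x+[y∸x] s w le })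
        (λ w b → b))
      (⋃Fin λ i → ⋃< (lookup s i) λ v → map-image (section n g pg i v) (insA i v)
          (λ { t (a , eq) → rem i t , subst (λ x → A (fun g x)) (sym (ins-rem i t eq)) a ,
                            trans (fun-insA i _ _) (ins-rem i t eq) }) (λ t b → subst (λ x → B (fun g x)) (sym (fun-insA i v t)) b))
      (λ w a → case ≤v-or-small s w of λ
        { (inj₁ le) → inj₁ (a , le)
        ; (inj₂ (i , lt)) → inj₂ (i , lookup w i , lt , a , refl) })
      (λ _ b → b) (λ _ b → b)
    where
    s : Vec ℕ n
    -- The point pumped from the origin with `j = 0`; the factor `1` is kept so that it is literally
    -- the point given by `pump`.
    s = (1 * suc (proj₁ (pump 𝟘 𝟘))) · (𝟙 +v 𝟘)
    start : 𝟘 +v s ≡ s +v 𝟘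
    start = CMon.comm (V _) 𝟘 s

  section (suc n) g pg i v = go n (g ∘A insA i v) (P-∘ g (insA i v) pg)

upper : ∀ {n} (w : Vec ℕ n) → ∃ λ k → ∀ i → lookup w i ≤ k
upper []      = 0 , λ ()
upper (x ∷ w) with upper w
... | k , p = x + k , λ { zero → m≤m+n x k ; (suc i) → ≤-trans (p i) (m≤n+m k x) }

-- `w` is a part of some `k · 𝟙` and all values are nonnegative, so `lin φ w` is at most
-- `lin φ (k · 𝟙)`, which is 0. One evaluation at `𝟙` thus decides whether a form varies at all.
lin-zero⇒const : ∀ {n} (φ : Aff (V n) Nat) → lin φ 𝟙 ≡ 0 → ∀ w → fun φ w ≡ fun φ 𝟘
lin-zero⇒const {n} φ eq w with upper w
... | k , p = trans (fun-0 φ w) (trans (cong (fun φ 𝟘 +_) lin≡0) (+-identityʳ _))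
  where
  open ≡-Reasoning
  k𝟙 : ∀ i → lookup w i ≤ lookup (k · 𝟙) i
  k𝟙 i = ≤-trans (p i) (≤-reflexive (sym (trans (lookup-· k 𝟙 i) (trans (cong (k *_) (lookup-𝟙 i)) (*-identityʳ k)))))
  lin≡0 : lin φ w ≡ 0
  lin≡0 = m+n≡0⇒m≡0 (lin φ w) (begin
    lin φ w + lin φ ((k · 𝟙) ∸v w)  ≡⟨ lin-⊕ φ w _ ⟨
    lin φ (w +v ((k · 𝟙) ∸v w))     ≡⟨ cong (lin φ) (x+[y∸x] w _ k𝟙) ⟩
    lin φ (k · 𝟙)                   ≡⟨ lin-mul φ k 𝟙 ⟩
    CMon.mul Nat k (lin φ 𝟙)        ≡⟨ cong (CMon.mul Nat k) eq ⟩
    CMon.mul Nat k 0                ≡⟨ CMon.mul-0 Nat k ⟩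
    0                               ∎)

zero-row? : ∀ {m} (r : Vec ℕ m) → (∃ λ i → lookup r i ≡ 0) ⊎ (𝟙 ≤v r)
zero-row? r with Finₚ.any? (λ i → lookup r i ≟ 0)
... | yes p = inj₁ p
... | no ¬p = inj₂ λ i → ≤-trans (≤-reflexive (lookup-𝟙 i)) (n≢0⇒n>0 λ e → ¬p (i , e))

-- Positive rows send the direction `𝟙 +v h` to a vector that can again be written as `𝟙` plus
-- something, the only kind of direction that `Pumpable` accepts.
Pumpable-∘ : ∀ {m n} {B : Vec ℕ m → Set} (g : Aff (V n) (V m)) → 𝟙 ≤v lin g 𝟙 → Pumpable B → Pumpable (B ∘ fun g)
Pumpable-∘ {B = B} g pos pump z h with pump (fun g z) ((lin g 𝟙 ∸v 𝟙) +v lin g h)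
... | N , p = N , λ j → subst B (sym (eq (suc j * suc N))) (p j)
  where
  open ≡-Reasoning
  eq : ∀ k → fun g (z +v k · (𝟙 +v h)) ≡ fun g z +v k · (𝟙 +v ((lin g 𝟙 ∸v 𝟙) +v lin g h))
  eq k = trans (aff g z _) (cong (fun g z +v_) (begin
    lin g (k · (𝟙 +v h))                       ≡⟨ lin-mul g k _ ⟩
    k · lin g (𝟙 +v h)                         ≡⟨ cong (k ·_) (lin-⊕ g 𝟙 h) ⟩
    k · (lin g 𝟙 +v lin g h)                   ≡⟨ cong (λ x → k · (x +v lin g h)) (x+[y∸x] 𝟙 (lin g 𝟙) pos) ⟨
    k · ((𝟙 +v (lin g 𝟙 ∸v 𝟙)) +v lin g h)     ≡⟨ cong (k ·_) (CMon.assoc (V _) 𝟙 _ _) ⟩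
    k · (𝟙 +v ((lin g 𝟙 ∸v 𝟙) +v lin g h))     ∎))

Pumpable-× : ∀ {m} {B B′ : Vec ℕ m → Set} → Pumpable B → Pumpable B′ → Pumpable (λ w → B w × B′ w)
Pumpable-× {B = B} {B′} p p′ z h with p z h | p′ z h
... | N , q | N′ , q′ = N′ + N * suc N′ , λ j →
  subst (λ k → B (z +v k · (𝟙 +v h))) (lem₁ j N N′) (q (N′ + j * suc N′)) ,
  subst (λ k → B′ (z +v k · (𝟙 +v h))) (lem₂ j N N′) (q′ (N + j * suc N))
  where
  lem₁ : ∀ j N N′ → suc (N′ + j * suc N′) * suc N ≡ suc j * suc (N′ + N * suc N′)
  lem₁ = solve-∀
  lem₂ : ∀ j N N′ → suc (N + j * suc N) * suc N′ ≡ suc j * suc (N′ + N * suc N′)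
  lem₂ = solve-∀

-- Intersections, joins and preimages of covers

-- Both trees are pulled back to common parameters. If a coordinate of one of them is constant
-- there, the intersection lies in a section, whose cover is a part of that tree; if none is, both
-- are pumped at once. The recursion is on the two trees, either of which may shrink.
meet-tree : ∀ {m m′ A B A′ B′} → Tree m A B → Tree m′ A′ B′ →
            ∀ n (g : Aff (V n) (V m)) (g′ : Aff (V n) (V m′)) →
            Cover (V n) (λ w → A (fun g w) × A′ (fun g′ w)) (λ w → B (fun g w) × B′ (fun g′ w))
meet-decide : ∀ {m m′ A B A′ B′} → Tree m A B → Tree m′ A′ B′ → ∀ {n} (h : Aff (V n) (V m ⊗ V m′)) →
  ((∃ λ i → lookup (proj₁ (lin h 𝟙)) i ≡ 0) ⊎ (𝟙 ≤v proj₁ (lin h 𝟙))) →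
  ((∃ λ i → lookup (proj₂ (lin h 𝟙)) i ≡ 0) ⊎ (𝟙 ≤v proj₂ (lin h 𝟙))) →
  Cover (V n) (λ w → A (proj₁ (fun h w)) × A′ (proj₂ (fun h w))) (λ w → B (proj₁ (fun h w)) × B′ (proj₂ (fun h w)))
    ⊎ Pumpable (λ w → B (proj₁ (fun h w)) × B′ (proj₂ (fun h w)))
-- A leaf of the cover is known only as an image under some `f`, so its parameters `w` are adjoined
-- to `t` with the equation `fun f w ≡ fun g t`. Solving it leads back to two trees over common
-- parameters.
meet-cover : ∀ {S m′ A B A′ B′} → Cover S A B → Solvable S → Tree m′ A′ B′ →
             ∀ n (g : Aff (V n) S) (g′ : Aff (V n) (V m′)) →
             Cover (V n) (λ w → A (fun g w) × A′ (fun g′ w)) (λ w → B (fun g w) × B′ (fun g′ w))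

meet-tree {m} {m′} {A} {B} {A′} {B′} T T′ n g g′ =
  cover-by-pumping {V m ⊗ V m′} (λ s → A (proj₁ s) × A′ (proj₂ s)) (λ s → B (proj₁ s) × B′ (proj₂ s))
    (λ _ → ⊤) (λ _ _ _ → tt) (λ h _ → meet-decide T T′ h (zero-row? (proj₁ (lin h 𝟙))) (zero-row? (proj₂ (lin h 𝟙)))) n ⟨ g , g′ ⟩A tt

meet-decide {m} {m′} {A} {B} {A′} {B′} T@(node b p c) T′@(node b′ p′ c′) {n} h (inj₁ (i , z)) _ = inj₁ (weaken (meet-cover (c i v) (solve-V _) T′ n (remA i ∘A h₁) h₂)
    (λ w (a , a′) → subst A (sym (back w)) a , a′) (λ w (b , b′) → subst B (back w) b , b′))
  where
  h₁ = fstA {V m} {V m′} ∘A h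
  h₂ = sndA {V m} {V m′} ∘A h
  v = lookup (fun h₁ 𝟘) i
  back : ∀ w → ins i v (fun (remA i) (fun h₁ w)) ≡ fun h₁ w
  back w = trans (cong (ins i v) (fun-remA i _)) (ins-rem i _ (lin-zero⇒const (lookupA i ∘A h₁) z w))
meet-decide {m} {m′} {A} {B} {A′} {B′} T@(node b p c) T′@(node b′ p′ c′) {n} h (inj₂ pos) (inj₁ (i , z)) = inj₁ (weaken (meet-cover (c′ i v) (solve-V _) T n (remA i ∘A h₂) h₁)
    (λ w (a , a′) → subst A′ (sym (back w)) a′ , a) (λ w (b′ , b) → b , subst B′ (back w) b′))
  where
  h₁ = fstA {V m} {V m′} ∘A h
  h₂ = sndA {V m} {V m′} ∘A h
  v = lookup (fun h₂ 𝟘) i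
  back : ∀ w → ins i v (fun (remA i) (fun h₂ w)) ≡ fun h₂ w
  back w = trans (cong (ins i v) (fun-remA i _)) (ins-rem i _ (lin-zero⇒const (lookupA i ∘A h₂) z w))
meet-decide {m} {m′} {A} {B} {A′} {B′} T@(node b p c) T′@(node b′ p′ c′) {n} h (inj₂ pos) (inj₂ pos′) = inj₂ (Pumpable-× {B = B ∘ proj₁ ∘ fun h} {B′ = B′ ∘ proj₂ ∘ fun h}
    (Pumpable-∘ {B = B} (fstA {V m} {V m′} ∘A h) pos p) (Pumpable-∘ {B = B′} (sndA {V m} {V m′} ∘A h) pos′ p′))

meet-cover (none p) s T′ n g g′ = none λ w → p (fun g w) ∘ proj₁
meet-cover {S} {m′} {A} {B} {A′} {B′} (image {m} A₁ B₁ T f p q) s T′ n g g′ =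
  map-image
    (Sol-cover {A = λ w → A₁ (Vec.take m w) × A′ (fun g′ (Vec.drop m w))} {B = λ w → B₁ (Vec.take m w) × B′ (fun g′ (Vec.drop m w))}
      (s (f ∘A takeA m) (g ∘A dropA m))
      (λ u _ → meet-tree T T′ _ (takeA m ∘A u) (g′ ∘A dropA m ∘A u)))
    (dropA m)
    (λ t (a , a′) → case p (fun g t) a of λ (w , a₁ , eq) → w Vec.++ t ,
      ((subst A₁ (sym (take-++ w t)) a₁ , subst (A′ ∘ fun g′) (sym (drop-++ w t)) a′) ,
       trans (cong (fun f) (take-++ w t)) (trans eq (cong (fun g) (sym (drop-++ w t))))) , drop-++ w t)
    (λ t ((b₁ , b′) , eq) → subst B eq (q _ b₁) , b′)
meet-cover {S} {m′} {A} {B} {A′} {B′} (both A₁ A₂ B₁ B₂ c₁ c₂ p q₁ q₂) s T′ n g g′ =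
  both (λ w → A₁ (fun g w) × A′ (fun g′ w)) (λ w → A₂ (fun g w) × A′ (fun g′ w))
       (λ w → B₁ (fun g w) × B′ (fun g′ w)) (λ w → B₂ (fun g w) × B′ (fun g′ w))
    (meet-cover c₁ s T′ n g g′) (meet-cover c₂ s T′ n g g′)
    (λ w (a , a′) → case p _ a of λ { (inj₁ a₁) → inj₁ (a₁ , a′) ; (inj₂ a₂) → inj₂ (a₂ , a′) })
    (λ w (b , b′) → q₁ _ b , b′) (λ w (b , b′) → q₂ _ b , b′)

-- The fibre product over `E`, mapped on by `ψ`. Composition of relations, intersection and fixing a
-- value are all instances.
Join : ∀ {S S′ E U} (A : ∣ S ∣ → Set) (A′ : ∣ S′ ∣ → Set) (φ : Aff S E) (φ′ : Aff S′ E) (ψ : Aff (S ⊗ S′) U) → ∣ U ∣ → Set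
Join A A′ φ φ′ ψ t = ∃ λ s → ∃ λ s′ → A s × A′ s′ × fun φ s ≡ fun φ′ s′ × fun ψ (s , s′) ≡ t

join : ∀ {S S′ E U A B A′ B′} → Cover S A B → Cover S′ A′ B′ → Solvable E →
       (φ : Aff S E) (φ′ : Aff S′ E) (ψ : Aff (S ⊗ S′) U) →
       Cover U (Join A A′ φ φ′ ψ) (Join B B′ φ φ′ ψ)
join (none p) c′ s φ φ′ ψ = none λ { t (x , _ , a , _) → p x a }
join {S} {S′} {E} {U} {A} {B} {A′} {B′} (both A₁ A₂ B₁ B₂ c₁ c₂ p q₁ q₂) c′ s φ φ′ ψ =
  both (Join A₁ A′ φ φ′ ψ) (Join A₂ A′ φ φ′ ψ) (Join B₁ B′ φ φ′ ψ) (Join B₂ B′ φ φ′ ψ)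
    (join c₁ c′ s φ φ′ ψ) (join c₂ c′ s φ φ′ ψ)
    (λ { t (x , y , a , r) → case p x a of λ { (inj₁ a₁) → inj₁ (x , y , a₁ , r) ; (inj₂ a₂) → inj₂ (x , y , a₂ , r) } })
    (λ { t (x , y , b , r) → x , y , q₁ x b , r }) (λ { t (x , y , b , r) → x , y , q₂ x b , r })
join (image _ _ _ _ _ _) (none p) s φ φ′ ψ = none λ { t (_ , y , _ , a′ , _) → p y a′ }
join {S} {S′} {E} {U} {A} {B} {A′} {B′} c@(image _ _ _ _ _ _) (both A₁ A₂ B₁ B₂ c₁ c₂ p q₁ q₂) s φ φ′ ψ =
  both (Join A A₁ φ φ′ ψ) (Join A A₂ φ φ′ ψ) (Join B B₁ φ φ′ ψ) (Join B B₂ φ φ′ ψ)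
    (join c c₁ s φ φ′ ψ) (join c c₂ s φ φ′ ψ)
    (λ { t (x , y , a , a′ , r) → case p y a′ of λ { (inj₁ a₁) → inj₁ (x , y , a , a₁ , r) ; (inj₂ a₂) → inj₂ (x , y , a , a₂ , r) } })
    (λ { t (x , y , b , b′ , r) → x , y , b , q₁ y b′ , r }) (λ { t (x , y , b , b′ , r) → x , y , b , q₂ y b′ , r })
join {S} {S′} {E} {U} {A} {B} {A′} {B′} (image {m} A₁ B₁ T f p q) (image {m′} A₂ B₂ T′ f′ p′ q′) s φ φ′ ψ =
  map-image
    (Sol-cover {A = λ w → A₁ (Vec.take m w) × A₂ (Vec.drop m w)} {B = λ w → B₁ (Vec.take m w) × B₂ (Vec.drop m w)}
      (s (φ ∘A f ∘A takeA m) (φ′ ∘A f′ ∘A dropA m))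
      (λ u _ → meet-tree T T′ _ (takeA m ∘A u) (dropA m ∘A u)))
    (ψ ∘A ⟨ f ∘A takeA m , f′ ∘A dropA m ⟩A)
    (λ { t (x , y , a , a′ , eq , refl) → case p x a of λ { (w , a₁ , refl) → case p′ y a′ of λ { (w′ , a₂ , refl) →
      w Vec.++ w′ , ((subst A₁ (sym (take-++ w w′)) a₁ , subst A₂ (sym (drop-++ w w′)) a₂) ,
        trans (cong (fun φ ∘ fun f) (take-++ w w′)) (trans eq (cong (fun φ′ ∘ fun f′) (sym (drop-++ w w′))))) ,
      cong (fun ψ) (cong₂ _,_ (cong (fun f) (take-++ w w′)) (cong (fun f′) (drop-++ w w′))) } } })
    (λ w ((b₁ , b₂) , eq) → _ , _ , q _ b₁ , q′ _ b₂ , eq , refl)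

full-tree : ∀ m → Tree m (λ _ → ⊤) (λ _ → ⊤)
full-tree zero    = node tt (λ _ _ → 0 , λ _ → tt) λ ()
full-tree (suc m) = node tt (λ _ _ → 0 , λ _ → tt)
  λ i v → image (λ _ → ⊤) (λ _ → ⊤) (full-tree m) idA (λ w _ → w , tt , refl) (λ _ _ → tt)

-- The intersection with a trivial tree of dimension 0: the equation solving inside `meet-cover`
-- does the work.
preimage : ∀ {S A B n} → Cover S A B → Solvable S → (g : Aff (V n) S) → Cover (V n) (A ∘ fun g) (B ∘ fun g)
preimage c s g = weaken (meet-cover c s (full-tree 0) _ g (constA [])) (λ _ a → a , tt) (λ _ → proj₁)

record Param (S : CMon) : Set where
  constructor mkParam
  field
    dim  : ℕ
    par  : Aff (V dim) S
    onto : ∀ s → ∃ λ w → fun par w ≡ s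

open Param public

param-V : ∀ n → Param (V n)
param-V n = mkParam n idA λ w → w , refl

param-Nat : Param Nat
param-Nat = mkParam 1 headA λ x → (x ∷ []) , refl

param-Unit : Param Unit
param-Unit = mkParam 0 (constA tt) λ _ → [] , refl

param-⊗ : ∀ {S T} → Param S → Param T → Param (S ⊗ T)
param-⊗ {S} {T} (mkParam m f p) (mkParam n g q) = mkParam (m + n) (⟨_,_⟩A {T = S} {U = T} (f ∘A takeA m) (g ∘A dropA m))
  λ (s , t) → case p s of λ (v , eq) → case q t of λ (w , eq′) → (v Vec.++ w) ,
    cong₂ _,_ (trans (cong (fun f) (take-++ v w)) eq) (trans (cong (fun g) (drop-++ v w)) eq′)

affine-cover : ∀ {S A B n} → (f : Aff (V n) S) → (∀ s → A s → ∃ λ w → fun f w ≡ s) → (∀ w → B (fun f w)) → Cover S A B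
affine-cover f p q = image (λ _ → ⊤) (λ _ → ⊤) (full-tree _) f (λ s a → case p s a of λ (w , eq) → w , tt , eq) (λ w _ → q w)

full-cover : ∀ {S} → Param S → Cover S (λ _ → ⊤) (λ _ → ⊤)
full-cover P = affine-cover (par P) (λ s _ → onto P s) (λ _ → tt)

-- Covers of relations on ℕᵏ

VRel : ℕ → Set₁
VRel k = Vec ℕ k → Vec ℕ k → Set

RelCover : (k : ℕ) → VRel k → VRel k → Set₁
RelCover k A B = Cover (V k ⊗ V k) (λ p → A (proj₁ p) (proj₂ p)) (λ p → B (proj₁ p) (proj₂ p))

Monotone : ∀ {k} → VRel k → Set
Monotone {k} B = ∀ (t : Vec ℕ k) {x y} → B x y → B (t +v x) (t +v y)

solve-VV : ∀ k → Solvable (V k ⊗ V k)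
solve-VV k = solve-⊗ {V k} {V k} (solve-V k) (solve-V k)

param-VV : ∀ k → Param (V k ⊗ V k)
param-VV k = param-⊗ (param-V k) (param-V k)

pullback : ∀ {S T A B} → Cover S A B → Solvable S → Param T → (g : Aff T S) → Cover T (A ∘ fun g) (B ∘ fun g)
pullback {A = A} {B} c s P g = map-image (preimage c s (g ∘A par P)) (par P)
  (λ t a → case onto P t of λ { (w , refl) → w , a , refl }) (λ _ b → b)

infixr 9 _⨾_
_⨾_ : ∀ {k} → VRel k → VRel k → VRel k
(A ⨾ B) x z = ∃ λ y → A x y × B y z

compose : ∀ {k A B A′ B′} → RelCover k A B → RelCover k A′ B′ → RelCover k (A ⨾ A′) (B ⨾ B′)
compose {k} c c′ = weaken (join c c′ (solve-V k) (sndA {V k} {V k}) (fstA {V k} {V k}) ends)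
  (λ { (x , z) (y , a , a′) → (x , y) , (y , z) , a , a′ , refl , refl })
  (λ { _ ((x , y) , (_ , z) , b , b′ , refl , refl) → y , b , b′ })
  where
  ends : Aff ((V k ⊗ V k) ⊗ (V k ⊗ V k)) (V k ⊗ V k)
  ends = mkAff (λ ((x , _) , (_ , z)) → x , z) (λ ((x , _) , (_ , z)) → x , z) (λ _ _ → refl)

Flip : ∀ {k} → VRel k → VRel k
Flip A x y = A y x

flip-cover : ∀ {k A B} → RelCover k A B → RelCover k (Flip A) (Flip B)
flip-cover {k} c = map-image c (mkAff (λ (x , y) → y , x) (λ (x , y) → y , x) (λ _ _ → refl))
  (λ (x , y) a → (y , x) , a , refl) (λ _ b → b)

≡-cover : ∀ {k} → RelCover k _≡_ _≡_
≡-cover = affine-cover (mkAff (λ x → x , x) (λ x → x , x) (λ _ _ → refl)) (λ { (x , _) refl → x , refl }) (λ _ → refl)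

StarClosed : ℕ → Set₁
StarClosed k = ∀ {A B : VRel k} → Monotone B → RelCover k A B → RelCover k (Star A) (Star B)

Star-monotone : ∀ {k} {B : VRel k} → Monotone B → Monotone (Star B)
Star-monotone m t ε        = ε
Star-monotone m t (b ◅ bs) = m t b ◅ Star-monotone m t bs

-- Finite control: Kleene's algorithm

GraphRel : ℕ → ℕ → Set₁
GraphRel n k = Fin n → Fin n → VRel k

GStep : ∀ {n k} → GraphRel n k → (Fin n × Vec ℕ k) → (Fin n × Vec ℕ k) → Set
GStep R (p , x) (q , y) = R p q x y

Via : ∀ {n k} → GraphRel n k → List (Fin n) → GraphRel n k
Via R []      p q = R p q
Via R (s ∷ L) p q x y = Via R L p q x y ⊎ (Via R L p s ⨾ Star (Via R L s s) ⨾ Via R L s q) x y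

Via-base : ∀ {n k} (R : GraphRel n k) L {p q x y} → R p q x y → Via R L p q x y
Via-base R []      r = r
Via-base R (s ∷ L) r = inj₁ (Via-base R L r)

Via-step : ∀ {n k} (R : GraphRel n k) L {p r q x u y} → r ∈ L → R p r x u → Via R L r q u y → Via R L p q x y
Via-step R (s ∷ L) (here refl) e (inj₁ v)                          = inj₂ (_ , Via-base R L e , _ , ε , v)
Via-step R (s ∷ L) (here refl) e (inj₂ (_ , v₁ , _ , st , v₂)) = inj₂ (_ , Via-base R L e , _ , v₁ ◅ st , v₂)
Via-step R (s ∷ L) (there r∈)  e (inj₁ v)                          = inj₁ (Via-step R L r∈ e v)
Via-step R (s ∷ L) (there r∈)  e (inj₂ (_ , v₁ , _ , st , v₂)) = inj₂ (_ , Via-step R L r∈ e v₁ , _ , st , v₂)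

-- `Via` describes nonempty paths, whence the first alternative; `graph-cover` accounts for it
-- through `≡-cover`.
Via-complete : ∀ {n k} (R : GraphRel n k) {p q x y} → Star (GStep R) (p , x) (q , y) →
               (p ≡ q × x ≡ y) ⊎ Via R (List.allFin n) p q x y
Via-complete R ε = inj₁ (refl , refl)
Via-complete {n} R (_◅_ {j = r , u} e es) with Via-complete R es
... | inj₁ (refl , refl) = inj₂ (Via-base R (List.allFin n) e)
... | inj₂ v             = inj₂ (Via-step R (List.allFin n) (∈-allFin r) e v)

Via-sound : ∀ {n k} (R : GraphRel n k) L {p q x y} → Via R L p q x y → Star (GStep R) (p , x) (q , y)
Via-sound R [] r = r ◅ ε
Via-sound R (s ∷ L) (inj₁ v) = Via-sound R L v
Via-sound {k = k} R (s ∷ L) (inj₂ (_ , v₁ , _ , st , v₂)) = Via-sound R L v₁ ◅◅ loops st ◅◅ Via-sound R L v₂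
  where
  loops : ∀ {u v : Vec ℕ k} → Star (Via R L s s) u v → Star (GStep R) (s , u) (s , v)
  loops ε        = ε
  loops (l ◅ ls) = Via-sound R L l ◅◅ loops ls

Via-monotone : ∀ {n k} (R : GraphRel n k) → (∀ p q → Monotone (R p q)) → ∀ L p q → Monotone (Via R L p q)
Via-monotone R m []      p q = m p q
Via-monotone R m (s ∷ L) p q t (inj₁ v) = inj₁ (Via-monotone R m L p q t v)
Via-monotone R m (s ∷ L) p q t (inj₂ (_ , v₁ , _ , st , v₂)) = inj₂ (_ , Via-monotone R m L p s t v₁ , _ ,
  Star-monotone (Via-monotone R m L s s) t st , Via-monotone R m L s q t v₂)

Via-cover : ∀ {n k} → StarClosed k → (A B : GraphRel n k) → (∀ p q → Monotone (B p q)) →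
            (∀ p q → RelCover k (A p q) (B p q)) → ∀ L p q → RelCover k (Via A L p q) (Via B L p q)
Via-cover sc A B m c []      p q = c p q
Via-cover sc A B m c (s ∷ L) p q = union
  (weaken (rec p q) (λ _ a → a) (λ _ → inj₁))
  (weaken (compose (rec p s) (compose (sc (Via-monotone B m L s s) (rec s s)) (rec s q))) (λ _ a → a) (λ _ → inj₂))
  where rec = Via-cover sc A B m c L

graph-cover : ∀ {n k} → StarClosed k → (A B : GraphRel n k) → (∀ p q → Monotone (B p q)) →
              (∀ p q → RelCover k (A p q) (B p q)) → ∀ p q →
              RelCover k (λ x y → Star (GStep A) (p , x) (q , y)) (λ x y → Star (GStep B) (p , x) (q , y))
graph-cover {n} {k} sc A B m c p q = weaken (union endpoints (weaken (Via-cover sc A B m c (List.allFin n) p q) (λ _ a → a) (λ _ → Via-sound B (List.allFin n))))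
  (λ _ → Via-complete A) (λ _ b → b)
  where
  endpoints : RelCover k (λ x y → p ≡ q × x ≡ y) (λ x y → Star (GStep B) (p , x) (q , y))
  endpoints with p Fin.≟ q
  ... | yes refl = weaken ≡-cover (λ _ → proj₂) (λ { _ refl → ε })
  ... | no ne    = none λ _ → ne ∘ proj₁

-- Almost full relations and Dickson's lemma

-- A constructive form of the statement that every infinite sequence has a related pair at positions
-- `i < j`. Once `x` has been seen, a later `y` with `R x y` makes every further element acceptable.
data AF {X : Set} (R : X → X → Set) : Set₁ where
  now   : (∀ x y → R x y) → AF R
  later : (∀ x → AF (λ y z → R y z ⊎ R x y)) → AF R

AF-mono : ∀ {X} {R S : X → X → Set} → (∀ x y → R x y → S x y) → AF R → AF S
AF-mono p (now r)   = now λ x y → p x y (r x y)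
AF-mono p (later f) = later λ x → AF-mono (λ y z → Sum.map (p y z) (p x y)) (f x)

AF-on : ∀ {X Y} {R : Y → Y → Set} (f : X → Y) → AF R → AF (λ x y → R (f x) (f y))
AF-on f (now r)   = now λ x y → r (f x) (f y)
AF-on f (later g) = later λ x → AF-on f (g (f x))

module _ {X : Set} where
  -- The intuitionistic Ramsey argument in three layers: `A` and `B` are propositions, then unary,
  -- then binary. Fixing the first element `x` of a pair lowers their arity by one, and `T` collects
  -- what has been achieved already.
  AF-∩₀ : ∀ {S S′ T : X → X → Set} {A B : Set} → AF S → (∀ y z → S y z → T y z ⊎ A) →
          AF S′ → (∀ y z → S′ y z → T y z ⊎ B) → AF (λ y z → T y z ⊎ (A × B))
  AF-∩₀ (now s) p q p′ = AF-mono (λ y z s′ → case p y z (s y z) of λ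
    { (inj₁ t) → inj₁ t ; (inj₂ a) → Sum.map₂ (a ,_) (p′ y z s′) }) q
  AF-∩₀ {T = T} (later f) p q p′ = later λ x → AF-mono
    (λ { y z (inj₁ (inj₁ t)) → inj₁ (inj₁ t) ; y z (inj₁ (inj₂ t)) → inj₂ (inj₁ t) ; y z (inj₂ ab) → inj₁ (inj₂ ab) })
    (AF-∩₀ {T = λ y z → T y z ⊎ T x y} (f x)
      (λ { y z (inj₁ s) → Sum.map₁ inj₁ (p y z s) ; y z (inj₂ s) → Sum.map₁ inj₂ (p x y s) })
      q (λ y z s′ → Sum.map₁ inj₁ (p′ y z s′)))

  AF-∩₁ : ∀ {S S′ T : X → X → Set} {A B : X → Set} → AF S → (∀ y z → S y z → T y z ⊎ A y) →
          AF S′ → (∀ y z → S′ y z → T y z ⊎ B y) → AF (λ y z → T y z ⊎ (A y × B y))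
  AF-∩₁ (now s) p q p′ = AF-mono (λ y z s′ → case p y z (s y z) of λ
    { (inj₁ t) → inj₁ t ; (inj₂ a) → Sum.map₂ (a ,_) (p′ y z s′) }) q
  AF-∩₁ (later f) p (now s′) p′ = AF-mono (λ y z s → case p′ y z (s′ y z) of λ
    { (inj₁ t) → inj₁ t ; (inj₂ b) → Sum.map₂ (_, b) (p y z s) }) (later f)
  AF-∩₁ {T = T} {A} {B} (later f) p (later g) p′ = later λ x → AF-mono
    (λ { y z (inj₁ (inj₁ t)) → inj₁ t ; y z (inj₁ (inj₂ t)) → inj₂ (inj₁ t) ; y z (inj₂ ab) → inj₂ (inj₂ ab) })
    (AF-∩₀ {T = λ y z → (T y z ⊎ (A y × B y)) ⊎ T x y} {A x} {B x}
      (AF-∩₁ {T = λ y z → (T y z ⊎ T x y) ⊎ A x} {A} {B} (f x)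
        (λ { y z (inj₁ s) → Sum.map₁ (inj₁ ∘ inj₁) (p y z s) ; y z (inj₂ s) → inj₁ (Sum.map₁ inj₂ (p x y s)) })
        (later g) (λ y z s′ → Sum.map₁ (inj₁ ∘ inj₁) (p′ y z s′)))
      (λ { y z (inj₁ (inj₁ (inj₁ t))) → inj₁ (inj₁ (inj₁ t)) ; y z (inj₁ (inj₁ (inj₂ t))) → inj₁ (inj₂ t)
         ; y z (inj₁ (inj₂ a)) → inj₂ a ; y z (inj₂ ab) → inj₁ (inj₁ (inj₂ ab)) })
      (AF-∩₁ {T = λ y z → (T y z ⊎ T x y) ⊎ B x} {A} {B} (later f) (λ y z s → Sum.map₁ (inj₁ ∘ inj₁) (p y z s))
        (g x)
        (λ { y z (inj₁ s) → Sum.map₁ (inj₁ ∘ inj₁) (p′ y z s) ; y z (inj₂ s) → inj₁ (Sum.map₁ inj₂ (p′ x y s)) }))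
      (λ { y z (inj₁ (inj₁ (inj₁ t))) → inj₁ (inj₁ (inj₁ t)) ; y z (inj₁ (inj₁ (inj₂ t))) → inj₁ (inj₂ t)
         ; y z (inj₁ (inj₂ b)) → inj₂ b ; y z (inj₂ ab) → inj₁ (inj₁ (inj₂ ab)) }))

  AF-∩₂ : ∀ {S S′ T A B : X → X → Set} → AF S → (∀ y z → S y z → T y z ⊎ A y z) →
          AF S′ → (∀ y z → S′ y z → T y z ⊎ B y z) → AF (λ y z → T y z ⊎ (A y z × B y z))
  AF-∩₂ (now s) p q p′ = AF-mono (λ y z s′ → case p y z (s y z) of λ
    { (inj₁ t) → inj₁ t ; (inj₂ a) → Sum.map₂ (a ,_) (p′ y z s′) }) q
  AF-∩₂ (later f) p (now s′) p′ = AF-mono (λ y z s → case p′ y z (s′ y z) of λ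
    { (inj₁ t) → inj₁ t ; (inj₂ b) → Sum.map₂ (_, b) (p y z s) }) (later f)
  AF-∩₂ {T = T} {A} {B} (later f) p (later g) p′ = later λ x → AF-mono
    (λ { y z (inj₁ (inj₁ t)) → inj₁ t ; y z (inj₁ (inj₂ t)) → inj₂ (inj₁ t) ; y z (inj₂ ab) → inj₂ (inj₂ ab) })
    (AF-∩₁ {T = λ y z → (T y z ⊎ (A y z × B y z)) ⊎ T x y} {A x} {B x}
      (AF-∩₂ {T = λ y z → (T y z ⊎ T x y) ⊎ A x y} {A} {B} (f x)
        (λ { y z (inj₁ s) → Sum.map₁ (inj₁ ∘ inj₁) (p y z s) ; y z (inj₂ s) → inj₁ (Sum.map₁ inj₂ (p x y s)) })
        (later g) (λ y z s′ → Sum.map₁ (inj₁ ∘ inj₁) (p′ y z s′)))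
      (λ { y z (inj₁ (inj₁ (inj₁ t))) → inj₁ (inj₁ (inj₁ t)) ; y z (inj₁ (inj₁ (inj₂ t))) → inj₁ (inj₂ t)
         ; y z (inj₁ (inj₂ a)) → inj₂ a ; y z (inj₂ ab) → inj₁ (inj₁ (inj₂ ab)) })
      (AF-∩₂ {T = λ y z → (T y z ⊎ T x y) ⊎ B x y} {A} {B} (later f) (λ y z s → Sum.map₁ (inj₁ ∘ inj₁) (p y z s))
        (g x)
        (λ { y z (inj₁ s) → Sum.map₁ (inj₁ ∘ inj₁) (p′ y z s) ; y z (inj₂ s) → inj₁ (Sum.map₁ inj₂ (p′ x y s)) }))
      (λ { y z (inj₁ (inj₁ (inj₁ t))) → inj₁ (inj₁ (inj₁ t)) ; y z (inj₁ (inj₁ (inj₂ t))) → inj₁ (inj₂ t)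
         ; y z (inj₁ (inj₂ b)) → inj₂ b ; y z (inj₂ ab) → inj₁ (inj₁ (inj₂ ab)) }))

AF-≤ : AF _≤_
AF-≤ = later below
  where
  below : ∀ n → AF (λ y z → y ≤ z ⊎ n ≤ y)
  below zero    = now λ _ _ → inj₂ z≤n
  below (suc n) = later λ x → case suc n ≤? x of λ
    { (yes le) → now λ _ _ → inj₂ (inj₂ le)
    ; (no nle) → AF-mono (λ { y z (inj₁ p) → inj₁ (inj₁ p) ; y z (inj₂ q) → inj₂ (inj₁ (≤-trans (s≤s⁻¹ (≰⇒> nle)) q)) }) (below n) }

dickson : ∀ k → AF (_≤v_ {k})
dickson zero    = now λ _ _ ()
dickson (suc k) = AF-mono
  (λ { (a ∷ x) (b ∷ y) (inj₂ (p , q)) zero → p ; (a ∷ x) (b ∷ y) (inj₂ (p , q)) (suc i) → q i })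
  (AF-∩₂ {T = λ _ _ → ⊥} (AF-on Vec.head AF-≤) (λ _ _ → inj₂) (AF-on Vec.tail (dickson k)) (λ _ _ → inj₂))

AF-sequence : ∀ {X} {R : X → X → Set} → AF R → (f : ℕ → X) → ∃ λ i → ∃ λ j → i < j × R (f i) (f j)
AF-sequence (now r)   f = 0 , 1 , s≤s z≤n , r _ _
AF-sequence (later g) f with AF-sequence (g (f 0)) (f ∘ suc)
... | i , j , lt , inj₁ r = suc i , suc j , s≤s lt , r
... | i , j , lt , inj₂ r = 0 , suc i , s≤s z≤n , r

Good : {X : Set} → (X → X → Set) → List X → Set
Good R []      = ⊥
Good R (x ∷ h) = (∃ λ y → y ∈ h × R y x) ⊎ Good R h

-- Almost fullness relative to an explicit history, newest first. Recursion on a bar drives the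
-- searches that extend a list as long as it contains no related pair.
data Bar {X : Set} (R : X → X → Set) (h : List X) : Set where
  now   : Good R h → Bar R h
  later : (∀ x → Bar R (x ∷ h)) → Bar R h

AF⇒Bar : ∀ {X} {R : X → X → Set} → AF R → Bar R []
AF⇒Bar {X} {R} af = go af [] λ y z r → inj₁ (y , here refl , r)
  where
  skip : ∀ {x y z h} → Good R (z ∷ y ∷ h) → Good R (z ∷ y ∷ x ∷ h)
  skip (inj₁ (w , here e , r))           = inj₁ (w , here e , r)
  skip (inj₁ (w , there w∈ , r))         = inj₁ (w , there (there w∈) , r)
  skip (inj₂ (inj₁ (w , w∈ , r)))        = inj₂ (inj₁ (w , there w∈ , r))
  skip (inj₂ (inj₂ g))                   = inj₂ (inj₂ (inj₂ g))
  go : ∀ {S : X → X → Set} → AF S → ∀ h → (∀ y z → S y z → Good R (z ∷ y ∷ h)) → Bar R h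
  go (now s)   h p = later λ y → later λ z → now (p y z (s y z))
  go (later f) h p = later λ x → go (f x) (x ∷ h)
    λ { y z (inj₁ s) → skip (p y z s) ; y z (inj₂ s) → inj₂ (p x y s) }

-- Covers at a fixed value; masks

restrict : ∀ {S E A B} → Cover S A B → Solvable E → (φ : Aff S E) → ∀ e →
           Cover S (λ s → A s × fun φ s ≡ e) (λ s → B s × fun φ s ≡ e)
restrict {S} c solve φ e = weaken (join c (full-cover param-Unit) solve φ (constA e) (fstA {S} {Unit}))
  (λ s (a , eq) → s , tt , a , tt , eq , refl) (λ { s (_ , _ , b , _ , eq , refl) → b , eq })

-- A mask marks the coordinates whose value is irrelevant (ω in a Karp–Miller tree).
Mask : ℕ → Set
Mask = Vec Bool

infix 4 _⊆m_
_⊆m_ : ∀ {k} → Mask k → Mask k → Set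
S ⊆m S′ = ∀ i → lookup S i ≡ true → lookup S′ i ≡ true

Agree : ∀ {k} → Mask k → Vec ℕ k → Vec ℕ k → Set
Agree S x u = ∀ i → lookup S i ≡ false → lookup x i ≡ lookup u i

false⇐ : ∀ {k} (S S′ : Mask k) → S ⊆m S′ → ∀ i → lookup S′ i ≡ false → lookup S i ≡ false
false⇐ S S′ sub i f with lookup S i in eq
... | false = refl
... | true  = contradiction (trans (sym (sub i eq)) f) λ ()

Agree-⊆ : ∀ {k} (S S′ : Mask k) {x u} → S ⊆m S′ → Agree S x u → Agree S′ x u
Agree-⊆ S S′ sub a i f = a i (false⇐ S S′ sub i f)

onMask offMask : ∀ {k} → Mask k → Vec ℕ k → Vec ℕ k
onMask  = Vec.zipWith (λ b n → if b then n else 0)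
offMask = Vec.zipWith (λ b n → if b then 0 else n)

lookup-on : ∀ {k} (S : Mask k) x i → lookup S i ≡ true → lookup (onMask S x) i ≡ lookup x i
lookup-on S x i eq = trans (lookup-zipWith _ i S x) (cong (λ b → if b then lookup x i else 0) eq)

lookup-on′ : ∀ {k} (S : Mask k) x i → lookup S i ≡ false → lookup (onMask S x) i ≡ 0
lookup-on′ S x i eq = trans (lookup-zipWith _ i S x) (cong (λ b → if b then lookup x i else 0) eq)

lookup-off : ∀ {k} (S : Mask k) x i → lookup S i ≡ false → lookup (offMask S x) i ≡ lookup x i
lookup-off S x i eq = trans (lookup-zipWith _ i S x) (cong (λ b → if b then 0 else lookup x i) eq)

lookup-off′ : ∀ {k} (S : Mask k) x i → lookup S i ≡ true → lookup (offMask S x) i ≡ 0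
lookup-off′ S x i eq = trans (lookup-zipWith _ i S x) (cong (λ b → if b then 0 else lookup x i) eq)

offA : ∀ {k} → Mask k → Aff (V k) (V k)
offA {k} S = mkAff (offMask S) (offMask S) (additive S)
  where
  additive : ∀ {k} (S : Mask k) x v → offMask S (x +v v) ≡ offMask S x +v offMask S v
  additive []          []      []      = refl
  additive (true ∷ S)  (_ ∷ x) (_ ∷ v) = cong (0 ∷_) (additive S x v)
  additive (false ∷ S) (_ ∷ x) (_ ∷ v) = cong (_ ∷_) (additive S x v)

off-agree : ∀ {k} (S : Mask k) x u → offMask S x ≡ offMask S u → Agree S x u
off-agree S x u eq i f = trans (sym (lookup-off S x i f)) (trans (cong (λ v → lookup v i) eq) (lookup-off S u i f))

agree-off : ∀ {k} (S : Mask k) x u → Agree S x u → offMask S x ≡ offMask S u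
agree-off S x u a = vec-ext λ i → helper i (lookup S i) refl
  where
  helper : ∀ i b → lookup S i ≡ b → lookup (offMask S x) i ≡ lookup (offMask S u) i
  helper i true  eq = trans (lookup-off′ S x i eq) (sym (lookup-off′ S u i eq))
  helper i false eq = trans (lookup-off S x i eq) (trans (a i eq) (sym (lookup-off S u i eq)))

widen : ∀ {k} → Mask k → (Fin k → Bool) → Mask k
widen S b = Vec.zipWith _∨_ S (Vec.tabulate b)

lookup-widen : ∀ {k} (S : Mask k) b i → lookup (widen S b) i ≡ lookup S i ∨ b i
lookup-widen S b i = trans (lookup-zipWith _∨_ i S _) (cong (lookup S i ∨_) (lookup∘tabulate b i))

⊆-widen : ∀ {k} (S : Mask k) b → S ⊆m widen S b
⊆-widen S b i eq = trans (lookup-widen S b i) (cong (_∨ b i) eq)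

widen-true : ∀ {k} (S : Mask k) b i → lookup S i ≡ false → lookup (widen S b) i ≡ true → b i ≡ true
widen-true S b i f t = trans (sym (trans (lookup-widen S b i) (cong (_∨ b i) f))) t

widen-false : ∀ {k} (S : Mask k) b i → lookup (widen S b) i ≡ false → b i ≡ false
widen-false S b i f = trans (sym (trans (lookup-widen S b i) (cong (_∨ b i) (false⇐ S (widen S b) (⊆-widen S b) i f)))) f

fixed : ∀ {k} → Mask k → ℕ
fixed []          = 0
fixed (true ∷ S)  = fixed S
fixed (false ∷ S) = suc (fixed S)

fixed-mono : ∀ {k} (S S′ : Mask k) → S ⊆m S′ → fixed S′ ≤ fixed S
fixed-mono []          []           sub = z≤n
fixed-mono (true ∷ S)  (true ∷ S′)  sub = fixed-mono S S′ (sub ∘ suc)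
fixed-mono (true ∷ S)  (false ∷ S′) sub = contradiction (sub zero refl) λ ()
fixed-mono (false ∷ S) (true ∷ S′)  sub = m≤n⇒m≤1+n (fixed-mono S S′ (sub ∘ suc))
fixed-mono (false ∷ S) (false ∷ S′) sub = s≤s (fixed-mono S S′ (sub ∘ suc))

fixed-strict : ∀ {k} (S S′ : Mask k) → S ⊆m S′ → ∀ i → lookup S i ≡ false → lookup S′ i ≡ true → fixed S′ < fixed S
fixed-strict (false ∷ S) (true ∷ S′)  sub zero    f t = s≤s (fixed-mono S S′ (sub ∘ suc))
fixed-strict (true ∷ S)  (true ∷ S′)  sub (suc i) f t = fixed-strict S S′ (sub ∘ suc) i f t
fixed-strict (true ∷ S)  (false ∷ S′) sub (suc i) f t = contradiction (sub zero refl) λ ()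
fixed-strict (false ∷ S) (true ∷ S′)  sub (suc i) f t = m≤n⇒m≤1+n (fixed-strict S S′ (sub ∘ suc) i f t)
fixed-strict (false ∷ S) (false ∷ S′) sub (suc i) f t = s≤s (fixed-strict S S′ (sub ∘ suc) i f t)

grows? : ∀ {k} (S S′ : Mask k) → S ⊆m S′ → (∃ λ i → lookup S i ≡ false × lookup S′ i ≡ true) ⊎ (S ≡ S′)
grows? S S′ sub with Finₚ.any? (λ i → (lookup S i Boolₚ.≟ false) ×-dec (lookup S′ i Boolₚ.≟ true))
... | yes p = inj₁ p
... | no ¬p = inj₂ (same S S′ λ i → agree i (lookup S i) (lookup S′ i) refl refl)
  where
  agree : ∀ i b b′ → lookup S i ≡ b → lookup S′ i ≡ b′ → b ≡ b′
  agree i true  true  _ _  = refl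
  agree i false false _ _  = refl
  agree i true  false e e′ = trans (sym (sub i e)) e′
  agree i false true  e e′ = contradiction (i , e , e′) ¬p
  same : ∀ {k} (S S′ : Mask k) → (∀ i → lookup S i ≡ lookup S′ i) → S ≡ S′
  same []      []       p = refl
  same (_ ∷ S) (_ ∷ S′) p = cong₂ _∷_ (p zero) (same S S′ (p ∘ suc))

-- Karp-Miller exploration

Low : ∀ {k} → VRel k → Fin k → ℕ → VRel k
Low A i K x y = A x y × lookup x i ≤ K × lookup y i ≤ K

Low-mono : ∀ {k} {A : VRel k} {i K K′} → K ≤ K′ → ∀ {x y} → Star (Low A i K) x y → Star (Low A i K′) x y
Low-mono le ε                = ε
Low-mono le ((a , p , q) ◅ r) = (a , ≤-trans p le , ≤-trans q le) ◅ Low-mono le r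

-- The bound on `x` is stated apart because an empty run has no step to carry it.
LowRun : ∀ {k} → VRel k → Mask k → ℕ → VRel k
LowRun A S K x y = ∃ λ i → lookup S i ≡ false × lookup x i ≤ K × Star (Low A i K) x y

module KarpMiller {k : ℕ} (A R : VRel k) (R-mono : Monotone R) (cover : RelCover k A R) where

  -- Rather than limits, this speaks of actual runs: for every `n` there is one whose end has all
  -- marked coordinates at least `n`, from a start whose own marked coordinates may depend on `n`.
  record Cap (S : Mask k) (u : Vec ℕ k) (S′ : Mask k) (u′ : Vec ℕ k) : Set where
    constructor mkCap
    field
      sub : S ⊆m S′
      run : ∀ n → ∃ λ x → ∃ λ y → Star R x y × Agree S x u × Agree S′ y u′ ×
                  (∀ i → lookup S′ i ≡ true → n ≤ lookup y i)

  open Cap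

  lift : Mask k → ℕ → Vec ℕ k
  lift S n = onMask S (n · 𝟙)

  lookup-lift : ∀ S n i → lookup S i ≡ true → lookup (lift S n) i ≡ n
  lookup-lift S n i t = trans (lookup-on S _ i t) (trans (lookup-· n 𝟙 i) (trans (cong (n *_) (lookup-𝟙 i)) (*-identityʳ n)))

  lookup-+0 : ∀ (t x : Vec ℕ k) i → lookup t i ≡ 0 → lookup (t +v x) i ≡ lookup x i
  lookup-+0 t x i e = trans (lookup-+v t x i) (cong (_+ lookup x i) e)

  Cap-refl : ∀ S u → Cap S u S u
  Cap-refl S u = mkCap (λ _ t → t) λ n → lift S n +v u , lift S n +v u , ε , agrees n , agrees n ,
    λ i t → ≤-trans (≤-reflexive (sym (lookup-lift S n i t))) (≤-trans (m≤m+n _ _) (≤-reflexive (sym (lookup-+v (lift S n) u i))))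
    where
    agrees : ∀ n → Agree S (lift S n +v u) u
    agrees n i f = lookup-+0 (lift S n) u i (lookup-on′ S _ i f)

  -- The first run is taken so large that its end exceeds the start of the second on `S′`. Off `S′`
  -- the two agree, so translating the second run by their difference changes no unmarked
  -- coordinate.
  Cap-trans : ∀ {S u S′ u′ S″ u″} → Cap S u S′ u′ → Cap S′ u′ S″ u″ → Cap S u S″ u″
  Cap-trans {S} {u} {S′} {u′} {S″} {u″} c d = mkCap (λ i → sub d i ∘ sub c i) λ n → glue n (run d n)
    where
    glue : ∀ n → (∃ λ x → ∃ λ y → Star R x y × Agree S′ x u′ × Agree S″ y u″ × (∀ i → lookup S″ i ≡ true → n ≤ lookup y i)) →
           ∃ λ x → ∃ λ y → Star R x y × Agree S x u × Agree S″ y u″ × (∀ i → lookup S″ i ≡ true → n ≤ lookup y i)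
    glue n (x₂ , y₂ , r₂ , ax₂ , ay₂ , big₂) with upper x₂
    ... | N , x₂≤N with run c N
    ... | x₁ , y₁ , r₁ , ax₁ , ay₁ , big₁ =
      x₁ , t +v y₂ , r₁ ◅◅ subst (λ z → Star R z (t +v y₂)) t+x₂ (Star-monotone R-mono t r₂) , ax₁ ,
      (λ i f → trans (lookup-+0 t y₂ i (t≡0 i (false⇐ S′ S″ (sub d) i f))) (ay₂ i f)) ,
      λ i tr → ≤-trans (big₂ i tr) (≤-trans (m≤n+m _ _) (≤-reflexive (sym (lookup-+v t y₂ i))))
      where
      t = y₁ ∸v x₂
      same : ∀ i → lookup S′ i ≡ false → lookup x₂ i ≡ lookup y₁ i
      same i f = trans (ax₂ i f) (sym (ay₁ i f))
      x₂≤y₁ : x₂ ≤v y₁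
      x₂≤y₁ i with lookup S′ i in eq
      ... | true  = ≤-trans (x₂≤N i) (big₁ i eq)
      ... | false = ≤-reflexive (same i eq)
      t+x₂ : t +v x₂ ≡ y₁
      t+x₂ = trans (CMon.comm (V k) t x₂) (x+[y∸x] x₂ y₁ x₂≤y₁)
      t≡0 : ∀ i → lookup S′ i ≡ false → lookup t i ≡ 0
      t≡0 i f = trans (lookup-zipWith _∸_ i y₁ x₂) (trans (cong (lookup y₁ i ∸_) (same i f)) (n∸n≡0 (lookup y₁ i)))

  Cap-shift : ∀ {S u S′ u′} t → Cap S u S′ u′ → Cap S (t +v u) S′ (t +v u′)
  Cap-shift t c = mkCap (sub c) λ n → case run c n of λ (x , y , r , ax , ay , big) →
    t +v x , t +v y , Star-monotone R-mono t r ,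
    (λ i f → trans (lookup-+v t x i) (trans (cong (lookup t i +_) (ax i f)) (sym (lookup-+v t _ i)))) ,
    (λ i f → trans (lookup-+v t y i) (trans (cong (lookup t i +_) (ay i f)) (sym (lookup-+v t _ i)))) ,
    λ i tr → ≤-trans (big i tr) (≤-trans (m≤n+m _ _) (≤-reflexive (sym (lookup-+v t y i))))

  Cap-iterate : ∀ {S a} δ → Cap S a S (δ +v a) → ∀ n → Cap S a S (n · δ +v a)
  Cap-iterate {S} {a} δ c zero    = subst (Cap S a S) (sym (CMon.idˡ (V k) a)) (Cap-refl S a)
  Cap-iterate {S} {a} δ c (suc n) = Cap-trans (Cap-iterate δ c n)
    (subst (Cap S (n · δ +v a) S) (trans (sym (CMon.assoc (V k) _ _ _)) (cong (_+v a) (CMon.comm (V k) _ δ))) (Cap-shift (n · δ) c))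

  strictly : Vec ℕ k → Vec ℕ k → Fin k → Bool
  strictly a u i = lookup a i <ᵇ lookup u i

  -- Iterating `n` times adds `n · (u ∸v a)`: entries that grew exceed every bound and become ω, the
  -- other unmarked ones stay as they are.
  accelerate : ∀ {S a u} → Cap S a S u → a ≤v u → Cap S a (widen S (strictly a u)) u
  accelerate {S} {a} {u} c le = mkCap (⊆-widen S _) λ n → pump n (run (Cap-iterate Δ c′ n) n)
    where
    Δ = u ∸v a
    Δ+a : Δ +v a ≡ u
    Δ+a = trans (CMon.comm (V k) Δ a) (x+[y∸x] a u le)
    c′ : Cap S a S (Δ +v a)
    c′ = subst (Cap S a S) (sym Δ+a) c
    S′ = widen S (strictly a u)
    lookup-Δ : ∀ i → lookup Δ i ≡ lookup u i ∸ lookup a i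
    lookup-Δ i = lookup-zipWith _∸_ i u a
    value : ∀ n i → lookup (n · Δ +v a) i ≡ n * lookup Δ i + lookup a i
    value n i = trans (lookup-+v (n · Δ) a i) (cong (_+ lookup a i) (lookup-· n Δ i))
    pump : ∀ n → (∃ λ x → ∃ λ y → Star R x y × Agree S x a × Agree S y (n · Δ +v a) × (∀ i → lookup S i ≡ true → n ≤ lookup y i)) →
           ∃ λ x → ∃ λ y → Star R x y × Agree S x a × Agree S′ y u × (∀ i → lookup S′ i ≡ true → n ≤ lookup y i)
    pump n (x , y , r , ax , ay , big) = x , y , r , ax , stays , grows
      where
      stays : Agree S′ y u
      stays i f = trans (ay i (false⇐ S S′ (⊆-widen S _) i f)) (trans (value n i)
        (trans (cong (λ z → n * z + lookup a i) (trans (lookup-Δ i) (m≤n⇒m∸n≡0 u≤a))) (trans (cong (_+ lookup a i) (*-zeroʳ n)) (≤-antisym (le i) u≤a))))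
        where
        u≤a : lookup u i ≤ lookup a i
        u≤a = ≮⇒≥ λ lt → subst Data.Bool.T (widen-false S (strictly a u) i f) (<⇒<ᵇ lt)
      grows : ∀ i → lookup S′ i ≡ true → n ≤ lookup y i
      grows i t with lookup S i in eq
      ... | true  = big i eq
      ... | false = ≤-trans (≤-trans (≤-reflexive (sym (*-identityʳ n))) (*-monoʳ-≤ n
                      (≤-trans (m<n⇒0<n∸m a<u) (≤-reflexive (sym (lookup-Δ i))))))
                      (≤-trans (m≤m+n _ _) (≤-reflexive (sym (trans (ay i eq) (value n i)))))
        where
        a<u : lookup a i < lookup u i
        a<u = <ᵇ⇒< _ _ (subst Data.Bool.T (sym (widen-true S (strictly a u) i eq t)) tt)

  record Target (S : Mask k) (u : Vec ℕ k) : Set where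
    constructor mkTarget
    field
      mask  : Mask k
      value : Vec ℕ k
      cap   : Cap S u mask value

  Hits : ∀ {S u} → Vec ℕ k → Target S u → Set
  Hits y τ = Agree (Target.mask τ) y (Target.value τ)

  -- Even a fixed source may have infinitely many targets, since steps have parameters. Each leaf of
  -- the cover yields one target: outputs that vary with its parameters are pumped and become ω, the
  -- others are constant.
  successors : ∀ S u → ∃ λ (τs : List (Target S u)) → ∀ x y → A x y → Agree S x u → Any (Hits y) τs
  successors S u with leaves (restrict cover (solve-V k) (offA S ∘A fstA {V k} {V k}) (offMask S u))
    (λ x y (r , eq) → r , off-agree S x u eq)
    where
    leaves : ∀ {A′ B′} → RelCover k A′ B′ → (∀ x y → B′ x y → R x y × Agree S x u) →
             ∃ λ (τs : List (Target S u)) → ∀ x y → A′ x y → Any (Hits y) τs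
    leaves (none p) _ = [] , λ x y a → contradiction a (p (x , y))
    leaves (both A₁ A₂ B₁ B₂ c₁ c₂ p q₁ q₂) h
      with leaves c₁ (λ x y b → h x y (q₁ (x , y) b)) | leaves c₂ (λ x y b → h x y (q₂ (x , y) b))
    ... | τs₁ , f₁ | τs₂ , f₂ = τs₁ List.++ τs₂ , λ x y a → case p (x , y) a of λ
      { (inj₁ a₁) → Anyₚ.++⁺ˡ (f₁ x y a₁) ; (inj₂ a₂) → Anyₚ.++⁺ʳ τs₁ (f₂ x y a₂) }
    leaves {A′} {B′} (image {m} A₁ B₁ (node _ pumpB _) f p q) h = τ ∷ [] , hits
      where
      out : Aff (V m) (V k)
      out = sndA {V k} {V k} ∘A f
      row : Vec ℕ k
      row = lin out 𝟙
      S′ = widen S (λ i → 0 <ᵇ lookup row i)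
      u′ = fun out 𝟘
      big : ∀ n → Vec ℕ m
      big n = 𝟘 +v (suc n * suc (proj₁ (pumpB 𝟘 𝟘))) · (𝟙 +v 𝟘)
      out≥ : ∀ n i → 0 < lookup row i → n ≤ lookup (fun out (big n)) i
      out≥ n i pos = begin
        n                                     ≤⟨ n≤1+n n ⟩
        suc n                                 ≤⟨ m≤m*n (suc n) (suc (proj₁ (pumpB 𝟘 𝟘))) ⟩
        K                                     ≡⟨ *-identityʳ K ⟨
        K * 1                                 ≤⟨ *-monoʳ-≤ K pos ⟩
        K * lookup row i                      ≡⟨ lookup-· K row i ⟨
        lookup (K · row) i                    ≡⟨ cong (λ v → lookup (K · lin out v) i) (CMon.idʳ (V m) 𝟙) ⟨
        lookup (K · lin out (𝟙 +v 𝟘)) i       ≡⟨ cong (λ v → lookup v i) (lin-mul out K _) ⟨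
        lookup (lin out (K · (𝟙 +v 𝟘))) i     ≤⟨ m≤n+m _ _ ⟩
        lookup (fun out 𝟘) i + lookup (lin out (K · (𝟙 +v 𝟘))) i ≡⟨ lookup-+v (fun out 𝟘) _ i ⟨
        lookup (fun out 𝟘 +v lin out (K · (𝟙 +v 𝟘))) i ≡⟨ cong (λ v → lookup v i) (aff out 𝟘 _) ⟨
        lookup (fun out (big n)) i            ∎
        where
        open ≤-Reasoning
        K = suc n * suc (proj₁ (pumpB 𝟘 𝟘))
      stays : ∀ w → Agree S′ (fun out w) u′
      stays w i f = lin-zero⇒const (lookupA i ∘A out) (n≤0⇒n≡0 (≮⇒≥ λ lt →
        subst Data.Bool.T (widen-false S (λ i → 0 <ᵇ lookup row i) i f) (<⇒<ᵇ lt))) w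
      τ : Target S u
      τ = mkTarget S′ u′ (mkCap (⊆-widen S _) λ n → step n (h _ _ (q (big n) (proj₂ (pumpB 𝟘 𝟘) n))))
        where
        step : ∀ n → R (proj₁ (fun f (big n))) (fun out (big n)) × Agree S (proj₁ (fun f (big n))) u →
               ∃ λ x → ∃ λ y → Star R x y × Agree S x u × Agree S′ y u′ × (∀ i → lookup S′ i ≡ true → n ≤ lookup y i)
        -- The pumped step need not be large on `S`; translating it by `lift S n` makes it so.
        step n (r , ag) = t +v x , t +v y , R-mono t r ◅ ε ,
          (λ i f → trans (lookup-+0 t x i (lookup-on′ S _ i f)) (ag i f)) ,
          (λ i f → trans (lookup-+0 t y i (lookup-on′ S _ i (false⇐ S S′ (⊆-widen S _) i f))) (stays (big n) i f)) ,
          large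
          where
          x = proj₁ (fun f (big n))
          y = fun out (big n)
          t = lift S n
          large : ∀ i → lookup S′ i ≡ true → n ≤ lookup (t +v y) i
          large i tr with lookup S i in eq
          ... | true  = ≤-trans (≤-reflexive (sym (lookup-lift S n i eq))) (≤-trans (m≤m+n _ _) (≤-reflexive (sym (lookup-+v t y i))))
          ... | false = ≤-trans (out≥ n i (<ᵇ⇒< _ _ (subst Data.Bool.T (sym (widen-true S (λ i → 0 <ᵇ lookup row i) i eq tr)) tt)))
                          (≤-trans (m≤n+m _ _) (≤-reflexive (sym (lookup-+v t y i))))
      hits : ∀ x y → A′ x y → Any (Hits y) (τ ∷ [])
      hits x y a with p (x , y) a
      ... | w , _ , eq = here (subst (λ v → Agree S′ v u′) (cong proj₂ eq) (stays w))
  ... | τs , f = τs , λ x y a ag → f x y (a , agree-off S x u ag)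

  all-true : Mask k
  all-true = replicate k true

  CapAll : Mask k → Vec ℕ k → Set
  CapAll S u = Cap S u all-true 𝟘

  Bounded : Mask k → Vec ℕ k → ℕ → Set
  Bounded S u K = ∀ x y → Agree S x u → Star A x y → LowRun A S K x y

  LowRun-mono : ∀ {S K K′ x y} → K ≤ K′ → LowRun A S K x y → LowRun A S K′ x y
  LowRun-mono le (i , f , p , r) = i , f , ≤-trans p le , Low-mono le r

  LowRun-⊆ : ∀ S S′ {K x y} → S ⊆m S′ → LowRun A S′ K x y → LowRun A S K x y
  LowRun-⊆ S S′ sub (i , f , r) = i , false⇐ S S′ sub i f , r

  module Explore (S : Mask k) (u₀ : Vec ℕ k) (i₀ : Fin k) (i₀-fixed : lookup S i₀ ≡ false)
                 (IH : ∀ S′ u → S ⊆m S′ → (∃ λ i → lookup S i ≡ false × lookup S′ i ≡ true) →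
                       CapAll S′ u ⊎ ∃ (Bounded S′ u)) where

    LowFrom : ℕ → Vec ℕ k → Set
    LowFrom K y = ∀ z → Star A y z → LowRun A S K y z

    -- The invariant of a depth-first search: `h` is the branch being explored, `L` holds the
    -- finished nodes, and `LowFrom` stands for what larger masks have settled. Successors may point
    -- back into `h`; a node moves from `h` to `L` when its exploration ends.
    Known : List (Vec ℕ k) → List (Vec ℕ k) → ℕ → Vec ℕ k → Set
    Known h L K y = (∃ λ v → (v ∈ h ⊎ v ∈ L) × Agree S y v) ⊎ LowFrom K y

    Closed : List (Vec ℕ k) → List (Vec ℕ k) → ℕ → Set
    Closed h L K = ∀ v → v ∈ L → (∀ x y → Agree S x v → A x y → Known h L K y) × (∀ i → lookup S i ≡ false → lookup v i ≤ K)

    Known-mono : ∀ {h L L′ K K′ y} → (∀ {v} → v ∈ L → v ∈ L′) → K ≤ K′ → Known h L K y → Known h L′ K′ y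
    Known-mono inc le (inj₁ (v , inj₁ v∈ , a)) = inj₁ (v , inj₁ v∈ , a)
    Known-mono inc le (inj₁ (v , inj₂ v∈ , a)) = inj₁ (v , inj₂ (inc v∈) , a)
    Known-mono inc le (inj₂ low)               = inj₂ λ z r → LowRun-mono {S} le (low z r)

    Known-push : ∀ {h L K u y} → Known (u ∷ h) L K y → Known h (u ∷ L) K y
    Known-push (inj₁ (v , inj₁ (here refl) , a)) = inj₁ (v , inj₂ (here refl) , a)
    Known-push (inj₁ (v , inj₁ (there v∈) , a))  = inj₁ (v , inj₁ v∈ , a)
    Known-push (inj₁ (v , inj₂ v∈ , a))          = inj₁ (v , inj₂ (there v∈) , a)
    Known-push (inj₂ low)                        = inj₂ low

    jump : ∀ h {S′ u} → Cap S u₀ S′ u → (∃ λ i → lookup S i ≡ false × lookup S′ i ≡ true) → S ⊆m S′ →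
           CapAll S u₀ ⊎ (∃ λ L → ∃ λ K → Closed h L K × (∀ y → Agree S′ y u → Known h L K y))
    jump h {S′} {u} c new sub with IH S′ u sub new
    ... | inj₁ all      = inj₁ (Cap-trans c all)
    ... | inj₂ (K , bd) = inj₂ ([] , K , (λ _ ()) , λ y ag → inj₂ λ z r → LowRun-⊆ S S′ sub (bd y z ag r))

    -- If no ancestor lies below `u`, the history with `u` added is still bad and the bar gets
    -- smaller. Otherwise either `u` agrees with the ancestor off the mask, which closes a loop, or
    -- acceleration marks a new coordinate and the hypothesis for larger masks takes over.
    build : ∀ h → Bar _≤v_ h → ¬ Good _≤v_ h → (∀ {a} → a ∈ h → Cap S u₀ S a) →
            ∀ u → Cap S u₀ S u → (∀ {a} → a ∈ h → Cap S a S u) →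
            CapAll S u₀ ⊎ (∃ λ L → ∃ λ K → Closed h L K × (∀ y → Agree S y u → Known h L K y))
    build h (now g)   bad _  u _  _  = contradiction g bad
    build h (later f) bad r₀ u ru ra with Any.any? (λ a → Finₚ.all? (λ i → lookup a i ≤? lookup u i)) h
    ... | yes dominated with find dominated
    ... | a , a∈ , a≤u with grows? S (widen S (strictly a u)) (⊆-widen S _)
    ... | inj₁ new = Sum.map₂ (λ (L , K , cl , kn) → L , K , cl , λ y ag → kn y (Agree-⊆ S (widen S (strictly a u)) {x = y} {u = u} (⊆-widen S (strictly a u)) ag))
                       (jump h (Cap-trans (r₀ a∈) (accelerate (ra a∈) a≤u)) new (⊆-widen S _))
    ... | inj₂ S≡  = inj₂ ([] , 0 , (λ _ ()) , λ y ag → inj₁ (a , inj₁ a∈ , λ i f → trans (ag i f) (≤-antisym (u≤a i f) (a≤u i))))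
      where
      u≤a : ∀ i → lookup S i ≡ false → lookup u i ≤ lookup a i
      u≤a i f = ≮⇒≥ λ lt → subst Data.Bool.T
        (widen-false S (strictly a u) i (trans (cong (λ T → lookup T i) (sym S≡)) f)) (<⇒<ᵇ lt)
    build h (later f) bad r₀ u ru ra | no fresh = Sum.map₂ close (each (proj₁ (successors S u)))
      where
      bad′ : ¬ Good _≤v_ (u ∷ h)
      bad′ (inj₁ (a , a∈ , le)) = fresh (Any.map (λ { refl → le }) a∈)
      bad′ (inj₂ g)             = bad g
      r₀′ : ∀ {a} → a ∈ u ∷ h → Cap S u₀ S a
      r₀′ (here refl) = ru
      r₀′ (there a∈)  = r₀ a∈
      Covered : List (Vec ℕ k) → ℕ → Target S u → Set
      Covered L K τ = ∀ y → Hits y τ → Known (u ∷ h) L K y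
      one : (τ : Target S u) → CapAll S u₀ ⊎ (∃ λ L → ∃ λ K → Closed (u ∷ h) L K × Covered L K τ)
      one (mkTarget S′ u′ c) with grows? S S′ (sub c)
      ... | inj₁ new  = jump (u ∷ h) (Cap-trans ru c) new (sub c)
      ... | inj₂ refl = build (u ∷ h) (f u) bad′ r₀′ u′ (Cap-trans ru c)
                          λ { (here refl) → c ; (there a∈) → Cap-trans (ra a∈) c }
      each : ∀ τs → CapAll S u₀ ⊎ (∃ λ L → ∃ λ K → Closed (u ∷ h) L K × All (Covered L K) τs)
      each []       = inj₂ ([] , 0 , (λ _ ()) , [])
      each (τ ∷ τs) with one τ | each τs
      ... | inj₁ c | _      = inj₁ c
      ... | inj₂ _ | inj₁ c = inj₁ c
      ... | inj₂ (L , K , cl , kn) | inj₂ (L′ , K′ , cl′ , kn′) = inj₂ (L List.++ L′ , K ⊔ K′ , closed ,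
            (λ y hit → left (kn y hit)) ∷ All.map (λ p y hit → right (p y hit)) kn′)
        where
        left : ∀ {y} → Known (u ∷ h) L K y → Known (u ∷ h) (L List.++ L′) (K ⊔ K′) y
        left = Known-mono ∈-++⁺ˡ (m≤m⊔n K K′)
        right : ∀ {y} → Known (u ∷ h) L′ K′ y → Known (u ∷ h) (L List.++ L′) (K ⊔ K′) y
        right = Known-mono (∈-++⁺ʳ L) (m≤n⊔m K K′)
        closed : Closed (u ∷ h) (L List.++ L′) (K ⊔ K′)
        closed v v∈ with ∈-++⁻ L v∈
        ... | inj₁ p = (λ x y ag a → left (proj₁ (cl v p) x y ag a)) , λ i fi → ≤-trans (proj₂ (cl v p) i fi) (m≤m⊔n K K′)
        ... | inj₂ p = (λ x y ag a → right (proj₁ (cl′ v p) x y ag a)) , λ i fi → ≤-trans (proj₂ (cl′ v p) i fi) (m≤n⊔m K K′)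
      close : (∃ λ L → ∃ λ K → Closed (u ∷ h) L K × All (Covered L K) (proj₁ (successors S u))) →
              ∃ λ L → ∃ λ K → Closed h L K × (∀ y → Agree S y u → Known h L K y)
      close (L , K , cl , kn) = u ∷ L , K ⊔ K₀ , closed , λ y ag → inj₁ (u , inj₂ (here refl) , ag)
        where
        K₀ = proj₁ (upper u)
        up : ∀ {y} → Known (u ∷ h) L K y → Known h (u ∷ L) (K ⊔ K₀) y
        up = Known-mono id (m≤m⊔n K K₀) ∘ Known-push
        closed : Closed h (u ∷ L) (K ⊔ K₀)
        closed v (here refl) = (λ x y ag a → case find (proj₂ (successors S u) x y a ag) of λ
            (τ , τ∈ , hit) → up (All.lookup kn τ∈ y hit)) ,
          λ i _ → ≤-trans (proj₂ (upper u) i) (m≤n⊔m K K₀)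
        closed v (there v∈) = (λ x y ag a → up (proj₁ (cl v v∈) x y ag a)) , λ i fi → ≤-trans (proj₂ (cl v v∈) i fi) (m≤m⊔n K K₀)

    result : CapAll S u₀ ⊎ ∃ (Bounded S u₀)
    result with build [] (AF⇒Bar (dickson k)) (λ ()) (λ ()) u₀ (Cap-refl S u₀) (λ ())
    ... | inj₁ c = inj₁ c
    ... | inj₂ (L , K , cl , kn) = inj₂ (K , λ x y ag r → from (kn x ag) r)
      where
      head-low : ∀ {v} x → v ∈ L → Agree S x v → ∀ i → lookup S i ≡ false → lookup x i ≤ K
      head-low {v} x v∈ ag i f = ≤-trans (≤-reflexive (ag i f)) (proj₂ (cl v v∈) i f)
      -- A run that stays inside `L` is low at every unmarked coordinate, say at `i₀`. If it leaves
      -- `L`, the remaining run dictates the low coordinate; this is unmarked in `S`, so the earlier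
      -- vectors are low there too.
      from : ∀ {x y} → Known [] L K x → Star A x y → LowRun A S K x y
      from (inj₂ low) r = low _ r
      from {x} (inj₁ (v , inj₂ v∈ , ag)) ε = i₀ , i₀-fixed , head-low x v∈ ag i₀ i₀-fixed , ε
      from {x} (inj₁ (v , inj₂ v∈ , ag)) (a ◅ r) with from (proj₁ (cl v v∈) _ _ ag a) r
      ... | i , f , le , r′ = i , f , head-low x v∈ ag i f , (a , head-low x v∈ ag i f , le) ◅ r′

  -- Induction on the number of unmarked coordinates. The bound concerns runs of `A` and the
  -- capability runs of `R`, the two sides of the cover.
  dichotomy : ∀ S u → CapAll S u ⊎ ∃ (Bounded S u)
  dichotomy S = go S (<-wellFounded _)
    where
    go : ∀ S → Acc _<_ (fixed S) → ∀ u → CapAll S u ⊎ ∃ (Bounded S u)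
    go S (acc rs) u with grows? S all-true (λ i _ → lookup-replicate i true)
    ... | inj₁ (i , f , _) = Explore.result S u i f
            λ { S′ u′ sub (j , f′ , t) → go S′ (rs (fixed-strict S S′ sub j f′ t)) u′ }
    ... | inj₂ refl = inj₁ (mkCap (λ _ t → t) λ n → case run (Cap-refl S u) n of λ (x , y , r , ax , _ , big) →
            x , y , r , ax , (λ i f → contradiction (trans (sym (lookup-replicate i true)) f) λ ()) , big)

-- Edges and the well-founded order on lists of edges

record Edge (k : ℕ) : Set₁ where
  constructor mkEdge
  field
    {dom} : ℕ
    {inn} : Vec ℕ dom → Set
    {out} : Vec ℕ dom → Set
    tree  : Tree dom inn out
    ends  : Aff (V dom) (V k ⊗ V k)

  src tgt : Aff (V dom) (V k)
  src = fstA {V k} {V k} ∘A ends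
  tgt = sndA {V k} {V k} ∘A ends

open Edge

edgesOf : ∀ {k S A B} → Cover S A B → Aff S (V k ⊗ V k) → List (Edge k)
edgesOf (none _)                     f = []
edgesOf (image _ _ T g _ _)          f = mkEdge T (f ∘A g) ∷ []
edgesOf (both _ _ _ _ c₁ c₂ _ _ _)   f = edgesOf c₁ f List.++ edgesOf c₂ f

infix 4 _⊏_
-- This takes the place of a numerical rank. An edge disappears, or gives way to the finitely many
-- leaves of one of its sections; those are parts of its tree, so accessibility follows by
-- structural recursion.
data _⊏_ {k} : List (Edge k) → List (Edge k) → Set₁ where
  drop   : ∀ {e L} → L ⊏ e ∷ L
  refine : ∀ {m A B b p c f L} (i : Fin m) v →
           edgesOf (c i v) (f ∘A insA i v) List.++ L ⊏ mkEdge {dom = m} {A} {B} (node b p c) f ∷ L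
  there  : ∀ {e L L′} → L′ ⊏ L → e ∷ L′ ⊏ e ∷ L

⊏-++ : ∀ {k} (L₁ {L₂ L} : List (Edge k)) → L ⊏ L₁ List.++ L₂ →
       (∃ λ L₁′ → L₁′ ⊏ L₁ × L ≡ L₁′ List.++ L₂) ⊎ (∃ λ L₂′ → L₂′ ⊏ L₂ × L ≡ L₁ List.++ L₂′)
⊏-++ []       r            = inj₂ (_ , r , refl)
⊏-++ (e ∷ L₁) drop         = inj₁ (L₁ , drop , refl)
⊏-++ (e ∷ L₁) (refine {c = c} {f = f} i v) = inj₁ (_ , refine i v , sym (++-assoc (edgesOf (c i v) (f ∘A insA i v)) L₁ _))
  where open import Data.List.Properties using (++-assoc)
⊏-++ (e ∷ L₁) (there r) with ⊏-++ L₁ r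
... | inj₁ (L₁′ , r′ , refl) = inj₁ (e ∷ L₁′ , there r′ , refl)
... | inj₂ (L₂′ , r′ , refl) = inj₂ (L₂′ , r′ , refl)

Acc-++ : ∀ {k} {L₁ L₂ : List (Edge k)} → Acc _⊏_ L₁ → Acc _⊏_ L₂ → Acc _⊏_ (L₁ List.++ L₂)
Acc-++ {L₁ = L₁} (acc r₁) (acc r₂) = acc λ r → case ⊏-++ L₁ r of λ
  { (inj₁ (_ , r′ , refl)) → Acc-++ (r₁ r′) (acc r₂) ; (inj₂ (_ , r′ , refl)) → Acc-++ (acc r₁) (r₂ r′) }

Acc-[] : ∀ {k} → Acc (_⊏_ {k}) []
Acc-[] = acc λ ()

Acc-edge : ∀ {k m A B} (T : Tree m A B) (f : Aff (V m) (V k ⊗ V k)) → Acc _⊏_ (mkEdge T f ∷ [])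
Acc-edges : ∀ {k S A B} (c : Cover S A B) (f : Aff S (V k ⊗ V k)) → Acc _⊏_ (edgesOf c f)
Acc-edge (node b p c) f = acc λ
  { drop → Acc-[] ; (refine i v) → Acc-++ (Acc-edges (c i v) (f ∘A insA i v)) Acc-[] ; (there ()) }
Acc-edges (none _)                   f = Acc-[]
Acc-edges (image _ _ T g _ _)        f = Acc-edge T (f ∘A g)
Acc-edges (both _ _ _ _ c₁ c₂ _ _ _) f = Acc-++ (Acc-edges c₁ f) (Acc-edges c₂ f)

⊏-wellFounded : ∀ {k} (L : List (Edge k)) → Acc _⊏_ L
⊏-wellFounded []       = Acc-[]
⊏-wellFounded (e ∷ L) = Acc-++ (Acc-edge (tree e) (ends e)) (⊏-wellFounded L)

-- Characteristic vectors: for each edge, the number of its uses and the sum of the parameters used.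
Ch : ∀ {k} → List (Edge k) → CMon
Ch []      = Unit
Ch (e ∷ L) = (Nat ⊗ V (dom e)) ⊗ Ch L

param-Ch : ∀ {k} (L : List (Edge k)) → Param (Ch L)
param-Ch []      = param-Unit
param-Ch (e ∷ L) = param-⊗ (param-⊗ param-Nat (param-V _)) (param-Ch L)

EdgePred : ℕ → Set₁
EdgePred k = (e : Edge k) → Vec ℕ (dom e) → Set

Fire : ∀ {k} → EdgePred k → (L : List (Edge k)) → ∣ Ch L ∣ → VRel k
Fire P []      χ x y = ⊥
Fire P (e ∷ L) χ x y = (∃ λ w → P e w × fun (ends e) w ≡ (x , y) × χ ≡ ((1 , w) , CMon.0# (Ch L)))
                     ⊎ (∃ λ χ′ → Fire P L χ′ x y × χ ≡ ((0 , 𝟘) , χ′))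

EdgeStep : ∀ {k} → EdgePred k → List (Edge k) → VRel k
EdgeStep P L x y = ∃ λ χ → Fire P L χ x y

step-++ˡ : ∀ {k} {P : EdgePred k} L {L′ x y} → EdgeStep P L x y → EdgeStep P (L List.++ L′) x y
step-++ˡ (e ∷ L) (_ , inj₁ (w , p , eq , _)) = _ , inj₁ (w , p , eq , refl)
step-++ˡ (e ∷ L) (_ , inj₂ (χ , f , _))      = _ , inj₂ (_ , proj₂ (step-++ˡ L (χ , f)) , refl)

step-++ʳ : ∀ {k} {P : EdgePred k} L {L′ x y} → EdgeStep P L′ x y → EdgeStep P (L List.++ L′) x y
step-++ʳ []      s = s
step-++ʳ (e ∷ L) s = _ , inj₂ (_ , proj₂ (step-++ʳ L s) , refl)

step-++⁻ : ∀ {k} {P : EdgePred k} L {L′ x y} → EdgeStep P (L List.++ L′) x y → EdgeStep P L x y ⊎ EdgeStep P L′ x y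
step-++⁻ []      s = inj₂ s
step-++⁻ (e ∷ L) (_ , inj₁ (w , p , eq , _)) = inj₁ (_ , inj₁ (w , p , eq , refl))
step-++⁻ {P = P} (e ∷ L) (_ , inj₂ (χ , f , _)) with step-++⁻ {P = P} L (χ , f)
... | inj₁ (χ′ , f′) = inj₁ (_ , inj₂ (χ′ , f′ , refl))
... | inj₂ s         = inj₂ s

edges-complete : ∀ {k S A B} (c : Cover S A B) (f : Aff S (V k ⊗ V k)) {s x y} → A s → fun f s ≡ (x , y) →
                 EdgeStep inn (edgesOf c f) x y
edges-complete (none p) f {s} a _ = contradiction a (p s)
edges-complete (image _ _ T g p _) f {s} a eq with p s a
... | w , a′ , refl = _ , inj₁ (w , a′ , eq , refl)
edges-complete (both _ _ _ _ c₁ c₂ p _ _) f {s} a eq with p s a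
... | inj₁ a₁ = step-++ˡ (edgesOf c₁ f) (edges-complete c₁ f a₁ eq)
... | inj₂ a₂ = step-++ʳ (edgesOf c₁ f) (edges-complete c₂ f a₂ eq)

edges-sound : ∀ {k S A B} (c : Cover S A B) (f : Aff S (V k ⊗ V k)) {x y} → EdgeStep out (edgesOf c f) x y →
              ∃ λ s → B s × fun f s ≡ (x , y)
edges-sound (image _ _ T g _ q) f (_ , inj₁ (w , b , eq , _)) = fun g w , q w b , eq
edges-sound (both _ _ _ _ c₁ c₂ _ q₁ q₂) f st with step-++⁻ {P = out} (edgesOf c₁ f) st
... | inj₁ st₁ = case edges-sound c₁ f st₁ of λ (s , b , eq) → s , q₁ s b , eq
... | inj₂ st₂ = case edges-sound c₂ f st₂ of λ (s , b , eq) → s , q₂ s b , eq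

Pos : ∀ {k} (L : List (Edge k)) → ∣ Ch L ∣ → Set
Pos []      χ             = ⊤
Pos (e ∷ L) ((n , w) , χ) = 1 ≤ n × (𝟙 ≤v w) × Pos L χ

-- Along a ray of direction η, a zero entry of η bounds the number of steps outside the smaller list.
record Reduction {k} (L : List (Edge k)) (η : ∣ Ch L ∣) : Set₁ where
  field
    weight    : Aff (Ch L) Nat
    weight-ε  : fun weight (CMon.0# (Ch L)) ≡ 0
    weight-η  : lin weight η ≡ 0
    smaller   : List (Edge k)
    smaller-⊏ : smaller ⊏ L
    stay      : ∀ χ x y → Fire inn L χ x y → fun weight χ ≡ 0 → EdgeStep inn smaller x y
    sound     : ∀ x y → EdgeStep out smaller x y → EdgeStep out L x y

-- If the count of an edge does not grow along `η`, it serves as the weight, and steps of weight 0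
-- avoid that edge. If the sum of one of its parameters does not grow, that parameter is 0 in every
-- step of weight 0, which is the section at 0.
positive-or-reducible : ∀ {k} (L : List (Edge k)) η → Pos L η ⊎ Reduction L η
positive-or-reducible [] η = inj₁ tt
positive-or-reducible (e ∷ L) ((zero , w) , η) = inj₂ record
  { weight = mkAff (proj₁ ∘ proj₁) (proj₁ ∘ proj₁) (λ _ _ → refl) ; weight-ε = refl ; weight-η = refl
  ; smaller = L ; smaller-⊏ = drop
  ; stay = λ { χ x y (inj₁ (_ , _ , _ , refl)) () ; χ x y (inj₂ (χ′ , f , refl)) _ → χ′ , f }
  ; sound = λ { x y (χ , f) → _ , inj₂ (χ , f , refl) } }
positive-or-reducible {k} (mkEdge {m} {A} {B} T@(node b p c) f ∷ L) ((suc n , w) , η) with zero-row? w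
... | inj₁ (i , z) = inj₂ record
  { weight = mkAff (λ χ → lookup (proj₂ (proj₁ χ)) i) (λ χ → lookup (proj₂ (proj₁ χ)) i)
                   (λ χ χ′ → lookup-+v (proj₂ (proj₁ χ)) _ i)
  ; weight-ε = lookup-𝟘 i ; weight-η = z
  ; smaller = E List.++ L ; smaller-⊏ = refine i 0
  ; stay = λ
      { χ x y (inj₁ (w′ , a , eq , refl)) z′ → step-++ˡ E (edges-complete (c i 0) (f ∘A insA i 0)
          (subst A (sym (ins-rem i w′ z′)) a)
          (trans (cong (fun f) (trans (fun-insA i 0 _) (ins-rem i w′ z′))) eq))
      ; χ x y (inj₂ (χ′ , s , refl)) _ → step-++ʳ E (χ′ , s) }
  ; sound = λ x y st → case step-++⁻ {P = out} E st of λ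
      { (inj₁ st₁) → case edges-sound (c i 0) (f ∘A insA i 0) st₁ of λ (s , b′ , eq) →
          _ , inj₁ (ins i 0 s , b′ , trans (cong (fun f) (sym (fun-insA i 0 s))) eq , refl)
      ; (inj₂ (χ , s)) → _ , inj₂ (χ , s , refl) } }
  where E = edgesOf (c i 0) (f ∘A insA i 0)
... | inj₂ pos with positive-or-reducible L η
... | inj₁ pos′ = inj₁ (s≤s z≤n , pos , pos′)
... | inj₂ r = inj₂ record
  { weight = Reduction.weight r ∘A sndA {Nat ⊗ V m} {Ch L}
  ; weight-ε = Reduction.weight-ε r ; weight-η = Reduction.weight-η r
  ; smaller = mkEdge T f ∷ Reduction.smaller r ; smaller-⊏ = there (Reduction.smaller-⊏ r)
  ; stay = λ
      { χ x y (inj₁ (w′ , a , eq , _)) _ → _ , inj₁ (w′ , a , eq , refl)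
      ; χ x y (inj₂ (χ′ , s , refl)) z → _ , inj₂ (_ , proj₂ (Reduction.stay r χ′ x y s z) , refl) }
  ; sound = λ
      { x y (_ , inj₁ (w′ , b′ , eq , _)) → _ , inj₁ (w′ , b′ , eq , refl)
      ; x y (_ , inj₂ (χ′ , s , _)) → _ , inj₂ (_ , proj₂ (Reduction.sound r x y (χ′ , s)) , refl) } }

-- The state equation, realisable vectors and the pumping of runs

module _ {k : ℕ} where
  private
    module VM = CMon (V k)
    module S = CMSolver VM.bundle

  -- The sum of the sources, or of the targets, over all uses. The constant part of an end is
  -- multiplied by the count, which makes an affine quantity linear in the characteristic vector.
  total : (∀ e → Aff (V (dom e)) (V k)) → (L : List (Edge k)) → ∣ Ch L ∣ → Vec ℕ k
  total end []      χ             = 𝟘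
  total end (e ∷ L) ((n , w) , χ) = (n · fun (end e) 𝟘 +v lin (end e) w) +v total end L χ

  total-⊕ : ∀ end L χ χ′ → total end L (CMon._⊕_ (Ch L) χ χ′) ≡ total end L χ +v total end L χ′
  total-⊕ end []      χ             χ′               = sym (VM.idˡ 𝟘)
  total-⊕ end (e ∷ L) ((n , w) , χ) ((n′ , w′) , χ′) = begin
    ((n + n′) · b +v lin (end e) (w +v w′)) +v total end L (CMon._⊕_ (Ch L) χ χ′)
      ≡⟨ cong₂ _+v_ (cong₂ _+v_ (VM.mul-+ n n′ b) (lin-⊕ (end e) w w′)) (total-⊕ end L χ χ′) ⟩
    ((n · b +v n′ · b) +v (lin (end e) w +v lin (end e) w′)) +v (total end L χ +v total end L χ′)
      ≡⟨ S.solve 6 (λ a a′ b b′ c c′ → ((a S.⊕ a′) S.⊕ (b S.⊕ b′)) S.⊕ (c S.⊕ c′) S.⊜ ((a S.⊕ b) S.⊕ c) S.⊕ ((a′ S.⊕ b′) S.⊕ c′)) refl _ _ _ _ _ _ ⟩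
    ((n · b +v lin (end e) w) +v total end L χ) +v ((n′ · b +v lin (end e) w′) +v total end L χ′) ∎
    where
    open ≡-Reasoning
    b = fun (end e) 𝟘

  flow : (∀ e → Aff (V (dom e)) (V k)) → (L : List (Edge k)) → Aff (Ch L) (V k)
  flow end L = mkAff (total end L) (total end L) (total-⊕ end L)

  In Out : (L : List (Edge k)) → ∣ Ch L ∣ → Vec ℕ k
  In  L = fun (flow src L)
  Out L = fun (flow tgt L)

  flow-⊕ : ∀ end L χ χ′ → fun (flow end L) (CMon._⊕_ (Ch L) χ χ′) ≡ fun (flow end L) χ +v fun (flow end L) χ′
  flow-⊕ end L = aff (flow end L)

  flow-ε : ∀ end L → fun (flow end L) (CMon.0# (Ch L)) ≡ 𝟘
  flow-ε end L = lin-0 (flow end L)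

  fire-flow : ∀ (end : ∀ e → Aff (V (dom e)) (V k)) (π : Vec ℕ k × Vec ℕ k → Vec ℕ k) →
              (∀ e w → fun (end e) w ≡ π (fun (ends e) w)) →
              ∀ {P : EdgePred k} L {χ x y} → Fire P L χ x y → fun (flow end L) χ ≡ π (x , y)
  fire-flow end π h (e ∷ L) (inj₁ (w , _ , eq , refl)) = begin
    ((b +v 𝟘) +v lin (end e) w) +v fun (flow end L) (CMon.0# (Ch L))  ≡⟨ cong (((b +v 𝟘) +v lin (end e) w) +v_) (flow-ε end L) ⟩
    ((b +v 𝟘) +v lin (end e) w) +v 𝟘                                ≡⟨ VM.idʳ _ ⟩
    (b +v 𝟘) +v lin (end e) w                                       ≡⟨ cong (_+v lin (end e) w) (VM.idʳ b) ⟩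
    b +v lin (end e) w                                              ≡⟨ fun-0 (end e) w ⟨
    fun (end e) w                                                   ≡⟨ h e w ⟩
    π (fun (ends e) w)                                              ≡⟨ cong π eq ⟩
    π _                                                             ∎
    where
    open ≡-Reasoning
    b = fun (end e) 𝟘
  fire-flow end π h (e ∷ L) (inj₂ (χ , f , refl)) = trans
    (cong₂ _+v_ (trans (cong (𝟘 +v_) (lin-0 (end e))) (VM.idˡ 𝟘)) (fire-flow end π h L f)) (VM.idˡ _)

  fire-In : ∀ {P : EdgePred k} L {χ x y} → Fire P L χ x y → In L χ ≡ x
  fire-In = fire-flow src proj₁ λ _ _ → refl

  fire-Out : ∀ {P : EdgePred k} L {χ x y} → Fire P L χ x y → Out L χ ≡ y
  fire-Out = fire-flow tgt proj₂ λ _ _ → refl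

  -- The state equation of a run, `y = x + Out - In`, arranged without subtraction.
  Balance : (L : List (Edge k)) → Vec ℕ k → ∣ Ch L ∣ → Vec ℕ k → Set
  Balance L x χ y = x +v Out L χ ≡ y +v In L χ

  balance-ε : ∀ L x → Balance L x (CMon.0# (Ch L)) x
  balance-ε L x = cong (x +v_) (trans (flow-ε tgt L) (sym (flow-ε src L)))

  balance-trans : ∀ L {x χ u χ′ y} → Balance L x χ u → Balance L u χ′ y → Balance L x (CMon._⊕_ (Ch L) χ χ′) y
  balance-trans L {x} {χ} {u} {χ′} {y} p q = begin
    x +v Out L (CMon._⊕_ (Ch L) χ χ′)   ≡⟨ cong (x +v_) (flow-⊕ tgt L χ χ′) ⟩
    x +v (Out L χ +v Out L χ′)          ≡⟨ VM.assoc _ _ _ ⟨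
    (x +v Out L χ) +v Out L χ′          ≡⟨ cong (_+v Out L χ′) p ⟩
    (u +v In L χ) +v Out L χ′           ≡⟨ S.solve 3 (λ a b c → (a S.⊕ b) S.⊕ c S.⊜ (a S.⊕ c) S.⊕ b) refl u _ _ ⟩
    (u +v Out L χ′) +v In L χ           ≡⟨ cong (_+v In L χ) q ⟩
    (y +v In L χ′) +v In L χ            ≡⟨ S.solve 3 (λ a b c → (a S.⊕ b) S.⊕ c S.⊜ a S.⊕ (c S.⊕ b)) refl y _ _ ⟩
    y +v (In L χ +v In L χ′)            ≡⟨ cong (y +v_) (flow-⊕ src L χ χ′) ⟨
    y +v In L (CMon._⊕_ (Ch L) χ χ′)    ∎
    where open ≡-Reasoning

  balance-+ : ∀ L {x χ y x′ χ′ y′} → Balance L x χ y → Balance L x′ χ′ y′ → Balance L (x +v x′) (CMon._⊕_ (Ch L) χ χ′) (y +v y′)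
  balance-+ L {x} {χ} {y} {x′} {χ′} {y′} p q = begin
    (x +v x′) +v Out L (CMon._⊕_ (Ch L) χ χ′)    ≡⟨ cong ((x +v x′) +v_) (flow-⊕ tgt L χ χ′) ⟩
    (x +v x′) +v (Out L χ +v Out L χ′)           ≡⟨ VM.interchange _ _ _ _ ⟩
    (x +v Out L χ) +v (x′ +v Out L χ′)           ≡⟨ cong₂ _+v_ p q ⟩
    (y +v In L χ) +v (y′ +v In L χ′)             ≡⟨ VM.interchange _ _ _ _ ⟩
    (y +v y′) +v (In L χ +v In L χ′)             ≡⟨ cong ((y +v y′) +v_) (flow-⊕ src L χ χ′) ⟨
    (y +v y′) +v In L (CMon._⊕_ (Ch L) χ χ′)     ∎
    where open ≡-Reasoning

  balance-mul : ∀ L {x χ y} n → Balance L x χ y → Balance L (n · x) (CMon.mul (Ch L) n χ) (n · y)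
  balance-mul L zero    p = balance-ε L 𝟘
  balance-mul L (suc n) p = balance-+ L p (balance-mul L n p)

  fire-balance : ∀ {P : EdgePred k} L {χ x y} → Fire P L χ x y → Balance L x χ y
  fire-balance L {y = y} f = trans (cong₂ _+v_ (sym (fire-In L f)) (fire-Out L f)) (VM.comm _ y)

  data Run (L : List (Edge k)) : Vec ℕ k → ∣ Ch L ∣ → Vec ℕ k → Set where
    nil  : ∀ {x} → Run L x (CMon.0# (Ch L)) x
    cons : ∀ {x χ u χ′ y} → Fire inn L χ x u → Run L u χ′ y → Run L x (CMon._⊕_ (Ch L) χ χ′) y

  run-balance : ∀ L {x χ y} → Run L x χ y → Balance L x χ y
  run-balance L (nil {x}) = balance-ε L x
  run-balance L (cons {χ = χ} {χ′ = χ′} f r) = balance-trans L {χ = χ} {χ′ = χ′} (fire-balance L f) (run-balance L r)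

  run⇒star : ∀ L {x χ y} → Run L x χ y → Star (EdgeStep inn L) x y
  run⇒star L nil        = ε
  run⇒star L (cons f r) = (_ , f) ◅ run⇒star L r

  star⇒run : ∀ L {x y} → Star (EdgeStep inn L) x y → ∃ λ χ → Run L x χ y
  star⇒run L ε             = _ , nil
  star⇒run L ((_ , f) ◅ s) = _ , cons f (proj₂ (star⇒run L s))

  -- The least monotone relation containing the upper steps. Pumping works in it, and the result
  -- then holds in every monotone relation containing them.
  Shifted : List (Edge k) → VRel k
  Shifted L x y = ∃ λ t → ∃ λ x′ → ∃ λ y′ → EdgeStep out L x′ y′ × x ≡ t +v x′ × y ≡ t +v y′

  shifted-mono : ∀ L → Monotone (Shifted L)
  shifted-mono L t (t′ , x′ , y′ , s , refl , refl) = (t +v t′) , x′ , y′ , s , sym (VM.assoc _ _ _) , sym (VM.assoc _ _ _)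

  shifted-there : ∀ {e L x y} → Shifted L x y → Shifted (e ∷ L) x y
  shifted-there (t , x , y , (χ , f) , p , q) = t , x , y , (_ , inj₂ (χ , f , refl)) , p , q

  step-cover : ∀ L → RelCover k (EdgeStep inn L) (Shifted L)
  step-cover []                          = none λ { _ (_ , ()) }
  step-cover (e@(mkEdge T f) ∷ L) = weaken
    (union (image (inn e) (out e) T f (λ { s (w , a , eq) → w , a , eq })
              (λ w b → 𝟘 , _ , _ , (_ , inj₁ (w , b , refl , refl)) , sym (VM.idˡ _) , sym (VM.idˡ _)))
           (weaken (step-cover L) (λ _ s → s) (λ _ → shifted-there {e} {L})))
    (λ { s (_ , inj₁ (w , a , eq , _)) → inj₁ (w , a , eq) ; s (_ , inj₂ (χ , fr , _)) → inj₂ (χ , fr) })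
    (λ _ b → b)

  star-balance : ∀ L {x y} → Star (Shifted L) x y → ∃ λ χ → Balance L x χ y
  star-balance L {x} ε = _ , balance-ε L x
  star-balance L ((t , x , y , (χ , f) , refl , refl) ◅ r) with star-balance L r
  ... | χ′ , b = _ , balance-trans L {χ = χ} {χ′ = χ′} (begin
      (t +v x) +v Out L χ     ≡⟨ VM.assoc _ _ _ ⟩
      t +v (x +v Out L χ)     ≡⟨ cong (t +v_) (fire-balance L f) ⟩
      t +v (y +v In L χ)      ≡⟨ VM.assoc _ _ _ ⟨
      (t +v y) +v In L χ      ∎) b
    where open ≡-Reasoning

  -- Such a vector is the characteristic vector of a run from any large enough point: since 0 is a
  -- parameter of every edge, all uses but one may take the parameter 0.
  Realizable : (L : List (Edge k)) → ∣ Ch L ∣ → Set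
  Realizable []      χ             = ⊤
  Realizable (e ∷ L) ((n , w) , χ) = 1 ≤ n × out e w × Realizable L χ

  -- From `t +v In L χ` each use finds its own share of `In` in reserve and trades it for its share
  -- of `Out`, so the uses can be performed edge by edge.
  realize : ∀ L χ → Realizable L χ → ∀ t → Star (Shifted L) (t +v In L χ) (t +v Out L χ)
  realize []      χ _ t = ε
  realize (e@(mkEdge (node b₀ _ _) f) ∷ L) ((suc n , w) , χ) (_ , b , r) t =
    subst₂ (Star (Shifted (e ∷ L)))
      (S.solve 5 (λ t n p x i → ((t S.⊕ i) S.⊕ n) S.⊕ (p S.⊕ x) S.⊜ t S.⊕ (((p S.⊕ n) S.⊕ x) S.⊕ i)) refl t (n · p) p (lin (src e) w) (In L χ))
      (S.solve 5 (λ t n q y o → (t S.⊕ ((q S.⊕ n) S.⊕ y)) S.⊕ o S.⊜ t S.⊕ (((q S.⊕ n) S.⊕ y) S.⊕ o)) refl t (n · q) q (lin (tgt e) w) (Out L χ))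
      ((first ◅ zeros n (t +v In L χ +v fun (tgt e) w)) ◅◅ rest)
    where
    p = fun (src e) 𝟘
    q = fun (tgt e) 𝟘
    first : Shifted (e ∷ L) (((t +v In L χ) +v n · p) +v (p +v lin (src e) w)) ((t +v In L χ +v fun (tgt e) w) +v n · p)
    first = ((t +v In L χ) +v n · p) , fun (src e) w , fun (tgt e) w , (_ , inj₁ (w , b , refl , refl)) ,
      cong (((t +v In L χ) +v n · p) +v_) (sym (fun-0 (src e) w)) ,
      S.solve 4 (λ t i o n → (t S.⊕ (i S.⊕ o)) S.⊕ n S.⊜ ((t S.⊕ i) S.⊕ n) S.⊕ o) refl t _ _ _
    zeros : ∀ n t → Star (Shifted (e ∷ L)) (t +v n · p) (t +v n · q)
    zeros zero    t = ε
    zeros (suc n) t = ((t +v n · p) , p , q , (_ , inj₁ (𝟘 , b₀ , refl , refl)) ,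
        S.solve 3 (λ t p n → t S.⊕ (p S.⊕ n) S.⊜ (t S.⊕ n) S.⊕ p) refl t p _ , refl) ◅
      subst₂ (Star (Shifted (e ∷ L)))
        (S.solve 3 (λ t q n → (t S.⊕ q) S.⊕ n S.⊜ (t S.⊕ n) S.⊕ q) refl t q _) (VM.assoc t q _) (zeros n (t +v q))
    rest : Star (Shifted (e ∷ L)) ((t +v In L χ +v fun (tgt e) w) +v n · q) ((t +v ((q +v n · q) +v lin (tgt e) w)) +v Out L χ)
    rest = subst₂ (Star (Shifted (e ∷ L)))
      (trans (S.solve 5 (λ t q n y i → (t S.⊕ ((q S.⊕ n) S.⊕ y)) S.⊕ i S.⊜ (t S.⊕ (i S.⊕ (q S.⊕ y))) S.⊕ n) refl t q (n · q) (lin (tgt e) w) (In L χ))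
             (cong (λ z → (t +v In L χ +v z) +v n · q) (sym (fun-0 (tgt e) w))))
      refl
      (Star.map (shifted-there {e} {L}) (realize L χ r (t +v ((q +v n · q) +v lin (tgt e) w))))

  mul-⊗ : ∀ {S T} n (s : ∣ S ∣) (t : ∣ T ∣) → CMon.mul (S ⊗ T) n (s , t) ≡ (CMon.mul S n s , CMon.mul T n t)
  mul-⊗ zero    s t = refl
  mul-⊗ {S} {T} (suc n) s t = cong (CMon._⊕_ (S ⊗ T) (s , t)) (mul-⊗ {S} {T} n s t)

  mul-Ch : ∀ (e : Edge k) L j n w χ →
           CMon.mul (Ch (e ∷ L)) j ((n , w) , χ) ≡ ((j * n , j · w) , CMon.mul (Ch L) j χ)
  mul-Ch e L j n w χ = trans (mul-⊗ {Nat ⊗ V (dom e)} {Ch L} j (n , w) χ)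
    (cong (_, CMon.mul (Ch L) j χ) (trans (mul-⊗ {Nat} {V (dom e)} j n w) (cong (_, j · w) (mul-Nat j n))))

  -- Positivity of `h` makes it a pumping direction for the summed parameters of every edge; the
  -- periods of the edges are multiplied, as for `Pumpable-×`.
  realizable-multiple : ∀ (L : List (Edge k)) ζ h → Pos L h → ∃ λ M → ∀ j → Realizable L (CMon._⊕_ (Ch L) ζ (CMon.mul (Ch L) (suc j * suc M) h))
  realizable-multiple [] ζ h _ = 0 , λ _ → tt
  realizable-multiple (e@(mkEdge (node _ pumpB _) _) ∷ L) ((n , w) , ζ) ((n′ , w′) , h) (pn , pw , ph)
    with pumpB w (w′ ∸v 𝟙) | realizable-multiple L ζ h ph
  ... | N , p | M , q = M + N * suc M , λ j → subst (λ χ → Realizable (e ∷ L) (CMon._⊕_ (Ch (e ∷ L)) ((n , w) , ζ) χ))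
    (sym (mul-Ch e L (suc j * suc (M + N * suc M)) n′ w′ h))
    ( ≤-trans (*-mono-≤ {1} {suc j * suc (M + N * suc M)} (s≤s z≤n) pn) (m≤n+m _ n)
    , subst (λ z → out e (w +v z)) (cong₂ _·_ (lem₁ j N M) (x+[y∸x] 𝟙 w′ pw)) (p (M + j * suc M))
    , subst (λ z → Realizable L (CMon._⊕_ (Ch L) ζ (CMon.mul (Ch L) z h))) (lem₂ j N M) (q (N + j * suc N)) )
    where
    lem₁ : ∀ j N M → suc (M + j * suc M) * suc N ≡ suc j * suc (M + N * suc M)
    lem₁ = solve-∀
    lem₂ : ∀ j N M → suc (N + j * suc N) * suc M ≡ suc j * suc (M + N * suc M)
    lem₂ = solve-∀

  dominate-V : ∀ {m} (h ξ : Vec ℕ m) → 𝟙 ≤v h → ∃ λ j → ξ ≤v j · h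
  dominate-V h ξ pos with upper ξ
  ... | j , le = j , λ i → ≤-trans (≤-trans (le i) (≤-trans (≤-reflexive (sym (*-identityʳ j)))
      (*-monoʳ-≤ j (≤-trans (≤-reflexive (sym (lookup-𝟙 i))) (pos i))))) (≤-reflexive (sym (lookup-· j h i)))

  dominate-more : ∀ (L : List (Edge k)) h ξ ζ j j′ → CMon.mul (Ch L) j h ≡ CMon._⊕_ (Ch L) ξ ζ →
                  CMon.mul (Ch L) (j + j′) h ≡ CMon._⊕_ (Ch L) ξ (CMon._⊕_ (Ch L) ζ (CMon.mul (Ch L) j′ h))
  dominate-more L h ξ ζ j j′ eq = trans (CMon.mul-+ (Ch L) j j′ h) (trans (cong (λ z → CMon._⊕_ (Ch L) z (CMon.mul (Ch L) j′ h)) eq) (CMon.assoc (Ch L) _ _ _))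

  dominate : ∀ (L : List (Edge k)) h ξ → Pos L h → ∃ λ j → ∃ λ ζ → CMon.mul (Ch L) j h ≡ CMon._⊕_ (Ch L) ξ ζ
  dominate [] h ξ _ = 0 , tt , refl
  dominate (e ∷ L) ((n , w) , h) ((n′ , w′) , ξ) (pn , pw , ph) with dominate-V w w′ pw | dominate L h ξ ph
  ... | j₁ , le | j₂ , ζ , eq = j , ((j * n ∸ n′ , (j · w) ∸v w′) , CMon._⊕_ (Ch L) ζ (CMon.mul (Ch L) (n′ + j₁) h)) ,
    trans (mul-Ch e L j n w h) (cong₂ _,_ (cong₂ _,_ (sym (m+[n∸m]≡n n′≤)) (sym (x+[y∸x] w′ (j · w) w′≤)))
      (trans (cong (λ i → CMon.mul (Ch L) i h) (+-comm (n′ + j₁) j₂)) (dominate-more L h ξ ζ j₂ (n′ + j₁) eq)))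
    where
    j = n′ + j₁ + j₂
    n′≤ : n′ ≤ j * n
    n′≤ = ≤-trans (≤-trans (m≤m+n n′ j₁) (m≤m+n _ j₂)) (≤-trans (≤-reflexive (sym (*-identityʳ j))) (*-monoʳ-≤ j pn))
    w′≤ : w′ ≤v j · w
    w′≤ i = ≤-trans (le i) (≤-trans (≤-reflexive (lookup-· j₁ w i)) (≤-trans
      (*-monoˡ-≤ (lookup w i) (≤-trans (m≤n+m j₁ n′) (m≤m+n _ j₂))) (≤-reflexive (sym (lookup-· j w i)))))

  -- `α` is what a pumping run consumes and `β` what it leaves. A multiple of `h` pays for `α` where
  -- `h` is positive; elsewhere there is nothing to pay and something is gained. So `ρ +v β` ends up
  -- positive everywhere.
  slack : ∀ (h α β : Vec ℕ k) → (∀ i → 1 ≤ lookup h i ⊎ (lookup α i ≡ 0 × 1 ≤ lookup β i)) →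
          ∃ λ m₀ → ∀ m → m₀ ≤ m → ∃ λ ρ → m · h ≡ α +v ρ × 𝟙 ≤v ρ +v β
  slack h α β pos with upper α
  ... | U , α≤U = suc U , λ m le → ((m · h) ∸v α) , sym (x+[y∸x] α (m · h) (α≤ m le)) , big m le
    where
    m≤mh : ∀ m i → 1 ≤ lookup h i → m ≤ lookup (m · h) i
    m≤mh m i p = ≤-trans (≤-trans (≤-reflexive (sym (*-identityʳ m))) (*-monoʳ-≤ m p)) (≤-reflexive (sym (lookup-· m h i)))
    α≤ : ∀ m → suc U ≤ m → α ≤v m · h
    α≤ m le i with pos i
    ... | inj₁ p       = ≤-trans (α≤U i) (≤-trans (n≤1+n U) (≤-trans le (m≤mh m i p)))
    ... | inj₂ (z , _) = ≤-trans (≤-reflexive z) z≤n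
    big : ∀ m → suc U ≤ m → 𝟙 ≤v ((m · h) ∸v α) +v β
    big m le i = ≤-trans (≤-reflexive (lookup-𝟙 i)) (≤-trans (pos′ (pos i)) (≤-reflexive (sym (lookup-+v ((m · h) ∸v α) β i))))
      where
      pos′ : 1 ≤ lookup h i ⊎ (lookup α i ≡ 0 × 1 ≤ lookup β i) → 1 ≤ lookup ((m · h) ∸v α) i + lookup β i
      pos′ (inj₁ p)       = ≤-trans (≤-trans (m<n⇒0<n∸m (≤-trans (s≤s (α≤U i)) (≤-trans le (m≤mh m i p))))
                              (≤-reflexive (sym (lookup-zipWith _∸_ i (m · h) α)))) (m≤m+n _ _)
      pos′ (inj₂ (_ , p)) = ≤-trans p (m≤n+m _ _)

  repeat : ∀ {R : VRel k} {c α β} → Monotone R → Star R (c +v α) (c +v β) →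
           ∀ j t → Star R (t +v (c +v j · α)) (t +v (c +v j · β))
  repeat m r zero t = ε
  repeat {R} {c} {α} {β} m r (suc j) t =
    subst₂ (Star R)
      (S.solve 4 (λ t c a n → (t S.⊕ n) S.⊕ (c S.⊕ a) S.⊜ t S.⊕ (c S.⊕ (a S.⊕ n))) refl t c α (j · α))
      (S.solve 4 (λ t c a n → (t S.⊕ n) S.⊕ (c S.⊕ a) S.⊜ (t S.⊕ a) S.⊕ (c S.⊕ n)) refl t c β (j · α))
      (Star-monotone m (t +v j · α) r)
    ◅◅ subst (Star R ((t +v β) +v (c +v j · α)))
      (S.solve 4 (λ t c b n → (t S.⊕ b) S.⊕ (c S.⊕ n) S.⊜ t S.⊕ (c S.⊕ (b S.⊕ n))) refl t c β (j · β))
      (repeat m r j (t +v β))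

  -- A loop from σ to τ is iterated J times from Jσ to Jτ: on the way the vectors pσ + qτ with
  -- p + q = J stay large because σ and τ are positive.
  interpolate : ∀ {R : VRel k} {σ τ i o J} → (∀ t → Star R (t +v i) (t +v o)) → σ +v o ≡ τ +v i →
                𝟙 ≤v σ → 𝟙 ≤v τ → (∀ l → lookup i l ≤ J) →
                ∀ p q → J ≤ p + q → ∀ t → Star R (t +v (p · σ +v q · τ)) (t +v (p + q) · τ)
  interpolate {R} {σ} {τ} loop eq pσ pτ le zero q J≤ t = subst (λ z → Star R (t +v z) (t +v q · τ)) (sym (VM.idˡ _)) ε
  interpolate {R} {σ} {τ} {i} {o} {J} loop eq pσ pτ le (suc p) q J≤ t =
    subst₂ (λ a b → Star R (t +v a) (t +v b)) i+r o+r
      (subst₂ (Star R) (assoc′ i) (assoc′ o) (loop (t +v r)))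
    ◅◅ subst (λ n → Star R (t +v (p · σ +v suc q · τ)) (t +v n · τ)) (+-suc p q)
         (interpolate loop eq pσ pτ le p (suc q) (≤-trans J≤ (≤-reflexive (sym (+-suc p q)))) t)
    where
    now′ = suc p · σ +v q · τ
    r = now′ ∸v i
    assoc′ : ∀ z → (t +v r) +v z ≡ t +v (z +v r)
    assoc′ z = S.solve 3 (λ t r z → (t S.⊕ r) S.⊕ z S.⊜ t S.⊕ (z S.⊕ r)) refl t r z
    times : ∀ n {v : Vec ℕ k} → 𝟙 ≤v v → ∀ l → n ≤ lookup (n · v) l
    times n {v} pv l = ≤-trans (≤-trans (≤-reflexive (sym (*-identityʳ n))) (*-monoʳ-≤ n
      (≤-trans (≤-reflexive (sym (lookup-𝟙 l))) (pv l)))) (≤-reflexive (sym (lookup-· n v l)))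
    i+r : i +v r ≡ now′
    i+r = x+[y∸x] i now′ λ l → ≤-trans (le l) (≤-trans J≤ (≤-trans (+-mono-≤ (times (suc p) {σ} pσ l) (times q {τ} pτ l))
      (≤-reflexive (sym (lookup-+v (suc p · σ) (q · τ) l)))))
    o+r : o +v r ≡ p · σ +v suc q · τ
    o+r = VM.cancelˡ σ (begin
      σ +v (o +v r)               ≡⟨ VM.assoc _ _ _ ⟨
      (σ +v o) +v r               ≡⟨ cong (_+v r) eq ⟩
      (τ +v i) +v r               ≡⟨ VM.assoc _ _ _ ⟩
      τ +v (i +v r)               ≡⟨ cong (τ +v_) i+r ⟩
      τ +v ((σ +v p · σ) +v q · τ) ≡⟨ S.solve 4 (λ t s a b → t S.⊕ ((s S.⊕ a) S.⊕ b) S.⊜ s S.⊕ (a S.⊕ (t S.⊕ b))) refl τ σ _ _ ⟩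
      σ +v (p · σ +v (τ +v q · τ)) ∎)
      where open ≡-Reasoning

  -- The state equations of the two pumping runs are subtracted from that of a multiple of the
  -- homogeneous solution. What remains is the state equation of the filling loop, which has to lead
  -- from `ρ +v β` to `ρ′ +v γ`.
  residual-balance : ∀ {c d α β γ δ ρ ρ′ oᵤ iᵤ oᵥ iᵥ o i : Vec ℕ k} →
    (c +v α) +v oᵤ ≡ (c +v β) +v iᵤ → (d +v γ) +v oᵥ ≡ (d +v δ) +v iᵥ →
    (α +v ρ) +v ((oᵤ +v oᵥ) +v o) ≡ (δ +v ρ′) +v ((iᵤ +v iᵥ) +v i) →
    (ρ +v β) +v o ≡ (ρ′ +v γ) +v i
  residual-balance {c} {d} {α} {β} {γ} {δ} {ρ} {ρ′} {oᵤ} {iᵤ} {oᵥ} {iᵥ} {o} {i} e₁ e₂ e₃ =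
    VM.cancelˡ (((c +v d) +v iᵤ) +v oᵥ) (begin
      (((c +v d) +v iᵤ) +v oᵥ) +v ((ρ +v β) +v o)
        ≡⟨ S.solve 7 (λ c d i v r b o → (((c S.⊕ d) S.⊕ i) S.⊕ v) S.⊕ ((r S.⊕ b) S.⊕ o) S.⊜ ((c S.⊕ b) S.⊕ i) S.⊕ (((d S.⊕ v) S.⊕ r) S.⊕ o)) refl c d iᵤ oᵥ ρ β o ⟩
      ((c +v β) +v iᵤ) +v (((d +v oᵥ) +v ρ) +v o)
        ≡⟨ cong (_+v (((d +v oᵥ) +v ρ) +v o)) e₁ ⟨
      ((c +v α) +v oᵤ) +v (((d +v oᵥ) +v ρ) +v o)
        ≡⟨ S.solve 7 (λ c d a u v r o → ((c S.⊕ a) S.⊕ u) S.⊕ (((d S.⊕ v) S.⊕ r) S.⊕ o) S.⊜ (c S.⊕ d) S.⊕ ((a S.⊕ r) S.⊕ ((u S.⊕ v) S.⊕ o))) refl c d α oᵤ oᵥ ρ o ⟩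
      (c +v d) +v ((α +v ρ) +v ((oᵤ +v oᵥ) +v o))
        ≡⟨ cong ((c +v d) +v_) e₃ ⟩
      (c +v d) +v ((δ +v ρ′) +v ((iᵤ +v iᵥ) +v i))
        ≡⟨ S.solve 7 (λ c d e r u v i → (c S.⊕ d) S.⊕ ((e S.⊕ r) S.⊕ ((u S.⊕ v) S.⊕ i)) S.⊜ ((d S.⊕ e) S.⊕ v) S.⊕ (((c S.⊕ r) S.⊕ u) S.⊕ i)) refl c d δ ρ′ iᵤ iᵥ i ⟩
      ((d +v δ) +v iᵥ) +v (((c +v ρ′) +v iᵤ) +v i)
        ≡⟨ cong (_+v (((c +v ρ′) +v iᵤ) +v i)) e₂ ⟨
      ((d +v γ) +v oᵥ) +v (((c +v ρ′) +v iᵤ) +v i)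
        ≡⟨ S.solve 7 (λ c d g v r u i → ((d S.⊕ g) S.⊕ v) S.⊕ (((c S.⊕ r) S.⊕ u) S.⊕ i) S.⊜ (((c S.⊕ d) S.⊕ u) S.⊕ v) S.⊕ ((r S.⊕ g) S.⊕ i)) refl c d γ oᵥ ρ′ iᵤ i ⟩
      (((c +v d) +v iᵤ) +v oᵥ) +v ((ρ′ +v γ) +v i) ∎)
    where open ≡-Reasoning

  -- Lambert's pumping argument: U^j π W^j V^j, where U and V are the forward and backward pumping
  -- runs, W uses what is left of a multiple of the homogeneous solution, and π is any run whose
  -- characteristic vector differs from that of the given solution by a multiple of the same.
  pumping : ∀ (L : List (Edge k)) {x₀ χ₀ y₀ xₕ χₕ yₕ c α β d γ δ x₀′ y₀′} →
    Balance L x₀ χ₀ y₀ → Balance L xₕ χₕ yₕ → Pos L χₕ →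
    Star (Shifted L) (c +v α) (c +v β) → Star (Shifted L) (d +v γ) (d +v δ) →
    x₀ ≡ c +v x₀′ → y₀ ≡ d +v y₀′ →
    (∀ i → 1 ≤ lookup xₕ i ⊎ (lookup α i ≡ 0 × 1 ≤ lookup β i)) →
    (∀ i → 1 ≤ lookup yₕ i ⊎ (lookup δ i ≡ 0 × 1 ≤ lookup γ i)) →
    ∃ λ N → ∀ j → Star (Shifted L) (x₀ +v (suc j * suc N) · xₕ) (y₀ +v (suc j * suc N) · yₕ)
  pumping L {x₀} {χ₀} {y₀} {xₕ} {χₕ} {yₕ} {c} {α} {β} {d} {γ} {δ} {x₀′} {y₀′} b₀ bₕ posₕ U V refl refl posx posy
    with star-balance L U | star-balance L V
  ... | χᵤ , bᵤ | χᵥ , bᵥ with dominate L χₕ (CMon._⊕_ (Ch L) χᵤ χᵥ) posₕ | slack xₕ α β posx | slack yₕ δ γ posy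
  ... | m₁ , ζ , ζ≡ | m₂ , slackx | m₃ , slacky
    with realizable-multiple L (CMon._⊕_ (Ch L) ζ (CMon.mul (Ch L) (m₂ + m₃) χₕ)) χₕ posₕ | realizable-multiple L χ₀ χₕ posₕ
  ... | M , realW | M₀ , realπ = N , λ j → subst (λ n → Star _↝_ (x₀ +v n · xₕ) (y₀ +v n · yₕ)) (count j) (run (j * suc (M₀ + J) + J) (m≤n+m J (j * suc (M₀ + J))))
    where
    _↝_ = Shifted L
    module VC = CMon (Ch L)
    -- `m₁` copies of `χₕ` dominate `U` and `V` together, `m₂` and `m₃` give slack at the two ends,
    -- and `suc M` further copies make the remainder realisable.
    m′ = m₁ + (m₂ + m₃) + M
    m  = suc m′
    m≡ : m₁ + (m₂ + m₃) + 1 * suc M ≡ m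
    m≡ = trans (cong (m₁ + (m₂ + m₃) +_) (*-identityˡ (suc M))) (+-suc _ M)
    χw = VC._⊕_ (VC._⊕_ ζ (VC.mul (m₂ + m₃) χₕ)) (VC.mul (1 * suc M) χₕ)
    mχ : VC.mul m χₕ ≡ VC._⊕_ (VC._⊕_ χᵤ χᵥ) χw
    mχ = trans (cong (λ n → VC.mul n χₕ) (sym m≡))
      (dominate-more L χₕ _ _ (m₁ + (m₂ + m₃)) (1 * suc M) (dominate-more L χₕ _ ζ m₁ (m₂ + m₃) ζ≡))
    m₂≤m : m₂ ≤ m
    m₂≤m = ≤-trans (m≤m+n m₂ m₃) (≤-trans (m≤n+m (m₂ + m₃) m₁) (≤-trans (m≤m+n _ M) (n≤1+n m′)))
    m₃≤m : m₃ ≤ m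
    m₃≤m = ≤-trans (m≤n+m m₃ m₂) (≤-trans (m≤n+m (m₂ + m₃) m₁) (≤-trans (m≤m+n _ M) (n≤1+n m′)))
    ρ = proj₁ (slackx m m₂≤m)
    mxₕ : m · xₕ ≡ α +v ρ
    mxₕ = proj₁ (proj₂ (slackx m m₂≤m))
    σ = ρ +v β
    σ-pos : 𝟙 ≤v σ
    σ-pos = proj₂ (proj₂ (slackx m m₂≤m))
    ρ′ = proj₁ (slacky m m₃≤m)
    myₕ : m · yₕ ≡ δ +v ρ′
    myₕ = proj₁ (proj₂ (slacky m m₃≤m))
    τ = ρ′ +v γ
    τ-pos : 𝟙 ≤v τ
    τ-pos = proj₂ (proj₂ (slacky m m₃≤m))
    split₃ : ∀ end → fun (flow end L) (VC.mul m χₕ) ≡ (fun (flow end L) χᵤ +v fun (flow end L) χᵥ) +v fun (flow end L) χw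
    split₃ end = trans (cong (fun (flow end L)) mχ) (trans (flow-⊕ end L _ _) (cong (_+v fun (flow end L) χw) (flow-⊕ end L χᵤ χᵥ)))
    w-balance : σ +v Out L χw ≡ τ +v In L χw
    w-balance = residual-balance {c} {d} bᵤ bᵥ (subst₂ _≡_ (cong₂ _+v_ mxₕ (split₃ tgt)) (cong₂ _+v_ myₕ (split₃ src)) (balance-mul L m bₕ))
    -- A multiple of `suc M₀`, so that `χπ` is realisable, and of `m`, so that the total counted
    -- below divides evenly.
    R′ = m * suc M₀
    χπ = VC._⊕_ χ₀ (VC.mul R′ χₕ)
    π-balance : (x₀ +v R′ · xₕ) +v Out L χπ ≡ (y₀ +v R′ · yₕ) +v In L χπ
    π-balance = balance-+ L {χ = χ₀} {χ′ = VC.mul R′ χₕ} b₀ (balance-mul L R′ bₕ)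
    J = proj₁ (upper (In L χπ)) + proj₁ (upper (In L χw))
    -- Chosen so that `suc N` is `m * suc (M₀ + J)`. After `R′` is taken off, `suc j * suc N` leaves
    -- `j * suc (M₀ + J) + J` rounds of `m`, at least the `J` that leave room for `π` and `W`.
    N = (M₀ + J) + m′ * suc (M₀ + J)
    count : ∀ j → m * suc M₀ + (j * suc (M₀ + J) + J) * m ≡ suc j * suc N
    count j = lem j m′ M₀ J
      where
      lem : ∀ j m′ M₀ J → suc m′ * suc M₀ + (j * suc (M₀ + J) + J) * suc m′ ≡ suc j * suc ((M₀ + J) + m′ * suc (M₀ + J))
      lem = solve-∀
    run : ∀ j → J ≤ j → Star _↝_ (x₀ +v (R′ + j * m) · xₕ) (y₀ +v (R′ + j * m) · yₕ)
    -- Up to `R′` homogeneous solutions, the intermediate points are `x₀ +v j · σ`, `y₀ +v j · σ`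
    -- and `y₀ +v j · τ`.
    run j J≤j = subst₂ (Star _↝_) (sym start) (sym finish) (forward ◅◅ middle ◅◅ loops ◅◅ backward)
      where
      multiple : ∀ (h a b : Vec ℕ k) → m · h ≡ a +v b → (R′ + j * m) · h ≡ R′ · h +v (j · a +v j · b)
      multiple h a b eq = trans (VM.mul-+ R′ (j * m) h) (cong (R′ · h +v_) (trans (VM.mul-* j m h) (trans (cong (j ·_) eq) (VM.mul-⊕ j a b))))
      start : x₀ +v (R′ + j * m) · xₕ ≡ ((x₀′ +v R′ · xₕ) +v j · ρ) +v (c +v j · α)
      start = trans (cong (x₀ +v_) (multiple xₕ α ρ mxₕ))
        (S.solve 5 (λ c x r a p → (c S.⊕ x) S.⊕ (r S.⊕ (a S.⊕ p)) S.⊜ ((x S.⊕ r) S.⊕ p) S.⊕ (c S.⊕ a)) refl c x₀′ _ _ _)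
      finish : y₀ +v (R′ + j * m) · yₕ ≡ ((y₀′ +v R′ · yₕ) +v j · ρ′) +v (d +v j · δ)
      finish = trans (cong (y₀ +v_) (multiple yₕ δ ρ′ myₕ))
        (S.solve 5 (λ c x r a p → (c S.⊕ x) S.⊕ (r S.⊕ (a S.⊕ p)) S.⊜ ((x S.⊕ r) S.⊕ p) S.⊕ (c S.⊕ a)) refl d y₀′ _ _ _)
      middle-end : ∀ {c₁ z r₁ p q : Vec ℕ k} → ((z +v r₁) +v p) +v (c₁ +v q) ≡ ((c₁ +v z) +v r₁) +v (p +v q)
      middle-end {c₁} {z} {r₁} {p} {q} = S.solve 5 (λ c z r p q → ((z S.⊕ r) S.⊕ p) S.⊕ (c S.⊕ q) S.⊜ ((c S.⊕ z) S.⊕ r) S.⊕ (p S.⊕ q)) refl c₁ z r₁ p q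
      forward : Star _↝_ (((x₀′ +v R′ · xₕ) +v j · ρ) +v (c +v j · α)) ((x₀ +v R′ · xₕ) +v j · σ)
      forward = subst (Star _↝_ _) (trans middle-end (cong ((x₀ +v R′ · xₕ) +v_) (sym (VM.mul-⊕ j ρ β))))
        (repeat (shifted-mono L) U j ((x₀′ +v R′ · xₕ) +v j · ρ))
      backward : Star _↝_ ((y₀ +v R′ · yₕ) +v j · τ) (((y₀′ +v R′ · yₕ) +v j · ρ′) +v (d +v j · δ))
      backward = subst (λ z → Star _↝_ z (((y₀′ +v R′ · yₕ) +v j · ρ′) +v (d +v j · δ))) (trans middle-end (cong ((y₀ +v R′ · yₕ) +v_) (sym (VM.mul-⊕ j ρ′ γ))))
        (repeat (shifted-mono L) V j ((y₀′ +v R′ · yₕ) +v j · ρ′))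
      loops : Star _↝_ ((y₀ +v R′ · yₕ) +v j · σ) ((y₀ +v R′ · yₕ) +v j · τ)
      loops = subst₂ (λ a b → Star _↝_ ((y₀ +v R′ · yₕ) +v a) ((y₀ +v R′ · yₕ) +v b · τ)) (VM.idʳ _) (+-identityʳ j)
        (interpolate {σ = σ} {τ = τ} (realize L χw (realW 0)) w-balance σ-pos τ-pos
          (λ l → ≤-trans (proj₂ (upper (In L χw)) l) (m≤n+m _ _)) j 0 (≤-trans J≤j (m≤m+n j 0)) (y₀ +v R′ · yₕ))
      r = (j · σ) ∸v In L χπ
      In+r : In L χπ +v r ≡ j · σ
      In+r = x+[y∸x] (In L χπ) (j · σ) λ l → ≤-trans (proj₂ (upper (In L χπ)) l) (≤-trans (m≤m+n _ _) (≤-trans J≤j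
        (≤-trans (≤-trans (≤-reflexive (sym (*-identityʳ j))) (*-monoʳ-≤ j (≤-trans (≤-reflexive (sym (lookup-𝟙 l))) (σ-pos l))))
          (≤-reflexive (sym (lookup-· j σ l))))))
      middle : Star _↝_ ((x₀ +v R′ · xₕ) +v j · σ) ((y₀ +v R′ · yₕ) +v j · σ)
      middle = subst₂ (Star _↝_)
        (trans (S.solve 3 (λ a r i → (a S.⊕ r) S.⊕ i S.⊜ a S.⊕ (i S.⊕ r)) refl (x₀ +v R′ · xₕ) r _) (cong ((x₀ +v R′ · xₕ) +v_) In+r))
        (begin
          ((x₀ +v R′ · xₕ) +v r) +v Out L χπ   ≡⟨ S.solve 3 (λ a r o → (a S.⊕ r) S.⊕ o S.⊜ (a S.⊕ o) S.⊕ r) refl (x₀ +v R′ · xₕ) r _ ⟩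
          ((x₀ +v R′ · xₕ) +v Out L χπ) +v r   ≡⟨ cong (_+v r) π-balance ⟩
          ((y₀ +v R′ · yₕ) +v In L χπ) +v r    ≡⟨ VM.assoc _ _ _ ⟩
          (y₀ +v R′ · yₕ) +v (In L χπ +v r)    ≡⟨ cong ((y₀ +v R′ · yₕ) +v_) In+r ⟩
          (y₀ +v R′ · yₕ) +v j · σ             ∎)
        (realize L χπ (realπ m′) ((x₀ +v R′ · xₕ) +v r))
        where open ≡-Reasoning

-- The closure theorem for monotone relations with a cover

reverse-star : ∀ {k} {R : VRel k} {x y} → Star (Flip R) x y → Star R y x
reverse-star ε       = ε
reverse-star (r ◅ s) = reverse-star s ◅◅ (r ◅ ε)

unreverse-star : ∀ {k} {R : VRel k} {x y} → Star R x y → Star (Flip R) y x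
unreverse-star ε       = ε
unreverse-star (r ◅ s) = unreverse-star s ◅◅ (r ◅ ε)

pairA : ∀ {S T S′ T′} → Aff S S′ → Aff T T′ → Aff (S ⊗ T) (S′ ⊗ T′)
pairA f g = mkAff (λ (s , t) → fun f s , fun g t) (λ (s , t) → lin f s , lin g t) (λ (s , t) (s′ , t′) → cong₂ _,_ (aff f s s′) (aff g t t′))

ins-+ : ∀ {k} (i : Fin k) a t x → ins i a (t +v x) ≡ ins i 0 t +v ins i a x
ins-+ {suc k} i a t x = trans (cong (λ v → Vec.insertAt v i a) (CMon.comm (V k) t x))
  (trans (insertAt-+ i a x t) (CMon.comm (V (suc k)) _ _))

-- A coordinate that stays below K is moved into the control state.
low-cover : ∀ {k} {A R : VRel k} i K → StarClosed (pred k) → Monotone R → RelCover k A R →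
            RelCover k (λ x y → lookup x i ≤ K × Star (Low A i K) x y) (Star R)
low-cover {k} {A} {R} i K sc mono cover = weaken
  (⋃Fin λ a → ⋃Fin λ b → map-image (graph a b) (insA₂ a b)
    (λ t a → a) (λ (x , y) r → subst₂ (Star R) (sym (fun-insA i (Fin.toℕ a) x)) (sym (fun-insA i (Fin.toℕ b) y)) (Star.gmap (λ (c , z) → ins i (Fin.toℕ c) z) id r)))
  (λ (x , y) (le , r) → level x , level y , (rem i x , rem i y) , encode le r ,
     cong₂ _,_ (trans (fun-insA i (Fin.toℕ (level x)) _) (restore le)) (trans (fun-insA i (Fin.toℕ (level y)) _) (restore (end-low le r))))
  (λ _ r → r)
  where
  k′ = pred k
  insA₂ : Fin (suc K) → Fin (suc K) → Aff (V k′ ⊗ V k′) (V k ⊗ V k)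
  insA₂ a b = pairA (insA i (Fin.toℕ a)) (insA i (Fin.toℕ b))
  G : VRel k → GraphRel (suc K) k′
  G B a b x y = B (ins i (Fin.toℕ a) x) (ins i (Fin.toℕ b) y)
  graph : ∀ a b → RelCover k′ (λ x y → Star (GStep (G A)) (a , x) (b , y)) (λ x y → Star (GStep (G R)) (a , x) (b , y))
  graph = graph-cover sc (G A) (G R)
    (λ a b t {x} {y} r → subst₂ R (sym (ins-+ i (Fin.toℕ a) t x)) (sym (ins-+ i (Fin.toℕ b) t y)) (mono (ins i 0 t) r))
    (λ a b → weaken (pullback cover (solve-VV k) (param-VV k′) (insA₂ a b))
      (λ (x , y) r → subst₂ A (sym (fun-insA i (Fin.toℕ a) x)) (sym (fun-insA i (Fin.toℕ b) y)) r)
      (λ (x , y) r → subst₂ R (fun-insA i (Fin.toℕ a) x) (fun-insA i (Fin.toℕ b) y) r))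
  level : Vec ℕ k → Fin (suc K)
  level x = Fin.fromℕ< (s≤s (m⊓n≤n (lookup x i) K))
  restore : ∀ {x} → lookup x i ≤ K → ins i (Fin.toℕ (level x)) (rem i x) ≡ x
  restore {x} le = ins-rem i x (sym (trans (Finₚ.toℕ-fromℕ< (s≤s (m⊓n≤n (lookup x i) K))) (m≤n⇒m⊓n≡m le)))
  end-low : ∀ {x y} → lookup x i ≤ K → Star (Low A i K) x y → lookup y i ≤ K
  end-low le ε                 = le
  end-low le ((_ , _ , q) ◅ r) = end-low q r
  encode : ∀ {x y} → lookup x i ≤ K → Star (Low A i K) x y → Star (GStep (G A)) (level x , rem i x) (level y , rem i y)
  encode le ε                 = ε
  encode le ((a , p , q) ◅ r) = subst₂ A (sym (restore p)) (sym (restore q)) a ◅ encode q r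

lin-unique : ∀ {S T} (f g : Aff S T) → (∀ s → fun f s ≡ fun g s) → ∀ v → lin f v ≡ lin g v
lin-unique {S} {T} f g eq v = CMon.cancelˡ T (fun f (CMon.0# S))
  (trans (sym (aff f _ v)) (trans (eq _) (trans (aff g _ v) (cong (λ t → CMon._⊕_ T t (lin g v)) (sym (eq _))))))

off+on : ∀ {k} (S : Mask k) x → offMask S x +v onMask S x ≡ x
off+on []          []      = refl
off+on (true ∷ S)  (n ∷ x) = cong (n ∷_) (off+on S x)
off+on (false ∷ S) (n ∷ x) = cong₂ _∷_ (+-identityʳ n) (off+on S x)

off≤ : ∀ {k} (S : Mask k) x → offMask S x ≤v x
off≤ S x i = ≤-trans (m≤m+n _ _) (≤-reflexive (trans (sym (lookup-+v (offMask S x) (onMask S x) i)) (cong (λ v → lookup v i) (off+on S x))))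

support : ∀ {k} → Vec ℕ k → Mask k
support r = Vec.tabulate (λ i → 0 <ᵇ lookup r i)

support-false : ∀ {k} (r : Vec ℕ k) i → lookup (support r) i ≡ false → lookup r i ≡ 0
support-false r i f = n≤0⇒n≡0 (≮⇒≥ λ lt → subst Data.Bool.T (trans (sym (lookup∘tabulate _ i)) f) (<⇒<ᵇ lt))

support-true : ∀ {k} (r : Vec ℕ k) i → lookup (support r) i ≡ true → 1 ≤ lookup r i
support-true r i t = <ᵇ⇒< 0 _ (subst Data.Bool.T (sym (trans (sym (lookup∘tabulate _ i)) t)) tt)

support-agree : ∀ {n k} (f : Aff (V n) (V k)) z → Agree (support (lin f 𝟙)) (fun f z) (fun f 𝟘)
support-agree f z i e = lin-zero⇒const (lookupA i ∘A f) (support-false (lin f 𝟙) i e) z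

module _ {k n : ℕ} {A R : VRel k} {mono : Monotone R} {cover : RelCover k A R} (f : Aff (V n) (V k)) where
  open KarpMiller A R mono cover

  private
    S = support (lin f 𝟙)

  -- What `pumping` expects at one end. Coordinates of the end that do not vary with the parameters
  -- make up `base`; there the run consumes nothing beyond `base` and has to gain. On the varying
  -- ones it may consume `low`, which the homogeneous solution pays for.
  record PumpingRun : Set where
    field
      base low high : Vec ℕ k
      run       : Star R (base +v low) (base +v high)
      start     : ∀ z → ∃ λ x → fun f z ≡ base +v x
      positive  : ∀ h i → 1 ≤ lookup (lin f (𝟙 +v h)) i ⊎ (lookup low i ≡ 0 × 1 ≤ lookup high i)

  pumping-run : CapAll S (fun f 𝟘) → PumpingRun
  pumping-run cap with upper (fun f 𝟘)
  -- One more than a bound on the entries of `fun f 𝟘`, so that the run ends strictly above `base`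
  -- everywhere.
  ... | U , f0≤U with Cap.run cap (suc U)
  ... | x , y , r , ax , _ , big = record
    { base = base ; low = onMask S x ; high = y ∸v base
    ; run = subst₂ (Star R) (trans (sym (off+on S x)) (cong (_+v onMask S x) (agree-off S _ _ ax))) (sym (x+[y∸x] base y λ i → <⇒≤ (base<y i))) r
    ; start = λ z → onMask S (fun f z) , trans (sym (off+on S _)) (cong (_+v onMask S (fun f z)) (agree-off S _ _ (support-agree f z)))
    ; positive = λ h i → positive h i (lookup S i) refl }
    where
    base = offMask S (fun f 𝟘)
    base<y : ∀ i → lookup base i < lookup y i
    base<y i = ≤-trans (s≤s (≤-trans (off≤ S _ i) (f0≤U i))) (big i (lookup-replicate i true))
    positive : ∀ h i b → lookup S i ≡ b → 1 ≤ lookup (lin f (𝟙 +v h)) i ⊎ (lookup (onMask S x) i ≡ 0 × 1 ≤ lookup (y ∸v base) i)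
    positive h i true  e = inj₁ (≤-trans (support-true (lin f 𝟙) i e) (≤-trans (m≤m+n _ _)
      (≤-reflexive (sym (trans (cong (λ v → lookup v i) (lin-⊕ f 𝟙 h)) (lookup-+v (lin f 𝟙) _ i))))))
    positive h i false e = inj₂ (lookup-on′ S x i e ,
      ≤-trans (m<n⇒0<n∸m (base<y i)) (≤-reflexive (sym (lookup-zipWith _∸_ i y base))))

Pos-⊕ : ∀ {k} (L : List (Edge k)) η χ → Pos L η → Pos L (CMon._⊕_ (Ch L) η χ)
Pos-⊕ []      η χ _            = tt
Pos-⊕ (e ∷ L) ((n , w) , η) ((n′ , w′) , χ) (pn , pw , p) = ≤-trans pn (m≤m+n n n′) ,
  (λ i → ≤-trans (pw i) (≤-trans (m≤m+n _ _) (≤-reflexive (sym (lookup-+v w w′ i))))) , Pos-⊕ L η χ p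

module _ {k : ℕ} where
  Mixed : VRel k → VRel k → ℕ → VRel k
  Mixed A₀ A zero    x y = Star A₀ x y
  Mixed A₀ A (suc v) x y = Star A₀ x y ⊎ (Star A₀ ⨾ A ⨾ Mixed A₀ A v) x y

  mixed-◅ : ∀ {A₀ A} v {x u y} → A₀ x u → Mixed A₀ A v u y → Mixed A₀ A v x y
  mixed-◅ zero    a m                          = a ◅ m
  mixed-◅ (suc v) a (inj₁ s)                   = inj₁ (a ◅ s)
  mixed-◅ (suc v) a (inj₂ (_ , s , _ , b , m)) = inj₂ (_ , a ◅ s , _ , b , m)

  mixed-ε : ∀ {A₀ A} v {x} → Mixed A₀ A v x x
  mixed-ε zero    = ε
  mixed-ε (suc v) = inj₁ ε

  mixed-cover : ∀ {A₀ A R} → RelCover k (Star A₀) (Star R) → RelCover k A R → ∀ v → RelCover k (Mixed A₀ A v) (Star R)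
  mixed-cover c₀ c zero    = c₀
  mixed-cover c₀ c (suc v) = union c₀ (weaken (compose c₀ (compose c (mixed-cover c₀ c v))) (λ _ m → m)
    (λ { _ (_ , s , _ , r , s′) → s ◅◅ (r ◅ s′) }))

  -- A step outside the smaller list has weight at least 1 and weights add up, so `v` unrestricted
  -- steps suffice.
  run⇒mixed : ∀ (L : List (Edge k)) {η} (red : Reduction L η) → ∀ {x χ y} → Run L x χ y → ∀ v → fun (Reduction.weight red) χ ≤ v →
              Mixed (EdgeStep inn (Reduction.smaller red)) (EdgeStep inn L) v x y
  run⇒mixed L red nil v _ = mixed-ε v
  run⇒mixed L red (cons {x} {χ} {u} {χ′} {y} f r) v le with fun weight χ in eq | ≤-trans (≤-reflexive (sym weight-+)) le
    where
    open Reduction red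
    weight-+ : fun weight (CMon._⊕_ (Ch L) χ χ′) ≡ fun weight χ + fun weight χ′
    weight-+ = trans (aff weight χ χ′) (cong (fun weight χ +_)
      (trans (cong (_+ lin weight χ′) (sym weight-ε)) (sym (fun-0 weight χ′))))
  ... | zero  | le′ = mixed-◅ v (Reduction.stay red χ _ _ f eq) (run⇒mixed L red r v le′)
  run⇒mixed L red (cons {χ = χ} f r) (suc v) le | suc n | s≤s le′ =
    inj₂ (_ , ε , _ , (χ , f) , run⇒mixed L red r v (≤-trans (m≤n+m _ n) le′))

-- Closure in dimension `pred k` is requested together with a coordinate; there is none when `k` is
-- 0, so the induction on the dimension has no separate base case.
module StarOf {k : ℕ} (closed : Fin k → StarClosed (pred k)) {R : VRel k} (R-mono : Monotone R) where

  Conclusion : List (Edge k) → Set₁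
  Conclusion L = RelCover k (Star (EdgeStep inn L)) (Star R)

  module Inductive (L : List (Edge k)) (sound : ∀ x y → EdgeStep out L x y → R x y)
                   (IH : ∀ L′ → L′ ⊏ L → (∀ x y → EdgeStep out L′ x y → EdgeStep out L x y) → Conclusion L′) where

    X : CMon
    X = V k ⊗ (V k ⊗ Ch L)

    xA yA : Aff X (V k)
    xA = mkAff proj₁ proj₁ (λ _ _ → refl)
    yA = mkAff (proj₁ ∘ proj₂) (proj₁ ∘ proj₂) (λ _ _ → refl)
    χA : Aff X (Ch L)
    χA = mkAff (proj₂ ∘ proj₂) (proj₂ ∘ proj₂) (λ _ _ → refl)
    xyA : Aff X (V k ⊗ V k)
    xyA = mkAff (λ (x , y , _) → x , y) (λ (x , y , _) → x , y) (λ _ _ → refl)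

    plus : Aff X (V k) → Aff X (V k) → Aff X (V k)
    plus f g = mkAff (λ s → fun f s +v fun g s) (λ s → lin f s +v lin g s)
      (λ s v → trans (cong₂ _+v_ (aff f s v) (aff g s v)) (CMon.interchange (V k) _ _ _ _))

    leftA rightA : Aff X (V k)
    leftA  = plus xA (flow tgt L ∘A χA)
    rightA = plus yA (flow src L ∘A χA)

    -- Pumping keeps the ends under control but changes the uses of the edges freely, so the upper
    -- set speaks of the ends, while the lower set records the characteristic vector of the run.
    𝒜 ℬ : ∣ X ∣ → Set
    𝒜 (x , y , χ) = Run L x χ y
    ℬ (x , y , χ) = Star R x y

    -- The invariant of the recursion. By `lin-unique` the directions of such a parametrisation
    -- satisfy the homogeneous state equation, which is what makes them available for pumping.
    Solves : ∀ {n} → Aff (V n) X → Set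
    Solves g = ∀ z → fun leftA (fun g z) ≡ fun rightA (fun g z)

    shifted⊆R : ∀ {x y} → Shifted L x y → R x y
    shifted⊆R (t , x , y , s , refl , refl) = R-mono t (sound _ _ s)

    steps : RelCover k (EdgeStep inn L) (Shifted L)
    steps = step-cover L

    module Fwd = KarpMiller (EdgeStep inn L) (Shifted L) (shifted-mono L) steps
    module Bwd = KarpMiller (Flip (EdgeStep inn L)) (Flip (Shifted L)) (λ t → shifted-mono L t) (flip-cover steps)

    along : ∀ {n} (g : Aff (V n) X) {A : VRel k} → RelCover k A (Star R) → (∀ z → 𝒜 (fun g z) → A (fun (xA ∘A g) z) (fun (yA ∘A g) z)) →
            Cover (V n) (𝒜 ∘ fun g) (ℬ ∘ fun g)
    along g c to = weaken (preimage c (solve-VV k) (xyA ∘A g)) to (λ _ b → b)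

    lows : ∀ K → RelCover k (λ x y → ∃ λ i → lookup x i ≤ K × Star (Low (EdgeStep inn L) i K) x y) (Star R)
    lows K = ⋃Fin λ i → low-cover i K (closed i) R-mono (weaken steps (λ _ a → a) (λ _ → shifted⊆R))

    reduced : ∀ {n} (g : Aff (V n) X) → Reduction L (lin (χA ∘A g) 𝟙) → Cover (V n) (𝒜 ∘ fun g) (ℬ ∘ fun g)
    reduced g red = along g
      (mixed-cover (IH smaller smaller-⊏ sound′) (weaken steps (λ _ a → a) (λ _ → shifted⊆R)) (fun (weight ∘A χA ∘A g) 𝟘))
      (λ z r → run⇒mixed L red r _ (≤-reflexive (lin-zero⇒const (weight ∘A χA ∘A g) weight-η z)))
      where open Reduction red renaming (sound to sound′)

    low-forward : ∀ {n} (g : Aff (V n) X) K → Fwd.Bounded (support (lin (xA ∘A g) 𝟙)) (fun (xA ∘A g) 𝟘) K → Cover (V n) (𝒜 ∘ fun g) (ℬ ∘ fun g)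
    low-forward g K bd = along g (lows K) λ z r →
      case bd _ _ (support-agree (xA ∘A g) z) (run⇒star L r) of λ (i , _ , le , s) → i , le , s

    low-backward : ∀ {n} (g : Aff (V n) X) K → Bwd.Bounded (support (lin (yA ∘A g) 𝟙)) (fun (yA ∘A g) 𝟘) K → Cover (V n) (𝒜 ∘ fun g) (ℬ ∘ fun g)
    low-backward g K bd = along g (lows K) λ z r →
      case bd _ _ (support-agree (yA ∘A g) z) (unreverse-star (run⇒star L r)) of λ (i , _ , le , s) → i , ends-low i le s , reverse-star (Star.map (λ (a , p , q) → a , q , p) s)
      where
      ends-low : ∀ i {x y} → lookup x i ≤ K → Star (Low (Flip (EdgeStep inn L)) i K) x y → lookup y i ≤ K
      ends-low i le ε                 = le
      ends-low i le ((_ , _ , q) ◅ s) = ends-low i q s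

    perfect : ∀ {n} (g : Aff (V n) X) → Solves g → Pos L (lin (χA ∘A g) 𝟙) →
              Fwd.CapAll (support (lin (xA ∘A g) 𝟙)) (fun (xA ∘A g) 𝟘) →
              Bwd.CapAll (support (lin (yA ∘A g) 𝟙)) (fun (yA ∘A g) 𝟘) → Pumpable (ℬ ∘ fun g)
    perfect g solves pos cf cb z h with pumping L {χ₀ = fun (χA ∘A g) z} {χₕ = lin (χA ∘A g) (𝟙 +v h)}
        (solves z) (lin-unique (leftA ∘A g) (rightA ∘A g) solves (𝟙 +v h))
        (subst (Pos L) (sym (lin-⊕ (χA ∘A g) 𝟙 h)) (Pos-⊕ L _ _ pos))
        (PumpingRun.run U) (reverse-star (PumpingRun.run W)) (proj₂ (PumpingRun.start U z)) (proj₂ (PumpingRun.start W z))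
        (PumpingRun.positive U h) (PumpingRun.positive W h)
      where
      U = pumping-run (xA ∘A g) cf
      W = pumping-run (yA ∘A g) cb
    ... | N , run = N , λ j → Star.map shifted⊆R (subst₂ (Star (Shifted L)) (sym (along-ray (xA ∘A g) j)) (sym (along-ray (yA ∘A g) j)) (run j))
      where
      along-ray : ∀ (f : Aff (V _) (V k)) j → fun f (z +v (suc j * suc N) · (𝟙 +v h)) ≡ fun f z +v (suc j * suc N) · lin f (𝟙 +v h)
      along-ray f j = trans (aff f z _) (cong (fun f z +v_) (lin-mul f (suc j * suc N) _))

    decide : ∀ {n} (g : Aff (V n) X) → Solves g → Cover (V n) (𝒜 ∘ fun g) (ℬ ∘ fun g) ⊎ Pumpable (ℬ ∘ fun g)
    decide g solves with positive-or-reducible L (lin (χA ∘A g) 𝟙)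
    ... | inj₂ red = inj₁ (reduced g red)
    ... | inj₁ pos with Fwd.dichotomy (support (lin (xA ∘A g) 𝟙)) (fun (xA ∘A g) 𝟘)
    ... | inj₂ (K , bd) = inj₁ (low-forward g K bd)
    ... | inj₁ cf with Bwd.dichotomy (support (lin (yA ∘A g) 𝟙)) (fun (yA ∘A g) 𝟘)
    ... | inj₂ (K , bd) = inj₁ (low-backward g K bd)
    ... | inj₁ cb = inj₂ (perfect g solves pos cf cb)

    conclusion : Conclusion L
    conclusion = map-image
      (Sol-cover {A = 𝒜 ∘ fun p} {B = ℬ ∘ fun p} (solve-V k (leftA ∘A p) (rightA ∘A p))
        λ u solves → cover-by-pumping 𝒜 ℬ Solves (λ g v s z → s (fun v z)) decide _ (p ∘A u) solves)
      (xyA ∘A p)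
      (λ (x , y) s → case star⇒run L s of λ (χ , r) → case onto P (x , y , χ) of λ (w , eq) →
        w , (subst 𝒜 (sym eq) r , subst (λ s → fun leftA s ≡ fun rightA s) (sym eq) (run-balance L r)) , cong (fun xyA) eq)
      (λ w → proj₁)
      where
      P = param-⊗ (param-V k) (param-⊗ (param-V k) (param-Ch L))
      p = par P

  star-edges : ∀ L → Acc _⊏_ L → (∀ x y → EdgeStep out L x y → R x y) → Conclusion L
  star-edges L (acc rs) sound = Inductive.conclusion L sound
    λ L′ lt sub → star-edges L′ (rs lt) (λ x y → sound x y ∘ sub x y)

star-closed : ∀ k → StarClosed k
star-closed k {A} {B} mono c = weaken
  (StarOf.star-edges (closed k) mono L (⊏-wellFounded L)
    (λ x y s → case edges-sound c idA s of λ { (_ , b , refl) → b }))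
  (λ _ → Star.map (λ a → edges-complete c idA a refl)) (λ _ b → b)
  where
  L = edgesOf c idA
  closed : ∀ k → Fin k → StarClosed (pred k)
  closed (suc k) _ = star-closed k

-- VASS with one zero-test

⋃Any : ∀ {S} {X : Set} {A B : X → ∣ S ∣ → Set} → (∀ t → Cover S (A t) (B t)) → ∀ ts →
       Cover S (λ s → Any (λ t → A t s) ts) (λ s → Any (λ t → B t s) ts)
⋃Any c []       = none λ { _ () }
⋃Any c (t ∷ ts) = weaken (union (weaken (c t) (λ _ a → a) (λ _ → here)) (weaken (⋃Any c ts) (λ _ a → a) (λ _ → there)))
  (λ { _ (here a) → inj₁ a ; _ (there as) → inj₂ as }) (λ _ b → b)

intersect : ∀ {k A B A′ B′} → RelCover k A B → RelCover k A′ B′ →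
            RelCover k (λ x y → A x y × A′ x y) (λ x y → B x y × B′ x y)
intersect {k} c c′ = weaken (join c c′ (solve-VV k) idA idA (fstA {V k ⊗ V k} {V k ⊗ V k}))
  (λ p (a , a′) → p , p , a , a′ , refl , refl) (λ { p (_ , _ , b , b′ , refl , refl) → b , b′ })

≤-cover : ∀ {k} → RelCover k _≤v_ _≤v_
≤-cover {k} = affine-cover
  (mkAff (λ w → Vec.take k w , Vec.drop k w +v Vec.take k w) (λ w → Vec.take k w , Vec.drop k w +v Vec.take k w)
    (λ w v → cong₂ _,_ (aff (takeA k {k}) w v) (trans (cong₂ _+v_ (aff (dropA k {k}) w v) (aff (takeA k {k}) w v)) (CMon.interchange (V k) _ _ _ _))))
  (λ (x , y) le → (x Vec.++ (y ∸v x)) , cong₂ _,_ (take-++ x _)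
    (trans (cong₂ _+v_ (drop-++ x (y ∸v x)) (take-++ x _)) (trans (CMon.comm (V k) _ x) (x+[y∸x] x y le))))
  (λ w i → ≤-trans (m≤n+m _ _) (≤-reflexive (sym (lookup-+v (Vec.drop k w) (Vec.take k w) i))))

inhabited-dec : ∀ {k A} → RelCover k A A → Dec (∃ λ x → ∃ λ y → A x y)
inhabited-dec c with inhabited? c
... | inj₁ ((x , y) , a) = yes (x , y , a)
... | inj₂ empty        = no λ (x , y , a) → empty (x , y) a

-- A shift by `z` relates exactly the pairs `loss z + n` and `gain z + n`; this removes the integers
-- and gives an affine parametrisation.
gain loss : ℤ → ℕ
gain (⁺ n)      = n
gain (-[1+ n ]) = 0
loss (⁺ n)      = 0
loss (-[1+ n ]) = suc n

IntShift : ℤ → ℕ → ℕ → Set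
IntShift z x y = ⁺ y ≡ ⁺ x ℤ.+ z

shift-sound : ∀ z n → IntShift z (loss z + n) (gain z + n)
shift-sound (⁺ m)      n = trans (ℤₚ.pos-+ m n) (ℤₚ.+-comm (⁺ m) (⁺ n))
shift-sound (-[1+ m ]) n = sym (trans (ℤₚ.⊖-≥ {suc m + n} {suc m} (m≤m+n (suc m) n)) (cong ⁺_ (m+n∸m≡n (suc m) n)))

shift-complete : ∀ z x y → IntShift z x y → ∃ λ n → loss z + n ≡ x × gain z + n ≡ y
shift-complete (⁺ m)      x y eq = x , refl , trans (+-comm m x) (sym (ℤₚ.+-injective (trans eq (sym (ℤₚ.pos-+ x m)))))
shift-complete (-[1+ m ]) x y eq = y , sym (ℤₚ.+-injective (begin
    ⁺ x                                ≡⟨ ℤₚ.+-identityʳ (⁺ x) ⟨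
    ⁺ x ℤ.+ ⁺ 0                        ≡⟨ cong (λ j → ⁺ x ℤ.+ j) (ℤₚ.+-inverseˡ (⁺ suc m)) ⟨
    ⁺ x ℤ.+ (-[1+ m ] ℤ.+ ⁺ suc m)     ≡⟨ ℤₚ.+-assoc (⁺ x) -[1+ m ] (⁺ suc m) ⟨
    ⁺ x ℤ.+ -[1+ m ] ℤ.+ ⁺ suc m       ≡⟨ cong (λ j → j ℤ.+ ⁺ suc m) eq ⟨
    ⁺ y ℤ.+ ⁺ suc m                    ≡⟨ ℤₚ.+-comm (⁺ y) (⁺ suc m) ⟩
    ⁺ suc m ℤ.+ ⁺ y                    ∎)) , refl
  where open ≡-Reasoning

IntShifts : ∀ {k} → Vec ℤ k → VRel k
IntShifts δ x y = ∀ i → IntShift (lookup δ i) (lookup x i) (lookup y i)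

shift-cover : ∀ {k} (δ : Vec ℤ k) → RelCover k (IntShifts δ) (IntShifts δ)
shift-cover {k} δ = affine-cover
  (mkAff (λ w → l +v w , g +v w) (λ w → w , w) (λ w v → cong₂ _,_ (sym (CMon.assoc (V k) l w v)) (sym (CMon.assoc (V k) g w v))))
  (λ (x , y) s → let n = λ i → shift-complete (lookup δ i) (lookup x i) (lookup y i) (s i) in
    Vec.tabulate (proj₁ ∘ n) ,
    cong₂ _,_ (vec-ext λ i → trans (value loss (proj₁ ∘ n) i) (proj₁ (proj₂ (n i))))
              (vec-ext λ i → trans (value gain (proj₁ ∘ n) i) (proj₂ (proj₂ (n i)))))
  (λ w i → subst₂ (IntShift (lookup δ i)) (sym (at-i loss w i)) (sym (at-i gain w i)) (shift-sound (lookup δ i) (lookup w i)))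
  where
  l = Vec.map loss δ
  g = Vec.map gain δ
  at-i : ∀ f w i → lookup (Vec.map f δ +v w) i ≡ f (lookup δ i) + lookup w i
  at-i f w i = trans (lookup-+v (Vec.map f δ) w i) (cong (_+ lookup w i) (lookup-map i f δ))
  value : ∀ f n i → lookup (Vec.map f δ +v Vec.tabulate n) i ≡ f (lookup δ i) + n i
  value f n i = trans (at-i f (Vec.tabulate n) i) (cong (f (lookup δ i) +_) (lookup∘tabulate n i))

shift-monotone : ∀ {k} (δ : Vec ℤ k) → Monotone (IntShifts δ)
shift-monotone δ t {x} {y} s i = begin
  ⁺ lookup (t +v y) i                        ≡⟨ cong ⁺_ (lookup-+v t y i) ⟩
  ⁺ (lookup t i + lookup y i)                ≡⟨ ℤₚ.pos-+ (lookup t i) _ ⟩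
  ⁺ lookup t i ℤ.+ ⁺ lookup y i              ≡⟨ cong (λ j → ⁺ lookup t i ℤ.+ j) (s i) ⟩
  ⁺ lookup t i ℤ.+ (⁺ lookup x i ℤ.+ lookup δ i) ≡⟨ ℤₚ.+-assoc (⁺ lookup t i) (⁺ lookup x i) (lookup δ i) ⟨
  ⁺ lookup t i ℤ.+ ⁺ lookup x i ℤ.+ lookup δ i   ≡⟨ cong (λ j → j ℤ.+ lookup δ i) (ℤₚ.pos-+ (lookup t i) _) ⟨
  ⁺ (lookup t i + lookup x i) ℤ.+ lookup δ i     ≡⟨ cong (λ n → ⁺ n ℤ.+ lookup δ i) (lookup-+v t x i) ⟨
  ⁺ lookup (t +v x) i ℤ.+ lookup δ i             ∎
  where open ≡-Reasoning

-- Distinct unit vectors are incomparable, so control states encoded in this way let Dickson's order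
-- compare configurations at equal states only.
at-injective : ∀ {n} (r r′ : Fin n) → at r 1 ≤v at r′ 1 → r ≡ r′
at-injective zero    zero     _  = refl
at-injective zero    (suc r′) le = contradiction (le zero) λ ()
at-injective (suc r) zero     le = contradiction (≤-trans (one r) (≤-trans (le (suc r)) (≤-reflexive (lookup-𝟘 r)))) λ ()
  where
  one : ∀ {n} (r : Fin n) → 1 ≤ lookup (at r 1) r
  one zero    = s≤s z≤n
  one (suc r) = one r
at-injective (suc r) (suc r′) le = cong suc (at-injective r r′ (le ∘ suc))

++-≤v : ∀ {m n} (x x′ : Vec ℕ m) {y y′ : Vec ℕ n} → x Vec.++ y ≤v x′ Vec.++ y′ → x ≤v x′ × y ≤v y′
++-≤v []      []        le = (λ ()) , le
++-≤v (a ∷ x) (a′ ∷ x′) le with ++-≤v x x′ (le ∘ suc)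
... | p , q = (λ { zero → le zero ; (suc i) → p i }) , q

module Reachability {d : ℕ} (V′ : VASSZ (suc d)) where

  k = suc d
  Q = St V′

  Letter Zero Any-step : Q → Q → VRel k
  Letter p q x y   = ∃ λ a → Step V′ (p , x) (letter a) (q , y)
  Zero p q x y     = Step V′ (p , x) zt (q , y)
  Any-step p q x y = ∃ λ a → Step V′ (p , x) a (q , y)

  letter-mono : ∀ p q → Monotone (Letter p q)
  letter-mono p q t (a , stepA .a t∈ s) = a , stepA a t∈ (shift-monotone (δ V′ (letter a)) t s)

  any-mono : ∀ t → lookup t zero ≡ 0 → ∀ {p q x y} → Any-step p q x y → Any-step p q (t +v x) (t +v y)
  any-mono t z (.(letter a) , stepA a t∈ s) = letter a , stepA a t∈ (shift-monotone (δ V′ (letter a)) t s)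
  any-mono t z {x = x} (.zt , stepZ t∈ s e) = zt , stepZ t∈ (shift-monotone (δ V′ zt) t s) (trans (lookup-+v t x zero) (cong₂ _+_ z e))

  Transition : Set
  Transition = Q × Label (nA V′) × Q

  letter-cover : ∀ p q → RelCover k (Letter p q) (Letter p q)
  letter-cover p q = weaken (⋃Any {A = By} {B = By} each (T V′))
    (λ { _ (a , stepA .a t∈ s) → lose t∈ (a , refl , s) })
    (λ _ as → case find as of λ { (_ , t∈ , a , refl , s) → a , stepA a t∈ s })
    where
    By : Transition → Vec ℕ k × Vec ℕ k → Set
    By t (x , y) = ∃ λ a → t ≡ (p , letter a , q) × IntShifts (δ V′ (letter a)) x y
    each : ∀ t → Cover (V k ⊗ V k) (By t) (By t)
    each (p′ , zt , q′)       = none λ { _ (_ , () , _) }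
    each (p′ , letter a , q′) with p′ Fin.≟ p | q′ Fin.≟ q
    ... | yes refl | yes refl = weaken (shift-cover (δ V′ (letter a))) (λ { _ (_ , refl , s) → s }) (λ _ s → a , refl , s)
    ... | yes _    | no ne    = none λ { _ (_ , refl , _) → ne refl }
    ... | no ne    | _        = none λ { _ (_ , refl , _) → ne refl }

  zero-cover : ∀ p q → RelCover k (Zero p q) (Zero p q)
  zero-cover p q = weaken
    (restrict (⋃Any {A = By} {B = By} each (T V′)) solve-Nat (lookupA zero ∘A fstA {V k} {V k}) 0)
    (λ { _ (stepZ t∈ s e) → lose t∈ (refl , s) , e })
    (λ { _ (as , e) → case find as of λ { (_ , t∈ , refl , s) → stepZ t∈ s e } })
    where
    By : Transition → Vec ℕ k × Vec ℕ k → Set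
    By t (x , y) = t ≡ (p , zt , q) × IntShifts (δ V′ zt) x y
    each : ∀ t → Cover (V k ⊗ V k) (By t) (By t)
    each (p′ , letter a , q′) = none λ { _ (() , _) }
    each (p′ , zt , q′) with p′ Fin.≟ p | q′ Fin.≟ q
    ... | yes refl | yes refl = weaken (shift-cover (δ V′ zt)) (λ _ → proj₂) (λ _ s → refl , s)
    ... | yes _    | no ne    = none λ { _ (refl , _) → ne refl }
    ... | no ne    | _        = none λ { _ (refl , _) → ne refl }

  any-cover : ∀ p q → RelCover k (Any-step p q) (Any-step p q)
  any-cover p q = weaken
    (union (weaken (letter-cover p q) (λ _ a → a) (λ { _ (a , s) → letter a , s }))
           (weaken (zero-cover p q) (λ _ a → a) (λ _ s → zt , s)))
    (λ { _ (letter a , s) → inj₁ (a , s) ; _ (zt , s) → inj₂ s }) (λ _ b → b)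

  Letters Reach : Q → Q → VRel k
  Letters p q x y = Star (GStep Letter) (p , x) (q , y)
  Reach p q x y   = Star (GStep Any-step) (p , x) (q , y)

  letters⇒reach : ∀ {c c′} → Star (GStep Letter) c c′ → Star (GStep Any-step) c c′
  letters⇒reach = Star.map λ (a , s) → letter a , s

  graph-mono : ∀ {n j} {R : GraphRel n j} → (∀ p q → Monotone (R p q)) → ∀ t {p q x y} →
               Star (GStep R) (p , x) (q , y) → Star (GStep R) (p , t +v x) (q , t +v y)
  graph-mono m t s = Star.gmap (λ (p , x) → p , t +v x) (λ {(p , _)} {(q , _)} r → m p q t r) s

  letters-cover : ∀ p q → RelCover k (Letters p q) (Letters p q)
  letters-cover = graph-cover (star-closed k) Letter Letter letter-mono letter-cover

  Round : GraphRel (suc (nQ V′)) d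
  Round r r′ x y = ∃ λ q → (Zero r q ⨾ Letters q r′) (0 ∷ x) (0 ∷ y)

  zeroA : Aff (V d ⊗ V d) (V k ⊗ V k)
  zeroA = mkAff (λ (x , y) → (0 ∷ x) , (0 ∷ y)) (λ (x , y) → (0 ∷ x) , (0 ∷ y)) (λ _ _ → refl)

  round-cover : ∀ r r′ → RelCover d (Round r r′) (Round r r′)
  round-cover r r′ = weaken
    (pullback (⋃Fin λ q → weaken (compose (zero-cover r q) (letters-cover q r′)) (λ _ a → a) (λ _ b → q , b)) (solve-VV k) (param-VV d) zeroA)
    (λ _ a → a) (λ _ b → b)

  round-mono : ∀ r r′ → Monotone (Round r r′)
  round-mono r r′ t {x} (q , u , stepZ t∈ s e , ls) =
    q , (0 ∷ t) +v u , stepZ t∈ (shift-monotone (δ V′ zt) (0 ∷ t) {0 ∷ x} {u} s) e , graph-mono letter-mono (0 ∷ t) ls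

  Rounds : Q → Q → VRel d
  Rounds r r′ x y = Star (GStep Round) (r , x) (r′ , y)

  AtZero : VRel d → VRel k
  AtZero A x y = ∃ λ x′ → ∃ λ y′ → A x′ y′ × (0 ∷ x′) ≡ x × (0 ∷ y′) ≡ y

  at-zero-cover : ∀ {A} → RelCover d A A → RelCover k (AtZero A) (AtZero A)
  at-zero-cover c = map-image c zeroA (λ { _ (x , y , a , refl , refl) → (x , y) , a , refl })
    (λ (x , y) a → x , y , a , refl , refl)

  -- The last zero-test stands apart from the rounds because the letters after it need not return to
  -- first coordinate 0.
  WithZeros : Q → Q → Q → Q → Q → VRel k
  WithZeros p q r r′ s = Letters p r ⨾ AtZero (Rounds r r′) ⨾ Zero r′ s ⨾ Letters s q

  Normal : Q → Q → VRel k
  Normal p q x y = Letters p q x y ⊎ (∃ λ r → ∃ λ r′ → ∃ λ s → WithZeros p q r r′ s x y)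

  normal-cover : ∀ p q → RelCover k (Normal p q) (Normal p q)
  normal-cover p q = union (weaken (letters-cover p q) (λ _ a → a) (λ _ → inj₁))
    (⋃Fin λ r → ⋃Fin λ r′ → ⋃Fin λ s → weaken
      (compose (letters-cover p r) (compose (at-zero-cover (graph-cover (star-closed d) Round Round round-mono round-cover r r′))
        (compose (zero-cover r′ s) (letters-cover s q))))
      (λ _ a → a) (λ _ b → inj₂ (r , r′ , s , b)))

  normalize : ∀ {p q x y} → Reach p q x y → Normal p q x y
  normalize ε = inj₁ ε
  normalize ((letter a , s) ◅ rest) with normalize rest
  ... | inj₁ ls                              = inj₁ ((a , s) ◅ ls)
  ... | inj₂ (r , r′ , s′ , u , ls , others) = inj₂ (r , r′ , s′ , u , (a , s) ◅ ls , others)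
  normalize {p} ((zt , z@(stepZ {q = q} {x = zero ∷ x} {y = y} t∈ sh refl)) ◅ rest) with normalize rest
  ... | inj₁ ls = inj₂ (p , p , q , (0 ∷ x) , ε , (0 ∷ x) , (x , x , ε , refl , refl) , y , z , ls)
  -- The initial letters of the rest end with first coordinate 0 and so complete the round opened by
  -- this zero-test.
  ... | inj₂ (r , r′ , s , _ , ls , _ , (x₁ , y₁ , rounds , refl , refl) , others) =
    inj₂ (p , r′ , s , (0 ∷ x) , ε , (0 ∷ y₁) , (x , y₁ , (q , y , z , ls) ◅ rounds , refl , refl) , others)

  rounds⇒reach : ∀ {r r′ x y} → Rounds r r′ x y → Reach r r′ (0 ∷ x) (0 ∷ y)
  rounds⇒reach ε                        = ε
  rounds⇒reach ((q , u , z , ls) ◅ rs) = (zt , z) ◅ letters⇒reach ls ◅◅ rounds⇒reach rs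

  normal⇒reach : ∀ {p q x y} → Normal p q x y → Reach p q x y
  normal⇒reach (inj₁ ls) = letters⇒reach ls
  normal⇒reach (inj₂ (r , r′ , s , _ , ls , _ , (_ , _ , rounds , refl , refl) , _ , z , ls′)) =
    letters⇒reach ls ◅◅ rounds⇒reach rounds ◅◅ ((zt , z) ◅ letters⇒reach ls′)

  reach-cover : ∀ p q → RelCover k (Reach p q) (Reach p q)
  reach-cover p q = weaken (normal-cover p q) (λ _ → normalize) (λ _ → normal⇒reach)

  Letters⁺ Reach⁺ : Q → Q → VRel k
  Letters⁺ p q x y = ∃ λ r → (Letter p r ⨾ Letters r q) x y
  Reach⁺ p q x y   = ∃ λ r → (Any-step p r ⨾ Reach r q) x y

  letters⁺-cover : ∀ p q → RelCover k (Letters⁺ p q) (Letters⁺ p q)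
  letters⁺-cover p q = ⋃Fin λ r → weaken (compose (letter-cover p r) (letters-cover r q)) (λ _ a → a) (λ _ b → r , b)

  reach⁺-cover : ∀ p q → RelCover k (Reach⁺ p q) (Reach⁺ p q)
  reach⁺-cover p q = ⋃Fin λ r → weaken (compose (any-cover p r) (reach-cover r q)) (λ _ a → a) (λ _ b → r , b)

  reach⇒ : ∀ {c c′} → Star (GStep Any-step) c c′ → Reach* V′ c c′
  reach⇒ ε              = done
  reach⇒ ((a , s) ◅ r) = more a s (reach⇒ r)

  reach⇐ : ∀ {c c′} → Reach* V′ c c′ → Star (GStep Any-step) c c′
  reach⇐ done         = ε
  reach⇐ (more a s r) = (a , s) ◅ reach⇐ r

  reach⁺⇒ : ∀ {p q x y} → Reach⁺ p q x y → Reach+ V′ (p , x) (q , y)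
  reach⁺⇒ (r , u , (a , s) , rest) = more a s (reach⇒ rest)

  infixr 5 _++⁺_ _⁺++_
  _++⁺_ : ∀ {p q r x y z} → Reach p q x y → Reach⁺ q r y z → Reach⁺ p r x z
  ε              ++⁺ s                  = s
  (_◅_ {j = r , u} a rs) ++⁺ (_ , _ , b , bs) = r , u , a , rs ◅◅ (b ◅ bs)

  _⁺++_ : ∀ {p q r x y z} → Reach⁺ p q x y → Reach q r y z → Reach⁺ p r x z
  (r , u , a , as) ⁺++ bs = r , u , a , as ◅◅ bs

  letters⁺⇒reach⁺ : ∀ {p q x y} → Letters⁺ p q x y → Reach⁺ p q x y
  letters⁺⇒reach⁺ (r , u , (a , s) , ls) = r , u , (letter a , s) , letters⇒reach ls

  letters⁺-mono : ∀ t {p q x y} → Letters⁺ p q x y → Letters⁺ p q (t +v x) (t +v y)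
  letters⁺-mono t (r , u , l , ls) = r , t +v u , letter-mono _ _ t l , graph-mono letter-mono t ls

  reach-mono : ∀ t → lookup t zero ≡ 0 → ∀ {p q x y} → Reach p q x y → Reach p q (t +v x) (t +v y)
  reach-mono t z = Star.gmap (λ (p , x) → p , t +v x) (any-mono t z)

  reach⁺-mono : ∀ t → lookup t zero ≡ 0 → ∀ {p q x y} → Reach⁺ p q x y → Reach⁺ p q (t +v x) (t +v y)
  reach⁺-mono t z (r , u , a , rs) = r , t +v u , any-mono t z a , reach-mono t z rs

  -- Repeated reachability of a control state

  module Repeated (qf : Q) where

    Initial : Q → VRel k
    Initial p x y = Reach (qin V′) p (xin V′) x

    initial-cover : ∀ p → RelCover k (Initial p) (Initial p)
    initial-cover p = pullback (reach-cover (qin V′) p) (solve-VV k) (param-VV k)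
      (mkAff (λ (x , _) → xin V′ , x) (λ (x , _) → 𝟘 , x) (λ _ _ → cong₂ _,_ (sym (CMon.idʳ (V k) (xin V′))) refl))

    LetterCycle : VRel k
    LetterCycle x y = Initial qf x y × Letters⁺ qf qf x y × x ≤v y

    Cycle : Q → VRel k
    Cycle r x y = (Initial r x y × (Reach⁺ r qf ⨾ Reach qf r) x y × x ≤v y) × (lookup x zero , lookup y zero) ≡ (0 , 0)

    Witness : Set
    Witness = (∃ λ x → ∃ λ y → LetterCycle x y) ⊎ (∃ λ x → ∃ λ y → ∃ λ r → Cycle r x y)

    witness? : Dec Witness
    witness? = letter-cycle? ⊎-dec cycle?
      where
      letter-cycle? : Dec (∃ λ x → ∃ λ y → LetterCycle x y)
      letter-cycle? = inhabited-dec (intersect (initial-cover qf) (intersect (letters⁺-cover qf qf) ≤-cover))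
      cycle-cover : ∀ r → RelCover k (Cycle r) (Cycle r)
      cycle-cover r = restrict (intersect (initial-cover r) (intersect (compose (reach⁺-cover r qf) (reach-cover qf r)) ≤-cover))
        (solve-⊗ {Nat} {Nat} solve-Nat solve-Nat) (pairA {V k} {V k} (lookupA zero) (lookupA zero)) (0 , 0)
      cycle? : Dec (∃ λ x → ∃ λ y → ∃ λ r → Cycle r x y)
      cycle? = inhabited-dec (⋃Fin λ r → weaken (cycle-cover r) (λ _ c → c) (λ _ c → r , c))

    iterate : ∀ {x y t} → (∀ j → Reach⁺ qf qf (j · t +v x) (j · t +v y)) → y ≡ t +v x → Reach (qin V′) qf (xin V′) x →
              VisitedInfinitelyOften V′ qf
    iterate {x} {y} {t} run refl init = (λ j → j · t +v x) ,
      subst (λ z → Reach* V′ _ (qf , z)) (sym (CMon.idˡ (V k) x)) (reach⇒ init) ,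
      λ j → subst (λ z → Reach+ V′ (qf , j · t +v x) (qf , z))
        (trans (sym (CMon.assoc (V k) (j · t) t x)) (cong (_+v x) (CMon.comm (V k) (j · t) t))) (reach⁺⇒ (run j))

    difference : ∀ {x y : Vec ℕ k} → x ≤v y → y ≡ (y ∸v x) +v x
    difference {x} {y} le = trans (sym (x+[y∸x] x y le)) (CMon.comm (V k) x _)

    witness⇒visited : Witness → VisitedInfinitelyOften V′ qf
    witness⇒visited (inj₁ (x , y , init , ls , le)) =
      iterate (λ j → letters⁺⇒reach⁺ (letters⁺-mono (j · (y ∸v x)) ls)) (difference le) init
    witness⇒visited (inj₂ (x , y , r , (init , (u , r⁺ , rs) , le) , z)) =
      iterate (λ j → reach⁺-mono (j · t) (trans (lookup-· j t zero) (trans (cong (j *_) t₀) (*-zeroʳ j))) loop) refl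
        (init ◅◅ reach⁺⇒star r⁺)
      where
      t = y ∸v x
      t₀ : lookup t zero ≡ 0
      t₀ = trans (lookup-zipWith _∸_ zero y x) (cong₂ _∸_ (cong proj₂ z) (cong proj₁ z))
      -- The cycle is rotated to begin at `qf`: its second half leads to `y`, which is `x`
      -- translated by `t`, and its first half is then run again under the same translation.
      loop : Reach⁺ qf qf u (t +v u)
      loop = rs ++⁺ subst (λ v → Reach⁺ r qf v (t +v u)) (sym (difference le)) (reach⁺-mono t t₀ r⁺)
      reach⁺⇒star : ∀ {p q x y} → Reach⁺ p q x y → Reach p q x y
      reach⁺⇒star (_ , _ , a , as) = a ◅ as

    module Visited (x : ℕ → Vec ℕ k) (init : Reach (qin V′) qf (xin V′) (x 0)) (next : ∀ j → Reach⁺ qf qf (x j) (x (suc j))) where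

      ZeroAt : ℕ → Set
      ZeroAt j = ∃ λ r → ∃ λ z → lookup z zero ≡ 0 × Reach qf r (x j) z × Reach⁺ r qf z (x (suc j))

      split-run : ∀ {p q y z} → Reach p q y z → Letters p q y z ⊎ (∃ λ r → ∃ λ u → lookup u zero ≡ 0 × Reach p r y u × Reach⁺ r q u z)
      split-run ε = inj₁ ε
      split-run ((zt , z@(stepZ _ _ e)) ◅ rest) = inj₂ (_ , _ , e , ε , (_ , _ , (zt , z) , rest))
      split-run ((letter a , s) ◅ rest) with split-run rest
      ... | inj₁ ls                       = inj₁ ((a , s) ◅ ls)
      ... | inj₂ (r , u , e , rs , r⁺) = inj₂ (r , u , e , (letter a , s) ◅ rs , r⁺)

      segment : ∀ j → Letters⁺ qf qf (x j) (x (suc j)) ⊎ ZeroAt j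
      segment j with next j
      ... | r , u , (zt , z@(stepZ _ _ e)) , rest = inj₂ (_ , _ , e , ε , (_ , _ , (zt , z) , rest))
      ... | r , u , (letter a , s) , rest with split-run rest
      ... | inj₁ ls                       = inj₁ (_ , _ , (a , s) , ls)
      ... | inj₂ (r , u , e , rs , r⁺) = inj₂ (r , u , e , (letter a , s) ◅ rs , r⁺)

      path : ∀ i n → Reach qf qf (x i) (x (n + i))
      path i zero    = ε
      path i (suc n) = path i n ◅◅ (case next (n + i) of λ { (_ , _ , a , as) → a ◅ as })

      segments : ∀ i n → Letters⁺ qf qf (x i) (x (suc n + i)) ⊎ (∃ λ l → ZeroAt (l + i))
      segments i zero    = Sum.map₂ (0 ,_) (segment i)
      segments i (suc n) with segments i n | segment (suc n + i)
      ... | inj₂ z                  | _                        = inj₂ z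
      ... | inj₁ _                  | inj₂ z                   = inj₂ (suc n , z)
      ... | inj₁ (r , u , l , ls) | inj₁ (r′ , u′ , l′ , ls′) = inj₁ (r , u , l , ls ◅◅ (l′ ◅ ls′))

      initially : ∀ n → Reach (qin V′) qf (xin V′) (x n)
      initially n = init ◅◅ subst (λ m → Reach qf qf (x 0) (x m)) (+-identityʳ n) (path 0 n)

      -- Dickson's lemma yields two comparable visits from `n` on. If only letters occur between
      -- them they form a letter cycle; otherwise one of the segments passes through first
      -- coordinate 0.
      next-zero : ∀ n → Witness ⊎ (∃ λ l → ZeroAt (l + n))
      next-zero n with AF-sequence (dickson k) (λ i → x (i + n))
      ... | i , j , i<j , le with m≤n⇒∃[o]m+o≡n i<j
      ... | o , refl with segments (i + n) o
      ... | inj₂ (l , z) = inj₂ (l + i , subst ZeroAt (sym (+-assoc l i n)) z)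
      ... | inj₁ ls      = inj₁ (inj₁ (x (i + n) , x (suc (i + o) + n) , initially (i + n) ,
              subst (λ m → Letters⁺ qf qf (x (i + n)) (x m)) (lem o i n) ls , le))
        where
        lem : ∀ o i n → suc o + (i + n) ≡ suc (i + o) + n
        lem = solve-∀

      code : Q → Vec ℕ k → Vec ℕ (suc (nQ V′) + k)
      code r z = at r 1 Vec.++ z

      Seen : ℕ → Vec ℕ (suc (nQ V′) + k) → Set
      Seen n c = ∃ λ r → ∃ λ z → c ≡ code r z × lookup z zero ≡ 0 × Reach (qin V′) r (xin V′) z × Reach⁺ r qf z (x n)

      -- Configurations with first coordinate 0 are collected until one of them lies below a later
      -- one at the same control state. Each is kept with a nonempty run to the visit `x n`, so that
      -- the cycle found passes through `qf`.
      search : ∀ n h → Bar _≤v_ h → ¬ Good _≤v_ h → (∀ {c} → c ∈ h → Seen n c) → Witness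
      search n h (now g)   bad seen = contradiction g bad
      search n h (later f) bad seen with next-zero n
      ... | inj₁ w = w
      ... | inj₂ (l , r , z , z₀ , to , from) with Any.any? (λ c → Finₚ.all? (λ i → lookup c i ≤? lookup (code r z) i)) h
      ... | yes dominated with find dominated
      ... | c , c∈ , c≤ with seen c∈
      ... | r′ , z′ , refl , z′₀ , start , loop with at-injective r′ r (proj₁ (++-≤v (at r′ 1) (at r 1) c≤))
      ... | refl = inj₂ (z′ , z , r , (start , (x (l + n) , loop ⁺++ path n l , to) , proj₂ (++-≤v (at r 1) (at r 1) c≤)) , cong₂ _,_ z′₀ z₀)
      search n h (later f) bad seen | inj₂ (l , r , z , z₀ , to , from) | no fresh =
        -- The search resumes at the visit where `from` ends, just after the configuration now
        -- recorded.
        search (suc l + n) (code r z ∷ h) (f (code r z))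
          (λ { (inj₁ (c , c∈ , c≤)) → fresh (Any.map (λ { refl → c≤ }) c∈) ; (inj₂ g) → bad g })
          (λ { (here refl) → r , z , refl , z₀ , initially (l + n) ◅◅ to , from
             ; (there c∈) → case seen c∈ of λ { (r′ , z′ , eq , z′₀ , start , loop) →
                 r′ , z′ , eq , z′₀ , start , loop ⁺++ path n (suc l) } })

      witness : Witness
      witness = search 0 [] (AF⇒Bar (dickson _)) (λ ()) (λ ())

    visited⇒witness : VisitedInfinitelyOften V′ qf → Witness
    visited⇒witness (x , init , next) = Visited.witness x (reach⇐ init)
      λ j → case next j of λ { (more {c' = r , u} a s rest) → r , u , (a , s) , reach⇐ rest }

    decide : Dec (VisitedInfinitelyOften V′ qf)
    decide = map′ witness⇒visited visited⇒witness witness?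

theorem7p3 : (d : ℕ) (V : VASSZ (suc d)) (qf : St V) → Dec (VisitedInfinitelyOften V qf)
theorem7p3 d V qf = Reachability.Repeated.decide V qf
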